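{- There is an algorithm which, given any string $T$ of length $n$ over an integer alphabet of size $n^{O(1)}$, computes the set $\mathsf{SAGP}_2(T)$ of all canonical longest single-arm-gapped palindromes for the type-2 pivots of $T$ in $O(n+\mathit{occ}_2)$ time and $O(n)$ space, where $\mathit{occ}_2=|\mathsf{SAGP}_2(T)|$.
   Context: Strings are over an integer alphabet $\Sigma=\{1,\dots,\sigma\}$ and are indexed from $1$; $T[i..j]$ is the substring from position $i$ to position $j$; $x^R$ denotes the reversal of the string $x$. SAGPs. A single-arm-gapped palindrome (SAGP) is a string of the form $wguu^Rw^R$ with $w,g,u$ non-empty strings (gap $g$ in the left arm). If such a string occurs in $T$ beginning at position $b$, i.e. $T[b..b+2|wu|+|g|-1]=wguu^Rw^R$, the position $i=b+|wgu|-1$ is the pivot of this occurrence, and the occurrence is represented by (and identified with) the quadruple $(i,|w|,|g|,|u|)$. Its arm length is $|wu|$. A SAGP for pivot $i$ in $T$ is longest for pivot $i$ if no SAGP for pivot $i$ in $T$ has larger arm length. Among all longest SAGPs for pivot $i$, those with the largest $|u|$ are called canonical longest SAGPs for pivot $i$. Types. The maximal (even-length) palindrome centered at position $i$ is $T[i-r+1..i+r]$ for the largest $r\ge 0$ such that this substring is a palindrome. A position $i$ of $T$ is of type-1 if there is a SAGP $wguu^Rw^R$ for pivot $i$ in $T$ such that $uu^R$ is the maximal palindrome centered at $i$; otherwise it is of type-2. $\mathsf{SAGP}_2(T)$ is the set of (quadruples of) canonical longest SAGPs for all type-2 positions $i$ of $T$ (a type-2 position may have no SAGP and then contributes nothing).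 Model: unit-cost word RAM in which integers polynomial in $n$ fit in $O(1)$ machine words; space is working space in words (not counting the reported output). -}

module Defs where

open import Data.Bool using (if_then_else_)
open import Data.Fin using (Fin; toℕ)
open import Data.List using (List; []; _∷_; _++_; [_]; length; map; reverse)
open import Data.List.Membership.Propositional using (_∈_)
open import Data.List.Relation.Unary.Unique.Propositional using (Unique)
open import Data.Nat using (ℕ; zero; suc; _+_; _*_; _∸_; _^_; _≤_; _<_; _⊔_; _/_; _%_; _<ᵇ_; _≡ᵇ_)
open import Data.Nat.Properties using (m^n≢0)
open import Data.Product using (_×_; ∃-syntax)
open import Function.Bundles using (_⇔_)
open import Relation.Binary.PropositionalEquality using (_≡_; _≢_)
open import Relation.Nullary using (¬_)

------------------------------------------------------------------------
-- Strings and single-arm-gapped palindromes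

-- The letter k ∈ {1,…,σ} is the element of Fin σ with toℕ equal to k - 1.
Str : ℕ → Set
Str σ = List (Fin σ)

letter : ∀ {σ} → Fin σ → ℕ
letter a = suc (toℕ a)

private variable
  σ : ℕ

-- T[b..b+|s|-1] = s, positions counted from 1.
_OccursIn_At_ : Str σ → Str σ → ℕ → Set
s OccursIn T At b = ∃[ x ] ∃[ y ] (T ≡ x ++ s ++ y × b ≡ suc (length x))

-- The quadruple (i , |w| , |g| , |u|).
record Quad : Set where
  constructor quad
  field
    pivot ∣w∣ ∣g∣ ∣u∣ : ℕ

  armLength : ℕ
  armLength = ∣w∣ + ∣u∣

open Quad public

sagp : (w g u : Str σ) → Str σ
sagp w g u = w ++ g ++ u ++ reverse u ++ reverse w

SAGP : Str σ → Quad → Set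
SAGP T (quad i lw lg lu) = ∃[ w ] ∃[ g ] ∃[ u ] ∃[ b ]
  ( w ≢ [] × g ≢ [] × u ≢ []
  × sagp w g u OccursIn T At b
  × i ≡ b + length (w ++ g ++ u) ∸ 1
  × lw ≡ length w × lg ≡ length g × lu ≡ length u )

Longest : Str σ → Quad → Set
Longest T q = SAGP T q ×
  (∀ q′ → SAGP T q′ → pivot q′ ≡ pivot q → armLength q′ ≤ armLength q)

CanonicalLongest : Str σ → Quad → Set
CanonicalLongest T q = Longest T q ×
  (∀ q′ → Longest T q′ → pivot q′ ≡ pivot q → ∣u∣ q′ ≤ ∣u∣ q)

-- T[i-r+1..i+r] lies within T and is a palindrome; the starting position b is
-- i-r+1, written without subtraction.
EvenPalindrome : Str σ → ℕ → ℕ → Set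
EvenPalindrome T i r = ∃[ s ] ∃[ b ]
  (s OccursIn T At b × b + r ≡ suc i × length s ≡ r + r × s ≡ reverse s)

MaximalRadius : Str σ → ℕ → ℕ → Set
MaximalRadius T i r = EvenPalindrome T i r × (∀ r′ → EvenPalindrome T i r′ → r′ ≤ r)

Position : Str σ → ℕ → Set
Position T i = 1 ≤ i × i ≤ length T

-- The factor uuᴿ of a SAGP for pivot i is centred at i, so it is the maximal
-- palindrome there exactly when |u| is the maximal radius.
Type1 : Str σ → ℕ → Set
Type1 T i = Position T i ×
  ∃[ q ] (SAGP T q × pivot q ≡ i × MaximalRadius T i (∣u∣ q))

Type2 : Str σ → ℕ → Set
Type2 T i = Position T i × ¬ Type1 T i

SAGP₂ : Str σ → Quad → Set
SAGP₂ T q = Type2 T (pivot q) × CanonicalLongest T q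

-- The list has each element of the set P exactly once, so its length is |P|.
_Enumerates_ : {A : Set} → List A → (A → Set) → Set
xs Enumerates P = Unique xs × (∀ x → (x ∈ xs) ⇔ P x)

------------------------------------------------------------------------
-- Unit-cost word RAM with w-bit words

data Op : Set where
  add sub mul div mod and or xor shl shr lt eq : Op

bitwise : (ℕ → ℕ → ℕ) → (w : ℕ) → ℕ → ℕ → ℕ
bitwise f zero    a b = 0
bitwise f (suc w) a b = f (a % 2) (b % 2) + 2 * bitwise f w (a / 2) (b / 2)

trunc : (w : ℕ) → ℕ → ℕ
trunc w a = _%_ a (2 ^ w) {{m^n≢0 2 w}}

-- Division and remainder by zero give 0.
⟦_⟧ : Op → (w : ℕ) → ℕ → ℕ → ℕ
⟦ add ⟧ w a b       = trunc w (a + b)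
⟦ sub ⟧ w a b       = trunc w (a + 2 ^ w ∸ b)
⟦ mul ⟧ w a b       = trunc w (a * b)
⟦ div ⟧ w a zero    = 0
⟦ div ⟧ w a (suc b) = trunc w (a / suc b)
⟦ mod ⟧ w a zero    = 0
⟦ mod ⟧ w a (suc b) = trunc w (a % suc b)
⟦ and ⟧ w a b       = bitwise _*_ w a b
⟦ or  ⟧ w a b       = bitwise _⊔_ w a b
⟦ xor ⟧ w a b       = bitwise (λ x y → (x + y) % 2) w a b
⟦ shl ⟧ w a b       = trunc w (a * 2 ^ b)
⟦ shr ⟧ w a b       = trunc w (_/_ a (2 ^ b) {{m^n≢0 2 b}})
⟦ lt  ⟧ w a b       = trunc w (if a <ᵇ b then 1 else 0)
⟦ eq  ⟧ w a b       = trunc w (if a ≡ᵇ b then 1 else 0)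

Reg : Set
Reg = ℕ

-- A program mentions finitely many registers, so they occupy O(1) words.
data Prog : Set where
  skip   : Prog
  imm    : (x : Reg) (k : ℕ) → Prog               -- x := k
  arith  : (op : Op) (x y z : Reg) → Prog         -- x := y op z
  load   : (x y : Reg) → Prog                     -- x := M[y]
  store  : (x y : Reg) → Prog                     -- M[x] := y
  report : (i w g u : Reg) → Prog                 -- write (i , w , g , u) to the output
  _⨾_    : (p q : Prog) → Prog
  ifnz   : (x : Reg) (p q : Prog) → Prog          -- if x ≠ 0 then p else q
  while  : (x : Reg) (p : Prog) → Prog            -- while x ≠ 0 do p

infixr 5 _⨾_

record State : Set where
  constructor state
  field
    reg : Reg → ℕ
    mem : ℕ → ℕ

open State public

_[_↦_] : (ℕ → ℕ) → ℕ → ℕ → (ℕ → ℕ)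
(f [ a ↦ v ]) a′ = if a′ ≡ᵇ a then v else f a′

-- Exec w m p s s′ t out: on w-bit words with a memory of m cells (addresses
-- 0,…,m-1), p started in s halts in s′ after t steps having written out.
-- An access outside the memory has no rule, so a program making one has no run.
-- Every basic instruction and every evaluation of a guard costs one step.
data Exec (w m : ℕ) : Prog → State → State → ℕ → List Quad → Set where

  skip   : ∀ {s} → Exec w m skip s s 1 []

  imm    : ∀ {x k r M} →
           Exec w m (imm x k) (state r M) (state (r [ x ↦ trunc w k ]) M) 1 []

  arith  : ∀ {op x y z r M} →
           Exec w m (arith op x y z) (state r M)
                (state (r [ x ↦ ⟦ op ⟧ w (r y) (r z) ]) M) 1 []

  load   : ∀ {x y r M} → r y < m →
           Exec w m (load x y) (state r M) (state (r [ x ↦ M (r y) ]) M) 1 []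

  store  : ∀ {x y r M} → r x < m →
           Exec w m (store x y) (state r M) (state r (M [ r x ↦ r y ])) 1 []

  report : ∀ {i a g u r M} →
           Exec w m (report i a g u) (state r M) (state r M) 1
                [ quad (r i) (r a) (r g) (r u) ]

  seq    : ∀ {p q s s′ s″ t t′ o o′} →
           Exec w m p s s′ t o → Exec w m q s′ s″ t′ o′ →
           Exec w m (p ⨾ q) s s″ (t + t′) (o ++ o′)

  if-nz  : ∀ {x p q s s′ t o} → reg s x ≢ 0 → Exec w m p s s′ t o →
           Exec w m (ifnz x p q) s s′ (suc t) o

  if-z   : ∀ {x p q s s′ t o} → reg s x ≡ 0 → Exec w m q s s′ t o →
           Exec w m (ifnz x p q) s s′ (suc t) o

  loop   : ∀ {x p s s′ s″ t t′ o o′} → reg s x ≢ 0 →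
           Exec w m p s s′ t o → Exec w m (while x p) s′ s″ t′ o′ →
           Exec w m (while x p) s s″ (suc (t + t′)) (o ++ o′)

  done   : ∀ {x p s} → reg s x ≡ 0 → Exec w m (while x p) s s 1 []

cells : List ℕ → ℕ → ℕ
cells []       _       = 0
cells (v ∷ vs) zero    = v
cells (v ∷ vs) (suc a) = cells vs a

-- M[0] = |T| and M[j] = T[j] for 1 ≤ j ≤ |T|; everything else is zero.
initial : (w : ℕ) → Str σ → State
initial w T = state (λ _ → 0) (cells (map (trunc w) (length T ∷ map letter T)))

-- Let r be the maximal radius at a pivot i. If i is of type 2, then |w| + |u| ≤ r
-- for every SAGP for i: otherwise wᴿ covers position i + r + 1, whose letter then
-- also occurs in w, that is, at or before i - r - 1, and that letter alone would
-- extend the maximal palindrome to a SAGP. So the longest SAGPs for i have the arm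
-- T[p..i], where p ≥ i - r + 1 is least such that T[p] occurs before p. As the
-- mirror image of the single letter T[p] can serve as wᴿ, the canonical ones are
-- those with |w| = 1, u = T[p+1..i] and w any occurrence of T[p] before p.
--
-- The letters are renamed to numbers up to n by radix refinement, one base n + 1
-- digit per round; the number of rounds is bounded because the alphabet is
-- polynomial. Then the previous and the first occurrence of each letter and the
-- next repeated position are found by scans, the radii by Manacher's algorithm,
-- and the occurrences of T[p] are listed along the links to previous occurrences.
-- Every loop but that of the rounds has a loop-free body, so its time is read off
-- a potential; a step of the last loop that reports is charged to the output.

module Submission where

open import Defs
open import Data.Bool.Base using (Bool; true; false; T; _∧_; if_then_else_)
open import Data.Empty using (⊥)
open import Data.Fin as Fin using (Fin; toℕ; #_)
open import Data.Fin.Properties using (toℕ<n; toℕ-injective) renaming (_≟_ to _≟ᶠ_)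
import Data.Integer.Base as ℤ
open import Data.List as List using (List; []; _∷_; _++_; [_]; length; map; reverse)
open import Data.List.Properties using (length-++; ++-assoc; length-reverse; unfold-reverse; reverse-++; reverse-involutive)
open import Data.List.Relation.Unary.Any using (here; there)
import Data.List.Relation.Unary.All as All
open import Data.List.Relation.Unary.AllPairs using ([]; _∷_)
open import Data.Nat
open import Data.Nat.DivMod using (m<n⇒m%n≡m; [m+n]%n≡m%n; [m+kn]%n≡m%n; m/n≤m; m%n≤m; m%n<n; m≡m%n+[m/n]*n; /-monoˡ-≤; m<n*o⇒m/o<n)
open import Data.Nat.Properties
open import Algebra.Properties.CommutativeSemigroup +-commutativeSemigroup using (interchange)
open import Data.Product using (_×_; _,_; proj₁; proj₂; ∃-syntax)
open import Data.Sum using (_⊎_; inj₁; inj₂; [_,_]′)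
open import Data.Unit using (tt)
open import Data.Vec as Vec using (Vec; []; _∷_; lookup; replicate) renaming (_[_]≔_ to _⟪_⟫≔_)
open import Data.Vec.N-ary using (N-ary; _$ⁿ_; ∀ⁿ; curryⁿ)
open import Data.Vec.Properties using (lookup∘update; lookup∘update′; lookup-replicate)
open import Function using (_∘_; case_of_)
open import Function.Bundles using (mk⇔; Equivalence)
open import Relation.Binary.PropositionalEquality hiding ([_])
open import Relation.Nullary using (¬_; yes; no; contradiction)


-- Linear arithmetic over ℕ

-- Renaming is forced by space: a letter can be as large as a polynomial in `n`, whereas every table
-- has `n + 1` cells. The program is not told the alphabet, so it finds the number of rounds itself,
-- dividing the largest letter by `n + 1` until nothing is left. That the type of a pivot can be
-- tested in constant time rests on monotonicity: the letter after a non-empty maximal palindrome of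
-- radius `r` makes `i` a type-1 pivot if it occurs before `i - r`, and if any occurrence lies
-- there, the first one does. The machine computes modulo `2 ^ w` in a bounded memory, so overflow
-- and stray accesses must be excluded at every instruction. The algorithm is therefore written in a
-- small language over ℕ whose weakest preconditions contain these exclusions; on a concrete loop
-- body they reduce to a nested tuple of bounds ending in the new invariant, and one proof about the
-- compiler serves all bodies. The combinatorics concerns functions from positions to ℕ and uses
-- their values only through equality, which is why names can replace letters in it.

module Linear where

  infixl 7 _:+_
  infixl 8 _:*_
  infix 6 _:≤_ _:<_ _:≡_
  infix 2 _⊢_

  data Term (k : ℕ) : Set where
    var  : Fin k → Term k
    lit  : ℕ → Term k
    _:+_ : Term k → Term k → Term k
    _:*_ : ℕ → Term k → Term k

  data Rel (k : ℕ) : Set where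
    _:≤_ _:<_ _:≡_ : Term k → Term k → Rel k
    :⊥ : Rel k

  data Sequent (k : ℕ) : Set where
    _⊢_ : List (Rel k) → Rel k → Sequent k

  module _ {k : ℕ} where

    ⟦_⟧ᵗ : Term k → Vec ℕ k → ℕ
    ⟦ var i ⟧ᵗ ρ = Vec.lookup ρ i
    ⟦ lit c ⟧ᵗ ρ = c
    ⟦ s :+ t ⟧ᵗ ρ = ⟦ s ⟧ᵗ ρ + ⟦ t ⟧ᵗ ρ
    ⟦ c :* t ⟧ᵗ ρ = c * ⟦ t ⟧ᵗ ρ

    ⟦_⟧ʳ : Rel k → Vec ℕ k → Set
    ⟦ s :≤ t ⟧ʳ ρ = ⟦ s ⟧ᵗ ρ ≤ ⟦ t ⟧ᵗ ρ
    ⟦ s :< t ⟧ʳ ρ = ⟦ s ⟧ᵗ ρ < ⟦ t ⟧ᵗ ρ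
    ⟦ s :≡ t ⟧ʳ ρ = ⟦ s ⟧ᵗ ρ ≡ ⟦ t ⟧ᵗ ρ
    ⟦ :⊥ ⟧ʳ ρ = ⊥

    hyps : List (Rel k) → Rel k → Vec ℕ k → Set
    hyps [] g ρ = ⟦ g ⟧ʳ ρ
    hyps (h ∷ hs) g ρ = ⟦ h ⟧ʳ ρ → hyps hs g ρ

    ⟦_⟧ˢ : Sequent k → Vec ℕ k → Set
    ⟦ hs ⊢ g ⟧ˢ = hyps hs g

  Form : ℕ → Set
  Form k = ℕ × Vec ℕ k

  dot : ∀ {k} → Vec ℕ k → Vec ℕ k → ℕ
  dot [] [] = 0
  dot (a ∷ as) (x ∷ xs) = a * x + dot as xs

  ⟦_⟧ᶠ : ∀ {k} → Form k → Vec ℕ k → ℕ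
  ⟦ c , as ⟧ᶠ ρ = c + dot as ρ

  unit : ∀ {k} → Fin k → Vec ℕ k
  unit Fin.zero = 1 ∷ Vec.replicate _ 0
  unit (Fin.suc i) = 0 ∷ unit i

  addᶠ : ∀ {k} → Form k → Form k → Form k
  addᶠ (c , as) (d , bs) = c + d , Vec.zipWith _+_ as bs

  scaleᶠ : ∀ {k} → ℕ → Form k → Form k
  scaleᶠ l (c , as) = l * c , Vec.map (l *_) as

  norm : ∀ {k} → Term k → Form k
  norm (var i) = 0 , unit i
  norm (lit c) = c , Vec.replicate _ 0
  norm (s :+ t) = addᶠ (norm s) (norm t)
  norm (c :* t) = scaleᶠ c (norm t)

  dot-zero : ∀ {k} (ρ : Vec ℕ k) → dot (Vec.replicate k 0) ρ ≡ 0
  dot-zero [] = refl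
  dot-zero (x ∷ ρ) = dot-zero ρ

  dot-unit : ∀ {k} i (ρ : Vec ℕ k) → dot (unit i) ρ ≡ Vec.lookup ρ i
  dot-unit Fin.zero (x ∷ ρ) rewrite dot-zero ρ = trans (+-identityʳ _) (+-identityʳ x)
  dot-unit (Fin.suc i) (x ∷ ρ) = dot-unit i ρ

  dot-add : ∀ {k} (as bs ρ : Vec ℕ k) → dot (Vec.zipWith _+_ as bs) ρ ≡ dot as ρ + dot bs ρ
  dot-add [] [] [] = refl
  dot-add (a ∷ as) (b ∷ bs) (x ∷ ρ) rewrite dot-add as bs ρ | *-distribʳ-+ x a b =
    interchange (a * x) (b * x) (dot as ρ) (dot bs ρ)

  dot-scale : ∀ {k} l (as ρ : Vec ℕ k) → dot (Vec.map (l *_) as) ρ ≡ l * dot as ρ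
  dot-scale l [] [] = sym (*-zeroʳ l)
  dot-scale l (a ∷ as) (x ∷ ρ) rewrite dot-scale l as ρ | *-assoc l a x =
    sym (*-distribˡ-+ l (a * x) (dot as ρ))

  addᶠ-sound : ∀ {k} (f g : Form k) ρ → ⟦ addᶠ f g ⟧ᶠ ρ ≡ ⟦ f ⟧ᶠ ρ + ⟦ g ⟧ᶠ ρ
  addᶠ-sound (c , as) (d , bs) ρ rewrite dot-add as bs ρ =
    interchange c d (dot as ρ) (dot bs ρ)

  scaleᶠ-sound : ∀ {k} l (f : Form k) ρ → ⟦ scaleᶠ l f ⟧ᶠ ρ ≡ l * ⟦ f ⟧ᶠ ρ
  scaleᶠ-sound l (c , as) ρ rewrite dot-scale l as ρ = sym (*-distribˡ-+ l c (dot as ρ))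

  norm-sound : ∀ {k} (t : Term k) ρ → ⟦ norm t ⟧ᶠ ρ ≡ ⟦ t ⟧ᵗ ρ
  norm-sound (var i) ρ = dot-unit i ρ
  norm-sound (lit c) ρ = trans (cong (λ z → c + z) (dot-zero ρ)) (+-identityʳ c)
  norm-sound (s :+ t) ρ = trans (addᶠ-sound (norm s) (norm t) ρ) (cong₂ _+_ (norm-sound s ρ) (norm-sound t ρ))
  norm-sound (c :* t) ρ = trans (scaleᶠ-sound c (norm t) ρ) (cong (c *_) (norm-sound t ρ))

  -- Two forms instead of a difference: with coefficients in ℕ nothing can be moved across `≤`.
  Ineq : ℕ → Set
  Ineq k = Form k × Form k

  Holds : ∀ {k} → Vec ℕ k → Ineq k → Set
  Holds ρ (l , r) = ⟦ l ⟧ᶠ ρ ≤ ⟦ r ⟧ᶠ ρ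

  data AllHold {k} (ρ : Vec ℕ k) : List (Ineq k) → Set where
    []  : AllHold ρ []
    _∷_ : ∀ {c cs} → Holds ρ c → AllHold ρ cs → AllHold ρ (c ∷ cs)

  -- A certificate is a list of multipliers for the hypotheses and the negated
  -- goal whose combination is absurd coefficient by coefficient.
  combine : ∀ {k} → List ℕ → List (Ineq k) → Ineq k
  combine (m ∷ ms) ((l , r) ∷ cs) =
    addᶠ (scaleᶠ m l) (proj₁ (combine ms cs)) , addᶠ (scaleᶠ m r) (proj₂ (combine ms cs))
  combine _ _ = (0 , Vec.replicate _ 0) , (0 , Vec.replicate _ 0)

  combine-sound : ∀ {k} {ρ : Vec ℕ k} ms {cs} → AllHold ρ cs → Holds ρ (combine ms cs)
  combine-sound [] _ = ≤-refl
  combine-sound (m ∷ ms) [] = ≤-refl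
  combine-sound {ρ = ρ} (m ∷ ms) {(l , r) ∷ cs} (h ∷ hs)
    rewrite addᶠ-sound (scaleᶠ m l) (proj₁ (combine ms cs)) ρ
          | addᶠ-sound (scaleᶠ m r) (proj₂ (combine ms cs)) ρ
          | scaleᶠ-sound m l ρ | scaleᶠ-sound m r ρ
    = +-mono-≤ (*-monoʳ-≤ m h) (combine-sound ms hs)

  _≤ᵛ_ : ∀ {k} → Vec ℕ k → Vec ℕ k → Bool
  [] ≤ᵛ [] = true
  (a ∷ as) ≤ᵛ (b ∷ bs) = (a ≤ᵇ b) ∧ (as ≤ᵛ bs)

  -- A larger constant and no smaller coefficient on the left make the left side exceed the right
  -- one at every valuation. That variables are nonnegative is built into this test.
  absurdᶜ : ∀ {k} → Ineq k → Bool
  absurdᶜ ((c , as) , (d , bs)) = (d <ᵇ c) ∧ (bs ≤ᵛ as)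

  ∧-split : ∀ {a b} → T (a ∧ b) → T a × T b
  ∧-split {true} {true} _ = _ , _

  ≤ᵛ-sound : ∀ {k} (as bs ρ : Vec ℕ k) → T (as ≤ᵛ bs) → dot as ρ ≤ dot bs ρ
  ≤ᵛ-sound [] [] [] _ = z≤n
  ≤ᵛ-sound (a ∷ as) (b ∷ bs) (x ∷ ρ) p with ∧-split {a ≤ᵇ b} p
  ... | p₁ , p₂ = +-mono-≤ (*-monoˡ-≤ x (≤ᵇ⇒≤ a b p₁)) (≤ᵛ-sound as bs ρ p₂)

  absurdᶜ-sound : ∀ {k} (c : Ineq k) {ρ} → T (absurdᶜ c) → Holds ρ c → ⊥
  absurdᶜ-sound ((c , as) , (d , bs)) {ρ} p h with ∧-split {d <ᵇ c} p
  ... | p₁ , p₂ = <⇒≱ (+-mono-<-≤ (<ᵇ⇒< d c p₁) (≤ᵛ-sound bs as ρ p₂)) h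

  -- The multipliers are found by Fourier–Motzkin elimination; nothing needs to be
  -- proved about it.
  private
    open ℤ using (ℤ; +_; -[1+_])

    Row : Set
    Row = List ℤ × List ℤ × List ℕ

    row : ∀ {k} → List ℕ → Ineq k → Row
    row ms ((c , as) , (d , bs)) =
      Vec.toList (Vec.zipWith (λ a b → + b ℤ.- + a) as bs) , (+ d ℤ.- + c ∷ []) , ms

    zip : {A : Set} → (A → A → A) → List A → List A → List A
    zip f (x ∷ xs) (y ∷ ys) = f x y ∷ zip f xs ys
    zip f _ _ = []

    resolve : ℕ → ℕ → Row → Row → Row
    resolve p q (as , c , ms) (bs , d , ns) =
      zip lc as bs , zip lc c d , zip (λ m n → p * m + q * n) ms ns
      where
      lc : ℤ → ℤ → ℤ
      lc x y = + p ℤ.* x ℤ.+ + q ℤ.* y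

    data Sign : Set where
      pos neg : ℕ → Row → Sign
      nil : Row → Sign

    sign : Row → Sign
    sign ([] , c , ms) = nil ([] , c , ms)
    sign (+ 0 ∷ as , c , ms) = nil (as , c , ms)
    sign (+ suc n ∷ as , c , ms) = pos (suc n) (as , c , ms)
    sign (-[1+ n ] ∷ as , c , ms) = neg (suc n) (as , c , ms)

    split : List Row → List (ℕ × Row) × List (ℕ × Row) × List Row
    split [] = [] , [] , []
    split (r ∷ rs) with sign r | split rs
    ... | pos n r′ | ps , ns , zs = (n , r′) ∷ ps , ns , zs
    ... | neg n r′ | ps , ns , zs = ps , (n , r′) ∷ ns , zs
    ... | nil r′   | ps , ns , zs = ps , ns , r′ ∷ zs

    -- Two opposite rows are the two halves of an equation.
    opposite : Row → Row → Bool
    opposite (as , c , _) (bs , d , _) = null (zip ℤ._+_ as bs) ∧ null (zip ℤ._+_ c d)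
      where
      null : List ℤ → Bool
      null [] = true
      null (+ 0 ∷ xs) = null xs
      null _ = false

    equation : List (ℕ × Row) → List (ℕ × Row) → List ((ℕ × Row) × (ℕ × Row))
    equation ps ns = List.concatMap
      (λ p → List.concatMap (λ q → if opposite (proj₂ p) (proj₂ q) then (p , q) ∷ [] else []) ns) ps

    cross : List (ℕ × Row) → List (ℕ × Row) → List Row
    cross ps ns = List.concatMap (λ { (p , r) → List.map (λ { (q , s) → resolve q p r s }) ns }) ps

    -- If an equation involves the variable, it suffices to substitute it.
    eliminate : List Row → List Row
    eliminate rs with split rs
    ... | ps , ns , zs with equation ps ns
    ... | [] = cross ps ns List.++ zs
    ... | (p , q) ∷ _ = cross ps (q ∷ []) List.++ cross (p ∷ []) ns List.++ zs

    iter : ℕ → List Row → List Row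
    iter zero rs = rs
    iter (suc k) rs = iter k (eliminate rs)

    pick : List Row → List ℕ
    pick [] = []
    pick ((_ , -[1+ _ ] ∷ _ , ms) ∷ rs) = ms
    pick (_ ∷ rs) = pick rs

    basis : ℕ → ℕ → List ℕ
    basis zero _ = []
    basis (suc m) zero = 1 ∷ List.replicate m 0
    basis (suc m) (suc i) = 0 ∷ basis m i

    rows : ∀ {k} → ℕ → ℕ → List (Ineq k) → List Row
    rows m i [] = []
    rows m i (c ∷ cs) = row (basis m i) c ∷ rows m (suc i) cs

    -- These rows steer the elimination but carry zero multipliers: `absurdᶜ` compares coefficients
    -- by `≤` and so accounts for them without a certificate entry.
    nonneg : ℕ → (k : ℕ) → List Row
    nonneg m k = List.map (λ i → List.map (λ a → + a) (Vec.toList (unit i)) , (+ 0 ∷ []) , List.replicate m 0)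
      (List.allFin k)

    multipliers : ∀ {k} → List (Ineq k) → List ℕ
    multipliers {k} cs = pick (iter k (rows (List.length cs) 0 cs List.++ nonneg (List.length cs) k))

  refute : ∀ {k} → List (Ineq k) → Bool
  refute cs = absurdᶜ (combine (multipliers cs) cs)

  refute-sound : ∀ {k} (cs : List (Ineq k)) {ρ} → T (refute cs) → AllHold ρ cs → ⊥
  refute-sound cs p hs = absurdᶜ-sound (combine (multipliers cs) cs) p (combine-sound (multipliers cs) hs)

  _≤ᶠ_ _<ᶠ_ : ∀ {k} → Term k → Term k → Ineq k
  s ≤ᶠ t = norm s , norm t
  s <ᶠ t = norm (lit 1 :+ s) , norm t

  ≤ᶠ-sound : ∀ {k} (s t : Term k) {ρ} → ⟦ s ⟧ᵗ ρ ≤ ⟦ t ⟧ᵗ ρ → Holds ρ (s ≤ᶠ t)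
  ≤ᶠ-sound s t {ρ} h = subst₂ _≤_ (sym (norm-sound s ρ)) (sym (norm-sound t ρ)) h

  <ᶠ-sound : ∀ {k} (s t : Term k) {ρ} → ⟦ s ⟧ᵗ ρ < ⟦ t ⟧ᵗ ρ → Holds ρ (s <ᶠ t)
  <ᶠ-sound s t = ≤ᶠ-sound (lit 1 :+ s) t

  check : ∀ {k} → List (Ineq k) → List (Rel k) → Rel k → Bool
  check cs (s :≤ t ∷ hs) g = check (s ≤ᶠ t ∷ cs) hs g
  check cs (s :< t ∷ hs) g = check (s <ᶠ t ∷ cs) hs g
  check cs (s :≡ t ∷ hs) g = check (s ≤ᶠ t ∷ t ≤ᶠ s ∷ cs) hs g
  check cs (:⊥ ∷ hs) g = true
  check cs [] (s :≤ t) = refute (t <ᶠ s ∷ cs)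
  check cs [] (s :< t) = refute (t ≤ᶠ s ∷ cs)
  check cs [] (s :≡ t) = refute (t <ᶠ s ∷ cs) ∧ refute (s <ᶠ t ∷ cs)
  check cs [] :⊥ = refute cs

  check-sound : ∀ {k} (cs : List (Ineq k)) hs g ρ → T (check cs hs g) → AllHold ρ cs → hyps hs g ρ
  check-sound cs (s :≤ t ∷ hs) g ρ p as h = check-sound _ hs g ρ p (≤ᶠ-sound s t h ∷ as)
  check-sound cs (s :< t ∷ hs) g ρ p as h = check-sound _ hs g ρ p (<ᶠ-sound s t h ∷ as)
  check-sound cs (s :≡ t ∷ hs) g ρ p as h =
    check-sound _ hs g ρ p (≤ᶠ-sound s t (≤-reflexive h) ∷ ≤ᶠ-sound t s (≤-reflexive (sym h)) ∷ as)
  check-sound cs (:⊥ ∷ hs) g ρ p as ()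
  check-sound cs [] (s :≤ t) ρ p as = ≮⇒≥ λ h → refute-sound _ p (<ᶠ-sound t s h ∷ as)
  check-sound cs [] (s :< t) ρ p as = ≰⇒> λ h → refute-sound _ p (≤ᶠ-sound t s h ∷ as)
  check-sound cs [] (s :≡ t) ρ p as with ∧-split {refute (t <ᶠ s ∷ cs)} p
  ... | p₁ , p₂ = ≤-antisym (≮⇒≥ λ h → refute-sound _ p₁ (<ᶠ-sound t s h ∷ as))
                            (≮⇒≥ λ h → refute-sound _ p₂ (<ᶠ-sound s t h ∷ as))
  check-sound cs [] :⊥ ρ p as = refute-sound cs p as

  checkˢ : ∀ {k} → Sequent k → Bool
  checkˢ (hs ⊢ g) = check [] hs g

  checkˢ-sound : ∀ {k} (s : Sequent k) → T (checkˢ s) → ∀ ρ → ⟦ s ⟧ˢ ρ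
  checkˢ-sound (hs ⊢ g) p ρ = check-sound [] hs g ρ p []

  close : ∀ k → N-ary k (Term k) (Sequent k) → Sequent k
  close k f = f $ⁿ Vec.map var (Vec.allFin k)

  -- Proof by reflection. The implicit argument reduces to `T true` when the search succeeds and is
  -- then filled by evaluation; products and truncated differences are passed as variables.
  lia : ∀ k (f : N-ary k (Term k) (Sequent k)) {_ : T (checkˢ (close k f))} → ∀ⁿ k (curryⁿ ⟦ close k f ⟧ˢ)
  lia k f {p} = curryP k (checkˢ-sound (close k f) p)
    where
    curryP : ∀ k {P : Vec ℕ k → Set} → (∀ ρ → P ρ) → ∀ⁿ k (curryⁿ P)
    curryP zero h = h []
    curryP (suc k) h x = curryP k (λ ρ → h (x ∷ ρ))

open Linear using (lia; lit; _:+_; _:*_; _:≤_; _:<_; _:≡_; :⊥; _⊢_)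

-- A structured language on the word RAM

[↦]-same : ∀ (f : ℕ → ℕ) a v → (f [ a ↦ v ]) a ≡ v
[↦]-same f a v with a ≡ᵇ a in b≡
... | true = refl
... | false = contradiction (subst T b≡ (≡⇒≡ᵇ a a refl)) λ ()

[↦]-other : ∀ (f : ℕ → ℕ) {a} v {b} → b ≢ a → (f [ a ↦ v ]) b ≡ f b
[↦]-other f {a} v {b} b≢a with b ≡ᵇ a in b≡
... | false = refl
... | true = contradiction (≡ᵇ⇒≡ b a (subst T (sym b≡) tt)) b≢a

[↦]-elim : ∀ (P : ℕ → ℕ → Set) f {i v} a → P i v → (a ≢ i → P a (f a)) → P a ((f [ i ↦ v ]) a)
[↦]-elim P f {i} {v} a p q with a ≟ i
... | yes refl = subst (P a) (sym ([↦]-same f a v)) p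
... | no a≢i = subst (P a) (sym ([↦]-other f v a≢i)) (q a≢i)

-- Uniqueness of division with remainder. It separates the addresses of different cells, so that a
-- write leaves all other cells of all arrays alone.
m+k*suc[n]-injective : ∀ {n i j} a b → i ≤ n → j ≤ n → i + a * suc n ≡ j + b * suc n → i ≡ j × a ≡ b
m+k*suc[n]-injective {n} {i} {j} a b i≤n j≤n sum≡ =
  i≡j , *-cancelʳ-≡ a b (suc n) (+-cancelˡ-≡ i _ _ (trans sum≡ (cong (_+ b * suc n) (sym i≡j))))
  where
  i≡j : i ≡ j
  i≡j = begin
    i                        ≡⟨ m<n⇒m%n≡m (s≤s i≤n) ⟨
    i % suc n                ≡⟨ [m+kn]%n≡m%n i a (suc n) ⟨
    (i + a * suc n) % suc n  ≡⟨ cong (_% suc n) sum≡ ⟩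
    (j + b * suc n) % suc n  ≡⟨ [m+kn]%n≡m%n j b (suc n) ⟩
    j % suc n                ≡⟨ m<n⇒m%n≡m (s≤s j≤n) ⟩
    j                        ∎
    where open ≡-Reasoning

-- A language with V variables and A arrays of n + 1 cells, where n + 1 sits in
-- register 0, variable x in register x + 1, temporaries in the registers from
-- V + 1 on, and cell j of array a at address j + a (n + 1).
module Language (V A : ℕ) where

  infixl 8 _at_
  infixl 7 _⊕_ _⊖_
  infix 6 _≺_ _≈_
  infix 5 _≔_ _⟨_⟩≔_
  infixr 4 _⨟_
  infix 5 if_then_else_end

  data Exp : Set where
    var     : Fin V → Exp
    #0 #1   : Exp
    _at_    : Fin A → Exp → Exp
    _⊕_ _⊖_ : Exp → Exp → Exp
    quo rem : Exp → Exp         -- by n + 1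

  data Cond : Set where
    _≺_ _≈_ : Exp → Exp → Cond

  data Stm : Set where
    _≔_     : Fin V → Exp → Stm
    _⟨_⟩≔_  : Fin A → Exp → Exp → Stm
    write   : (i w g u : Exp) → Stm
    nop     : Stm
    _⨟_     : Stm → Stm → Stm
    if_then_else_end : Cond → Stm → Stm → Stm

  opaque

    -- Opaque, since the bounds only need that costs do not depend on `n`. The sums are bracketed as
    -- `seq` adds times, so that a compiled expression takes its cost by definition.
    expCost : Exp → ℕ
    expCost (var x) = 2
    expCost #0 = 1
    expCost #1 = 1
    expCost (a at e) = expCost e + (3 + 1)
    expCost (e ⊕ f) = expCost e + (expCost f + 1)
    expCost (e ⊖ f) = expCost e + (expCost f + 1)
    expCost (quo e) = expCost e + 1
    expCost (rem e) = expCost e + 1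

    condCost : Cond → ℕ
    condCost (e ≺ f) = expCost e + (expCost f + 1)
    condCost (e ≈ f) = expCost e + (expCost f + 1)

    cost : Stm → ℕ
    cost (x ≔ e) = expCost e + 2
    cost (a ⟨ e ⟩≔ f) = expCost e + (3 + (expCost f + 1))
    cost (write i w g u) = expCost i + (expCost w + (expCost g + (expCost u + 1)))
    cost nop = 1
    cost (s ⨟ t) = cost s + cost t
    -- The sum of both branches instead of their maximum; either is a constant.
    cost (if c then s else t end) = condCost c + suc (cost s + cost t)

    -- The factor is `suc μ` because the final failing test is paid like one more pass.
    loopCost : Cond → ℕ → ℕ → ℕ
    loopCost c t μ = suc μ * (suc (condCost c) + t)

  address : Fin A → Reg → Prog
  address a t = imm (suc t) (toℕ a) ⨾ arith mul (suc t) (suc t) 0 ⨾ arith add t t (suc t)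

  evalInto : Exp → Reg → Prog
  -- The machine has no move instruction, so a copy is an addition to 0.
  evalInto (var x) t = imm t 0 ⨾ arith add t (suc (toℕ x)) t
  evalInto #0 t = imm t 0
  evalInto #1 t = imm t 1
  evalInto (a at e) t = evalInto e t ⨾ address a t ⨾ load t t
  evalInto (e ⊕ f) t = evalInto e t ⨾ evalInto f (suc t) ⨾ arith add t t (suc t)
  evalInto (e ⊖ f) t = evalInto e t ⨾ evalInto f (suc t) ⨾ arith sub t t (suc t)
  evalInto (quo e) t = evalInto e t ⨾ arith div t t 0
  evalInto (rem e) t = evalInto e t ⨾ arith mod t t 0

  testInto : Cond → Reg → Prog
  testInto (e ≺ f) t = evalInto e t ⨾ evalInto f (suc t) ⨾ arith lt t t (suc t)
  testInto (e ≈ f) t = evalInto e t ⨾ evalInto f (suc t) ⨾ arith eq t t (suc t)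

  temp : Reg
  temp = suc V

  opaque

    compile : Stm → Prog
    compile (x ≔ e) = evalInto e temp ⨾ imm (suc (toℕ x)) 0 ⨾ arith add (suc (toℕ x)) (suc (toℕ x)) temp
    compile (a ⟨ e ⟩≔ f) = evalInto e temp ⨾ address a temp ⨾ evalInto f (suc temp) ⨾ store temp (suc temp)
    compile (write i w g u) = evalInto i temp ⨾ evalInto w (1 + temp) ⨾ evalInto g (2 + temp) ⨾ evalInto u
      (3 + temp) ⨾ report temp (1 + temp) (2 + temp) (3 + temp)
    compile nop = skip
    compile (s ⨟ t) = compile s ⨾ compile t
    compile (if c then s else t end) = testInto c temp ⨾ ifnz temp (compile s) (compile t)

    -- The guard of a `while` is a register; hence the test is evaluated once before the loop and
    -- again at the end of every pass.
    loopWhile : Cond → Prog → Prog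
    loopWhile c p = testInto c temp ⨾ while temp (p ⨾ testInto c temp)

  Vars Arrs : Set
  Vars = Vec ℕ V
  Arrs = Vec (ℕ → ℕ) A

  Post : Set₁
  Post = Vars → Arrs → List Quad → Set

  -- Meaning over ℕ and weakest preconditions

  module Semantics (n : ℕ) where

    ⟦_⟧ᵉ : Exp → Vars → Arrs → ℕ
    ⟦ var x ⟧ᵉ vs as = lookup vs x
    ⟦ #0 ⟧ᵉ vs as = 0
    ⟦ #1 ⟧ᵉ vs as = 1
    ⟦ a at e ⟧ᵉ vs as = lookup as a (⟦ e ⟧ᵉ vs as)
    ⟦ e ⊕ f ⟧ᵉ vs as = ⟦ e ⟧ᵉ vs as + ⟦ f ⟧ᵉ vs as
    ⟦ e ⊖ f ⟧ᵉ vs as = ⟦ e ⟧ᵉ vs as ∸ ⟦ f ⟧ᵉ vs as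
    ⟦ quo e ⟧ᵉ vs as = ⟦ e ⟧ᵉ vs as / suc n
    ⟦ rem e ⟧ᵉ vs as = ⟦ e ⟧ᵉ vs as % suc n

    -- K together with the conditions under which the word operations of the
    -- compiled expression agree with those on ℕ.
    safe : Exp → Vars → Arrs → Set → Set
    safe (var x) vs as K = K
    safe #0 vs as K = K
    safe #1 vs as K = K
    safe (a at e) vs as K = safe e vs as (⟦ e ⟧ᵉ vs as ≤ n × K)
    -- Twice the array size, because sums of two positions such as `D ⊕ D` occur.
    safe (e ⊕ f) vs as K = safe e vs as (safe f vs as (⟦ e ⟧ᵉ vs as + ⟦ f ⟧ᵉ vs as ≤ suc n + suc n × K))
    safe (e ⊖ f) vs as K = safe e vs as (safe f vs as (⟦ f ⟧ᵉ vs as ≤ ⟦ e ⟧ᵉ vs as × K))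
    safe (quo e) vs as K = safe e vs as K
    safe (rem e) vs as K = safe e vs as K

    True False : Cond → Vars → Arrs → Set
    True (e ≺ f) vs as = ⟦ e ⟧ᵉ vs as < ⟦ f ⟧ᵉ vs as
    True (e ≈ f) vs as = ⟦ e ⟧ᵉ vs as ≡ ⟦ f ⟧ᵉ vs as
    False (e ≺ f) vs as = ⟦ f ⟧ᵉ vs as ≤ ⟦ e ⟧ᵉ vs as
    False (e ≈ f) vs as = ⟦ e ⟧ᵉ vs as ≢ ⟦ f ⟧ᵉ vs as

    safeᶜ : Cond → Vars → Arrs → Set → Set
    safeᶜ (e ≺ f) vs as K = safe e vs as (safe f vs as K)
    safeᶜ (e ≈ f) vs as K = safe e vs as (safe f vs as K)

    safe-map : ∀ e {vs as K K′} → (K → K′) → safe e vs as K → safe e vs as K′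
    safe-map (var x) h = h
    safe-map #0 h = h
    safe-map #1 h = h
    safe-map (a at e) h = safe-map e λ { (b , k) → b , h k }
    safe-map (e ⊕ f) h = safe-map e (safe-map f λ { (b , k) → b , h k })
    safe-map (e ⊖ f) h = safe-map e (safe-map f λ { (b , k) → b , h k })
    safe-map (quo e) h = safe-map e h
    safe-map (rem e) h = safe-map e h

    safeᶜ-map : ∀ c {vs as K K′} → (K → K′) → safeᶜ c vs as K → safeᶜ c vs as K′
    safeᶜ-map (e ≺ f) h = safe-map e (safe-map f h)
    safeᶜ-map (e ≈ f) h = safe-map e (safe-map f h)

    wp : Stm → Post → Vars → Arrs → Set
    wp (x ≔ e) Q vs as = safe e vs as (Q (vs ⟪ x ⟫≔ ⟦ e ⟧ᵉ vs as) as [])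
    wp (a ⟨ e ⟩≔ f) Q vs as = safe e vs as (⟦ e ⟧ᵉ vs as ≤ n ×
      safe f vs as (Q vs (as ⟪ a ⟫≔ lookup as a [ ⟦ e ⟧ᵉ vs as ↦ ⟦ f ⟧ᵉ vs as ]) []))
    wp (write i w g u) Q vs as = safe i vs as (safe w vs as (safe g vs as (safe u vs as
      (Q vs as [ quad (⟦ i ⟧ᵉ vs as) (⟦ w ⟧ᵉ vs as) (⟦ g ⟧ᵉ vs as) (⟦ u ⟧ᵉ vs as) ]))))
    wp nop Q vs as = Q vs as []
    wp (s ⨟ t) Q vs as = wp s (λ vs as o → wp t (λ vs as o′ → Q vs as (o ++ o′)) vs as) vs as
    wp (if c then s else t end) Q vs as =
      safeᶜ c vs as ((True c vs as → wp s Q vs as) × (False c vs as → wp t Q vs as))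

    ≤n⇒safe : ∀ {x} → x ≤ n → x ≤ suc n + suc n
    ≤n⇒safe x≤n = ≤-trans x≤n (≤-trans (n≤1+n n) (m≤m+n (suc n) (suc n)))

    -- `wp` computes, so `s` and `Q` could not be inferred from its reduced form; the record keeps
    -- them visible.
    record Wp (s : Stm) (Q : Post) (vs : Vars) (as : Arrs) : Set where
      constructor [_]ʷ
      field unWp : wp s Q vs as

    -- κ is the time charged to each reported quadruple.
    module Execution (w m κ : ℕ) (A≤m : A * suc n ≤ m) (A≤2^w : A * suc n ≤ 2 ^ w)
      (2n<2^w : suc n + suc n < 2 ^ w) where

      record Agree (vs : Vars) (as : Arrs) (r M : ℕ → ℕ) : Set where
        constructor agree
        field
          size  : r 0 ≡ suc n
          vars  : ∀ x → r (suc (toℕ x)) ≡ lookup vs x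
          vars< : ∀ x → lookup vs x < 2 ^ w
          arrs  : ∀ a {j} → j ≤ n → M (j + toℕ a * suc n) ≡ lookup as a j
          arrs< : ∀ a {j} → j ≤ n → lookup as a j < 2 ^ w
      open Agree

      trunc-< : ∀ {a} → a < 2 ^ w → trunc w a ≡ a
      trunc-< = m<n⇒m%n≡m {{m^n≢0 2 w}}

      -- When `b ≤ a`, the `2 ^ w` that the machine adds before subtracting is one full turn of the
      -- modulus.
      trunc-∸ : ∀ {a b} → b ≤ a → a < 2 ^ w → trunc w (a + 2 ^ w ∸ b) ≡ a ∸ b
      trunc-∸ {a} {b} b≤a a< =
        trans (cong (trunc w)
        (trans (cong (_∸ b) (+-comm a (2 ^ w))) (trans (+-∸-assoc (2 ^ w) b≤a) (+-comm (2 ^ w) (a ∸ b)))))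
        (trans ([m+n]%n≡m%n (a ∸ b) (2 ^ w) {{m^n≢0 2 w}}) (trunc-< (≤-<-trans (m∸n≤m a b) a<)))

      1<2^w : 1 < 2 ^ w
      1<2^w = lia 2 (λ n p → (lit 1 :+ n) :+ (lit 1 :+ n) :< p ∷ [] ⊢ lit 1 :< p) n (2 ^ w) 2n<2^w

      toℕ+n< : ∀ (a : Fin A) {j} → j ≤ n → j + toℕ a * suc n < A * suc n
      toℕ+n< a {j} j≤n = ≤-trans (+-monoˡ-≤ (toℕ a * suc n) (s≤s j≤n)) (*-monoˡ-≤ (suc n) (toℕ<n a))

      Agree-regs : ∀ {vs as r r′ M t} → temp ≤ t → (∀ x → x < t → r′ x ≡ r x) → Agree vs as r M → Agree vs as r′ M
      Agree-regs {t = t} V<t same (agree s v v< a a<) = agree (trans (same 0 (≤-trans (s≤s z≤n) V<t)) s)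
        (λ x → trans (same (suc (toℕ x)) (≤-trans (s≤s (toℕ<n x)) V<t)) (v x)) v< a a<

      -- `frame` is what lets an operand in `t` survive the evaluation of the next one in `suc t`,
      -- and the variables survive both.
      record Evaluated (p : Prog) (c : ℕ) (t : Reg) (P : ℕ → Set) (r M : ℕ → ℕ) : Set where
        constructor evaluated
        field
          {r′}  : ℕ → ℕ
          run   : Exec w m p (state r M) (state r′ M) c []
          value : P (r′ t)
          frame : ∀ x → x < t → r′ x ≡ r x

      [↦]-below : ∀ (r : ℕ → ℕ) {t} v x → x < t → (r [ t ↦ v ]) x ≡ r x
      [↦]-below r v x x<t = [↦]-other r v (<⇒≢ x<t)

      operate : ∀ {op t y z r M} {P : ℕ → Set} → P (⟦ op ⟧ w (r y) (r z)) → Evaluated (arith op t y z) 1 t P r M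
      operate {op} {t} {y} {z} {r} {P = P} v = evaluated arith (subst P (sym ([↦]-same r t _)) v) ([↦]-below r _)

      Value : ℕ → ℕ → Set
      Value v z = z ≡ v × v < 2 ^ w

      infixr 5 _then_
      _then_ : ∀ {p q c d t P Q r M} → (ev : Evaluated p c t P r M) → Evaluated q d t Q (Evaluated.r′ ev) M → Evaluated
        (p ⨾ q) (c + d) t Q r M
      evaluated x v f then evaluated x′ v′ f′ = evaluated (seq x x′) v′ λ y y< → trans (f′ y y<) (f y y<)

      addressed : ∀ (a : Fin A) t {j r M} → temp ≤ t → r 0 ≡ suc n → r t ≡ j → j ≤ n →
        Evaluated (address a t) 3 t (λ z → z ≡ j + toℕ a * suc n) r M
      addressed a t {j} {r} {M} (s≤s V≤t) s refl j≤n =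
        evaluated (seq imm (seq arith arith)) (trans ([↦]-same r₂ t _) eq₄) λ x x<t →
          trans ([↦]-below r₂ _ x x<t) (trans ([↦]-below r₁ _ x (m≤n⇒m≤1+n x<t)) ([↦]-below r _ x (m≤n⇒m≤1+n x<t)))
        where
        r₁ r₂ : ℕ → ℕ
        r₁ = r [ suc t ↦ trunc w (toℕ a) ]
        r₂ = r₁ [ suc t ↦ trunc w (r₁ (suc t) * r₁ 0) ]
        bound : j + toℕ a * suc n < 2 ^ w
        bound = <-≤-trans (toℕ+n< a j≤n) A≤2^w
        bound′ : toℕ a * suc n < 2 ^ w
        bound′ = ≤-<-trans (m≤n+m _ j) bound
        eq₁ : r₁ (suc t) ≡ toℕ a
        eq₁ = trans ([↦]-same r (suc t) _) (trunc-< (≤-<-trans (m≤m*n (toℕ a) (suc n)) bound′))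
        eq₂ : r₂ (suc t) ≡ toℕ a * suc n
        eq₂ = trans ([↦]-same r₁ (suc t) _) (trans (cong (trunc w) (cong₂ _*_ eq₁ s)) (trunc-< bound′))
        eq₃ : r₂ t ≡ r t
        eq₃ = trans ([↦]-below r₁ _ t ≤-refl) ([↦]-below r _ t ≤-refl)
        eq₄ : trunc w (r₂ t + r₂ (suc t)) ≡ r t + toℕ a * suc n
        eq₄ = trans (cong (trunc w) (cong₂ _+_ eq₃ eq₂)) (trunc-< bound)

      Tested : Cond → Vars → Arrs → ℕ → Set
      Tested c vs as z = (z ≢ 0 × True c vs as) ⊎ (z ≡ 0 × False c vs as)

      lt-tested : ∀ a b → (⟦ lt ⟧ w a b ≢ 0 × a < b) ⊎ (⟦ lt ⟧ w a b ≡ 0 × b ≤ a)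
      lt-tested a b with a <ᵇ b in b≡
      ... | true = inj₁ ((λ z → 1+n≢0 (trans (sym (trunc-< 1<2^w)) z)) , <ᵇ⇒< a b (subst T (sym b≡) tt))
      ... | false = inj₂ (trunc-< (<-trans (n<1+n 0) 1<2^w) , ≮⇒≥ λ a<b → subst T b≡ (<⇒<ᵇ a<b))

      eq-tested : ∀ a b → (⟦ eq ⟧ w a b ≢ 0 × a ≡ b) ⊎ (⟦ eq ⟧ w a b ≡ 0 × a ≢ b)
      eq-tested a b with a ≡ᵇ b in b≡
      ... | true = inj₁ ((λ z → 1+n≢0 (trans (sym (trunc-< 1<2^w)) z)) , ≡ᵇ⇒≡ a b (subst T (sym b≡) tt))
      ... | false = inj₂ (trunc-< (<-trans (n<1+n 0) 1<2^w) , λ a≡b → subst T b≡ (≡⇒≡ᵇ a b a≡b))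

      opaque
        unfolding expCost

        -- The side conditions are consumed in the order of evaluation; what remains of them, `K`,
        -- is handed back for the code that follows.
        eval : ∀ e {t vs as r M K} → temp ≤ t → Agree vs as r M → safe e vs as K →
               Evaluated (evalInto e t) (expCost e) t (Value (⟦ e ⟧ᵉ vs as)) r M × K

        eval₂ : ∀ e f {t vs as r M K} → temp ≤ t → Agree vs as r M → safe e vs as (safe f vs as K) → ∃[ r₁ ] ∃[ r′ ]
                (Exec w m (evalInto e t) (state r M) (state r₁ M) (expCost e) []
                × Exec w m (evalInto f (suc t)) (state r₁ M) (state r′ M) (expCost f) []
                × Value (⟦ e ⟧ᵉ vs as) (r′ t) × Value (⟦ f ⟧ᵉ vs as) (r′ (suc t)) × (∀ x → x < t → r′ x ≡ r x)) × K

        binary : ∀ e f {op t vs as r M K P} → temp ≤ t → Agree vs as r M → safe e vs as (safe f vs as K) →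
                 (∀ {y z} → Value (⟦ e ⟧ᵉ vs as) y → Value (⟦ f ⟧ᵉ vs as) z → K → P (⟦ op ⟧ w y z)) →
                 Evaluated (evalInto e t ⨾ evalInto f (suc t) ⨾ arith op t t (suc t))
                   (expCost e + (expCost f + 1)) t P r M × K

        eval (var x) {t} {r = r} V<t ag k =
          evaluated (seq imm arith)
          (trans ([↦]-same (r [ t ↦ trunc w 0 ]) t _)
          (trans (cong (trunc w)
          (trans (cong₂ _+_ ([↦]-below r _ _ (≤-trans (s≤s (toℕ<n x)) V<t)) ([↦]-same r t (trunc w 0)))
          (trans (cong₂ _+_ (vars ag x) (trunc-< (<-trans (n<1+n 0) 1<2^w))) (+-identityʳ _))))
          (trunc-< (vars< ag x))) , vars< ag x)
          (λ y y<t → trans ([↦]-below (r [ t ↦ trunc w 0 ]) _ y y<t) ([↦]-below r _ y y<t)) , k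
        eval #0 {t} {r = r} V<t ag k = evaluated imm (trans ([↦]-same r t _) (trunc-< 0<) , 0<) ([↦]-below r _) , k
          where
          0< : 0 < 2 ^ w
          0< = <-trans (n<1+n 0) 1<2^w
        eval #1 {t} {r = r} V<t ag k = evaluated imm (trans ([↦]-same r t _) (trunc-< 1<2^w) , 1<2^w) ([↦]-below r _) ,
          k
        eval (a at e) {t} {r = r} {M} V<t ag k with eval e V<t ag k
        ... | evaluated {r₁} run (v , v<) f , j≤n , k′ with addressed a t {r = r₁} {M = M} V<t
          (trans (f 0 (≤-trans (s≤s z≤n) V<t)) (size ag)) v j≤n
        ... | evaluated {r₂} run₁ v′ f′ =
          evaluated (seq run (seq run₁ (load (subst (_< m) (sym v′) (<-≤-trans (toℕ+n< a j≤n) A≤m)))))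
            (trans ([↦]-same r₂ t _) (trans (cong M v′) (arrs ag a j≤n)) , arrs< ag a j≤n)
            (λ x x<t → trans ([↦]-below r₂ _ x x<t) (trans (f′ x x<t) (f x x<t))) , k′
        eval (e ⊕ f) {t} {vs} {as} {r} V<t ag k with binary e f {P =
          λ z → z ≡ ⟦ e ⟧ᵉ vs as + ⟦ f ⟧ᵉ vs as × ⟦ e ⟧ᵉ vs as + ⟦ f ⟧ᵉ vs as < 2 ^ w} V<t ag k
            (λ { (refl , _) (refl , _) (b , _) → trunc-< (≤-<-trans b 2n<2^w) , ≤-<-trans b 2n<2^w })
        ... | ev , _ , k′ = ev , k′
        eval (e ⊖ f) {t} {vs} {as} {r} V<t ag k with binary e f {P =
          λ z → z ≡ ⟦ e ⟧ᵉ vs as ∸ ⟦ f ⟧ᵉ vs as × ⟦ e ⟧ᵉ vs as ∸ ⟦ f ⟧ᵉ vs as < 2 ^ w} V<t ag k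
            (λ { (refl , v<) (refl , _) (b , _) → trunc-∸ b v< , ≤-<-trans (m∸n≤m _ (⟦ f ⟧ᵉ vs as)) v< })
        ... | ev , _ , k′ = ev , k′
        eval (quo e) {t} {vs} {as} {r} V<t ag k with eval e V<t ag k
        ... | ev@(evaluated run (v , v<) f) , k′ =
          (ev then operate (subst₂ (λ y z → Value (⟦ e ⟧ᵉ vs as / suc n) (⟦ div ⟧ w y z)) (sym v)
          (sym (trans (f 0 (≤-trans (s≤s z≤n) V<t)) (size ag))) (trunc-< b , b))) , k′
          where
          b : ⟦ e ⟧ᵉ vs as / suc n < 2 ^ w
          b = ≤-<-trans (m/n≤m _ (suc n)) v<
        eval (rem e) {t} {vs} {as} {r} V<t ag k with eval e V<t ag k
        ... | ev@(evaluated run (v , v<) f) , k′ =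
          (ev then operate (subst₂ (λ y z → Value (⟦ e ⟧ᵉ vs as % suc n) (⟦ mod ⟧ w y z)) (sym v)
          (sym (trans (f 0 (≤-trans (s≤s z≤n) V<t)) (size ag))) (trunc-< b , b))) , k′
          where
          b : ⟦ e ⟧ᵉ vs as % suc n < 2 ^ w
          b = ≤-<-trans (m%n≤m _ (suc n)) v<

        eval₂ e f {t} {vs} {as} V<t ag k with eval e V<t ag k
        ... | evaluated {r₁} run₁ v₁ f₁ , k₁ with eval f {suc t} (m≤n⇒m≤1+n V<t)
          (Agree-regs {vs} {as} {r′ = r₁} V<t f₁ ag) k₁
        ... | evaluated {r₂} run₂ v₂ f₂ , k₂ =
          r₁ , r₂ , (run₁ , run₂ , subst (Value (⟦ e ⟧ᵉ vs as)) (sym (f₂ t ≤-refl)) v₁ , v₂ ,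
          λ x x<t → trans (f₂ x (m≤n⇒m≤1+n x<t)) (f₁ x x<t)) , k₂

        binary e f {P = P} V<t ag k h with eval₂ e f V<t ag k
        ... | r₁ , r₂ , (run₁ , run₂ , v₁ , v₂ , f₂) , k₂ =
          evaluated (seq run₁ (seq run₂ arith)) (subst P (sym ([↦]-same r₂ _ _)) (h v₁ v₂ k₂))
          (λ x x<t → trans ([↦]-below r₂ _ x x<t) (f₂ x x<t)) , k₂

        test : ∀ c {vs as r M K} → Agree vs as r M → safeᶜ c vs as K →
               Evaluated (testInto c temp) (condCost c) temp (Tested c vs as) r M × K
        test (e ≺ f) ag k = binary e f ≤-refl ag k λ { (refl , _) (refl , _) _ → lt-tested _ _ }
        test (e ≈ f) ag k = binary e f ≤-refl ag k λ { (refl , _) (refl , _) _ → eq-tested _ _ }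

      Agree-var : ∀ {vs as r M} x {v} → v < 2 ^ w → Agree vs as r M → Agree (vs ⟪ x ⟫≔ v) as (r [ suc (toℕ x) ↦ v ]) M
      Agree-var {vs} {r = r} x {v} v< (agree s va va< a a<) =
        agree (trans ([↦]-other r {suc (toℕ x)} v λ ()) s) vars′ vars<′ a a<
        where
        vars′ : ∀ y → (r [ suc (toℕ x) ↦ v ]) (suc (toℕ y)) ≡ lookup (vs ⟪ x ⟫≔ v) y
        vars′ y with x ≟ᶠ y
        ... | yes refl = trans ([↦]-same r (suc (toℕ x)) v) (sym (lookup∘update x vs v))
        ... | no x≢y = trans ([↦]-other r v (λ sx≡sy → x≢y (sym (toℕ-injective (suc-injective sx≡sy)))))
          (trans (va y) (sym (lookup∘update′ (x≢y ∘ sym) vs v)))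
        vars<′ : ∀ y → lookup (vs ⟪ x ⟫≔ v) y < 2 ^ w
        vars<′ y with x ≟ᶠ y
        ... | yes refl = subst (_< 2 ^ w) (sym (lookup∘update x vs v)) v<
        ... | no x≢y = subst (_< 2 ^ w) (sym (lookup∘update′ (x≢y ∘ sym) vs v)) (va< y)

      Agree-cell : ∀ {vs as r M} a {i v} → i ≤ n → v < 2 ^ w → Agree vs as r M →
                   Agree vs (as ⟪ a ⟫≔ lookup as a [ i ↦ v ]) r (M [ i + toℕ a * suc n ↦ v ])
      Agree-cell {vs} {as} {r} {M} a {i} {v} i≤n v< (agree s va va< ar ar<) = agree s va va< arrs′ arrs<′
        where
        as′ : Arrs
        as′ = as ⟪ a ⟫≔ lookup as a [ i ↦ v ]
        arrs′ : ∀ b {j} → j ≤ n → (M [ i + toℕ a * suc n ↦ v ]) (j + toℕ b * suc n) ≡ lookup as′ b j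
        arrs′ b {j} j≤n with a ≟ᶠ b
        ... | no a≢b = trans
          ([↦]-other M v λ sum≡ → a≢b (sym (toℕ-injective (proj₂ (m+k*suc[n]-injective (toℕ b) (toℕ a) j≤n i≤n sum≡)))))
                         (trans (ar b j≤n) (cong (λ h → h j) (sym (lookup∘update′ (a≢b ∘ sym) as _))))
        ... | yes refl rewrite lookup∘update a as (lookup as a [ i ↦ v ]) with j ≟ i
        ... | yes refl = trans ([↦]-same M _ v) (sym ([↦]-same (lookup as a) j v))
        ... | no j≢i = trans ([↦]-other M v λ sum≡ → j≢i (+-cancelʳ-≡ (toℕ a * suc n) j i sum≡))
          (trans (ar a j≤n) (sym ([↦]-other (lookup as a) v j≢i)))
        arrs<′ : ∀ b {j} → j ≤ n → lookup as′ b j < 2 ^ w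
        arrs<′ b {j} j≤n with a ≟ᶠ b
        ... | no a≢b rewrite lookup∘update′ (a≢b ∘ sym) as (lookup as a [ i ↦ v ]) = ar< b j≤n
        ... | yes refl rewrite lookup∘update a as (lookup as a [ i ↦ v ]) with j ≟ i
        ... | yes refl rewrite [↦]-same (lookup as a) j v = v<
        ... | no j≢i rewrite [↦]-other (lookup as a) v j≢i = ar< a j≤n

      -- The time bound `B` is a function of the output, so that a report can pay for the step that
      -- makes it.
      record Run (p : Prog) (B : List Quad → ℕ) (Q : Post) (r M : ℕ → ℕ) : Set where
        constructor ran
        field
          {steps} : ℕ
          {out}   : List Quad
          {vs′}   : Vars
          {as′}   : Arrs
          {r′ M′} : ℕ → ℕ
          run     : Exec w m p (state r M) (state r′ M′) steps out
          steps≤  : steps ≤ B out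
          agrees  : Agree vs′ as′ r′ M′
          post    : Q vs′ as′ out

      record Spec (p : Prog) (B : List Quad → ℕ) (Q : Post) (vs : Vars) (as : Arrs) : Set where
        constructor spec
        field from : ∀ {r M} → Agree vs as r M → Run p B Q r M
      open Spec

      opaque
        unfolding compile expCost

        stm : ∀ s {vs as Q r M} → wp s Q vs as → Agree vs as r M → Run (compile s) (λ _ → cost s) Q r M
        stm (x ≔ e) {vs} {as} k ag with eval e ≤-refl ag k
        ... | evaluated {r₁} run (v , v<) f , q =
          ran (seq run (seq imm arith)) ≤-refl (Agree-resp (Agree-var x v< (Agree-regs ≤-refl f ag))) q
          where
          y : Reg
          y = suc (toℕ x)
          r₂ r₃ : ℕ → ℕ
          r₂ = r₁ [ y ↦ trunc w 0 ]
          r₃ = r₂ [ y ↦ trunc w (r₂ y + r₂ temp) ]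
          Agree-resp : ∀ {vs″ M} → Agree vs″ as (r₁ [ y ↦ ⟦ e ⟧ᵉ vs as ]) M → Agree vs″ as r₃ M
          Agree-resp ag′ = Agree-regs {t = temp} ≤-refl (λ z _ → same z) ag′
            where
            sum≡ : trunc w (r₂ y + r₂ temp) ≡ ⟦ e ⟧ᵉ vs as
            sum≡ = trans (cong (trunc w) (cong₂ _+_ (trans ([↦]-same r₁ y _) (trunc-< (<-trans (n<1+n 0) 1<2^w)))
                   (trans ([↦]-other r₁ _ (λ e → <⇒≢ (toℕ<n x) (sym (suc-injective e)))) v))) (trunc-< v<)
            same : ∀ z → r₃ z ≡ (r₁ [ y ↦ ⟦ e ⟧ᵉ vs as ]) z
            same z with z ≟ y
            ... | yes refl = trans ([↦]-same r₂ y _) (trans sum≡ (sym ([↦]-same r₁ y _)))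
            ... | no z≢y = trans ([↦]-other r₂ _ z≢y) (trans ([↦]-other r₁ _ z≢y) (sym ([↦]-other r₁ _ z≢y)))
        stm (a ⟨ e ⟩≔ f) {vs} {as} {Q} {M = M} k ag with eval e ≤-refl ag k
        ... | evaluated {r₁} run₁ (v₁ , _) f₁ , i≤n , k₁ with addressed a temp {r = r₁} {M = M} ≤-refl
          (trans (f₁ 0 (s≤s z≤n)) (size ag)) v₁ i≤n
        ... | evaluated {r₂} run₂ v₂ f₂ with eval f {suc temp} {M = M} (m≤n⇒m≤1+n ≤-refl)
          (Agree-regs {vs} {as} {r′ = r₂} ≤-refl (λ x x< → trans (f₂ x x<) (f₁ x x<)) ag) k₁
        ... | evaluated {r₃} run₃ (v₃ , v<) f₃ , q =
          ran (seq run₁ (seq run₂ (seq run₃ (store (subst (_< m) (sym r₃≡) (<-≤-trans (toℕ+n< a i≤n) A≤m)))))) ≤-refl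
          (subst₂ (λ x y → Agree vs (as ⟪ a ⟫≔ _) r₃ (M [ x ↦ y ])) (sym r₃≡) (sym v₃)
            (Agree-cell a i≤n v<
              (Agree-regs {r′ = r₃} ≤-refl (λ x x< → trans (f₃ x (m≤n⇒m≤1+n x<)) (trans (f₂ x x<) (f₁ x x<))) ag))) q
          where
          r₃≡ : r₃ temp ≡ ⟦ e ⟧ᵉ vs as + toℕ a * suc n
          r₃≡ = trans (f₃ temp ≤-refl) v₂
        stm (write i a g u) {vs} {as} {Q} {M = M} k ag with eval i {temp} ≤-refl ag k
        ... | evaluated {r₁} run₁ (v₁ , _) f₁ , k₁ with eval a {1 + temp} {M = M} (m≤n+m temp 1)
          (Agree-regs {r′ = r₁} ≤-refl f₁ ag) k₁
        ... | evaluated {r₂} run₂ (v₂ , _) f₂ , k₂ with eval g {2 + temp} {M = M} (m≤n+m temp 2)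
          (Agree-regs {r′ = r₂} ≤-refl (λ x x< → trans (f₂ x (m≤n⇒m≤o+n 1 x<)) (f₁ x x<)) ag) k₂
        ... | evaluated {r₃} run₃ (v₃ , _) f₃ , k₃ with eval u {3 + temp} {M = M} (m≤n+m temp 3)
          (Agree-regs {r′ = r₃} ≤-refl
          (λ x x< → trans (f₃ x (m≤n⇒m≤o+n 2 x<)) (trans (f₂ x (m≤n⇒m≤o+n 1 x<)) (f₁ x x<))) ag) k₃
        ... | evaluated {r₄} run₄ (v₄ , _) f₄ , q = ran (seq run₁ (seq run₂ (seq run₃ (seq run₄ report)))) ≤-refl
            (Agree-regs {r′ = r₄} ≤-refl
              (λ x x< → trans (f₄ x (m≤n⇒m≤o+n 3 x<))
              (trans (f₃ x (m≤n⇒m≤o+n 2 x<)) (trans (f₂ x (m≤n⇒m≤o+n 1 x<)) (f₁ x x<)))) ag)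
            (subst (λ x → Q vs as [ x ]) (sym q≡) q)
          where
          q≡ : quad (r₄ temp) (r₄ (1 + temp)) (r₄ (2 + temp)) (r₄ (3 + temp)) ≡ quad (⟦ i ⟧ᵉ vs as) (⟦ a ⟧ᵉ vs as)
            (⟦ g ⟧ᵉ vs as) (⟦ u ⟧ᵉ vs as)
          q≡ rewrite v₄ | f₄ (2 + temp) ≤-refl | v₃ | f₄ (1 + temp) (m≤n+m _ 1) | f₃ (1 + temp) ≤-refl | v₂
                   | f₄ temp (m≤n+m _ 2) | f₃ temp (m≤n+m _ 1) | f₂ temp ≤-refl | v₁ = refl
        stm nop q ag = ran skip ≤-refl ag q
        stm (s ⨟ t) k ag with stm s k ag
        ... | ran run₁ c₁ ag₁ k₁ with stm t k₁ ag₁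
        ... | ran run₂ c₂ ag₂ q = ran (seq run₁ run₂) (+-mono-≤ c₁ c₂) ag₂ q
        stm (if c then s else t end) k ag with test c ag k
        ... | evaluated run₁ (inj₁ (nz , tr)) f , k₁ , _ with stm s (k₁ tr) (Agree-regs ≤-refl f ag)
        ... | ran run₂ c₂ ag₂ q =
          ran (seq run₁ (if-nz nz run₂)) (+-monoʳ-≤ (condCost c) (s≤s (≤-trans c₂ (m≤m+n (cost s) (cost t))))) ag₂ q
        stm (if c then s else t end) k ag | evaluated run₁ (inj₂ (z , fa)) f , _ , k₁ with stm t (k₁ fa)
          (Agree-regs ≤-refl f ag)
        ... | ran run₂ c₂ ag₂ q =
          ran (seq run₁ (if-z z run₂)) (+-monoʳ-≤ (condCost c) (s≤s (≤-trans c₂ (m≤n+m (cost t) (cost s))))) ag₂ q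

      infixl 5 _+κ

      _+κ : ℕ → List Quad → ℕ
      (t +κ) o = t + κ * length o

      ++-steps : ∀ {t t′ b b′ : ℕ} (o o′ : List Quad) → t ≤ (b +κ) o → t′ ≤ (b′ +κ) o′ → t + t′ ≤ ((b + b′) +κ)
        (o ++ o′)
      ++-steps {t} {t′} {b} {b′} o o′ h h′ rewrite length-++ o {o′} | *-distribˡ-+ κ (length o) (length o′) =
        lia 6 (λ t t′ b b′ x y → t :≤ b :+ x ∷ t′ :≤ b′ :+ y ∷ [] ⊢ t :+ t′ :≤ b :+ b′ :+ (x :+ y)) t t′ b b′
          (κ * length o) (κ * length o′) h h′

      silent : ∀ {s vs as Q} → Wp s Q vs as → Spec (compile s) (cost s +κ) Q vs as
      from (silent {s} [ k ]ʷ) ag with stm s k ag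
      ... | ran run c ag′ q = ran run (≤-trans c (m≤m+n _ _)) ag′ q

      loud : ∀ {s vs as Q} → Wp s Q vs as → Spec (compile s) (λ _ → cost s) Q vs as
      loud {s} [ k ]ʷ = spec (stm s k)

      weaken : ∀ {p t t′ Q Q′ vs as} → t ≤ t′ → (∀ {vs as o} → Q vs as o → Q′ vs as o) → Spec p (t +κ) Q vs as → Spec p
        (t′ +κ) Q′ vs as
      from (weaken t≤t′ imp sp) ag with from sp ag
      ... | ran run c ag′ q = ran run (≤-trans c (+-monoˡ-≤ _ t≤t′)) ag′ (imp q)

      _▷_ : ∀ {p q t t′ Q R vs as} → Spec p (t +κ) R vs as →
            (∀ {vs as o} → R vs as o → Spec q (t′ +κ) (λ vs as o′ → Q vs as (o ++ o′)) vs as) →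
            Spec (p ⨾ q) ((t + t′) +κ) Q vs as
      from (sp ▷ next) ag with from sp ag
      ... | ran {out = o} run₁ c₁ ag₁ q₁ with from (next q₁) ag₁
      ... | ran {out = o′} run₂ c₂ ag₂ q₂ = ran (seq run₁ run₂) (++-steps o o′ c₁ c₂) ag₂ q₂

      opaque
        unfolding loopWhile

        -- A single unrolling with an explicit budget: the rest of the loop is granted `t′`, and `t`
        -- together with the charge for the output of this pass must cover test, guard, body and
        -- `t′`.
        iterate : ∀ c p {B t Q vs as} → suc (condCost c) ≤ t →
          safeᶜ c vs as
            ((True c vs as → Spec p B (λ vs as o → ∃[ t′ ] suc (condCost c) + B o + t′ ≤ (t +κ) o
                × Spec (loopWhile c p) (t′ +κ) (λ vs as o′ → Q vs as (o ++ o′)) vs as) vs as)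
             × (False c vs as → Q vs as [])) →
          Spec (loopWhile c p) (t +κ) Q vs as
        from (iterate c p {t = t} enough k) ag with test c ag k
        ... | evaluated run (inj₂ (z , fa)) f , _ , q =
          ran (seq run (done z)) (≤-trans (≤-reflexive (+-comm (condCost c) 1)) (≤-trans enough (m≤m+n t _)))
            (Agree-regs ≤-refl f ag) (q fa)
        ... | evaluated run (inj₁ (nz , tr)) f , body , _ with from (body tr) (Agree-regs ≤-refl f ag)
        ... | ran {steps = s₁} {out = o} run₁ c₁ ag₁ (t′ , t′≤ , rest) with from rest ag₁
        -- The remaining loop begins with its own test `run₂`; joined to the body it completes one
        -- pass of the `while`.
        ... | ran {out = o′} (seq {t = s₂} {t′ = s₃} {o = o₂} {o′ = o₃} run₂ run₃) c₂ ag₂ q =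
          ran (subst (Exec w m _ _ _ _) (++-assoc o o₂ o₃) (seq run (loop nz (seq run₁ run₂) run₃))) total ag₂ q
          where
          total : condCost c + suc (s₁ + s₂ + s₃) ≤ (t +κ) (o ++ o′)
          total rewrite length-++ o {o′} | *-distribˡ-+ κ (length o) (length o′) =
            lia 9 (λ c s₁ s₂ s₃ b t′ t x y → s₁ :≤ b ∷ lit 1 :+ c :+ b :+ t′ :≤ t :+ x ∷ s₂ :+ s₃ :≤ t′ :+ y ∷ [] ⊢
                c :+ (lit 1 :+ (s₁ :+ s₂ :+ s₃)) :≤ t :+ (x :+ y))
              (condCost c) s₁ s₂ s₃ _ t′ t (κ * length o) (κ * length o′) c₁ t′≤ c₂

      opaque
        unfolding loopCost

        -- I μ is an invariant under which at most μ iterations are left.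
        repeat : ∀ c p {t} (I : ℕ → Vars → Arrs → Set) →
          (∀ {μ vs as} → I μ vs as → safeᶜ c vs as (True c vs as →
             Spec p (t +κ) (λ vs′ as′ o → o ≡ [] × ∃[ μ′ ] (μ′ < μ × I μ′ vs′ as′)) vs as)) →
          ∀ μ {vs as} → I μ vs as →
          Spec (loopWhile c p) (loopCost c t μ +κ) (λ vs as o → o ≡ [] × False c vs as × ∃[ μ′ ] I μ′ vs as) vs as
        repeat c p {t} I body μ inv = go μ ≤-refl inv
          where
          τ : ℕ
          τ = suc (condCost c) + t
          Q : Post
          Q vs as o = o ≡ [] × False c vs as × ∃[ μ′ ] I μ′ vs as
          -- A pass may lower `μ` by more than one. The budget follows `ν ≥ μ`, which drops by
          -- exactly one per pass.
          go : ∀ ν {μ vs as} → μ ≤ ν → I μ vs as → Spec (loopWhile c p) (suc ν * τ +κ) Q vs as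
          go ν {μ} {vs} {as} μ≤ν i =
            iterate c p {B = t +κ} (≤-trans (m≤m+n _ t) (m≤m+n τ (ν * τ)))
            (safeᶜ-map c (λ k → (λ tr → cont (k tr)) , (λ fa → refl , fa , μ , i)) (body i))
            where
            cont : Spec p (t +κ) (λ vs′ as′ o → o ≡ [] × ∃[ μ′ ] (μ′ < μ × I μ′ vs′ as′)) vs as →
              Spec p (t +κ) (λ vs as o → ∃[ t′ ] suc (condCost c) + (t +κ) o + t′ ≤ (suc ν * τ +κ) o
                × Spec (loopWhile c p) (t′ +κ) (λ vs as o′ → Q vs as (o ++ o′)) vs as) vs as
            cont sp = weaken ≤-refl (λ { (refl , μ′ , μ′< , i′) → next ν μ≤ν μ′< i′ }) sp
              where
              next : ∀ ν {μ′ vs as} → μ ≤ ν → μ′ < μ → I μ′ vs as → ∃[ t′ ] suc (condCost c) + (t +κ) [] + t′ ≤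
                (suc ν * τ +κ) []
                × Spec (loopWhile c p) (t′ +κ) Q vs as
              next zero μ≤ν μ′<μ _ = contradiction (<-≤-trans μ′<μ μ≤ν) λ ()
              next (suc ν) μ≤ν μ′<μ i′ = suc ν * τ ,
                lia 4 (λ c t x y → [] ⊢ lit 1 :+ c :+ (t :+ x) :+ y :≤ (lit 1 :+ c :+ t) :+ y :+ x) (condCost c) t
                  (κ * 0) (suc ν * τ) ,
                go ν (≤-pred (<-≤-trans μ′<μ μ≤ν)) i′

-- The algorithm

module Algorithm where

  open Language 7 10 public

  v₀ v₁ v₂ v₃ v₄ v₅ v₆ : Fin 7
  v₀ = # 0
  v₁ = # 1
  v₂ = # 2
  v₃ = # 3
  v₄ = # 4
  v₅ = # 5
  v₆ = # 6

  N I E D Q K M : Exp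
  N = var v₀
  I = var v₁
  E = var v₂
  D = var v₃
  Q = var v₄
  K = var v₅
  M = var v₆

  text digit next bucket rep name prev first repeated radius : Fin 10
  text     = # 0
  digit    = # 1
  next     = # 2
  bucket   = # 3
  rep      = # 4
  name     = # 5
  prev     = # 6
  first    = # 7
  repeated = # 8
  radius   = # 9

  maxInit maxBody buildInit buildBody walkInit walkBody divide : Stm
  maxInit = v₁ ≔ N
  maxBody = if M ≺ text at I then v₆ ≔ text at I else nop end ⨟ v₁ ≔ I ⊖ #1

  -- One round of radix refinement: the names are refined by the last base
  -- n + 1 digit of text, which is then dropped from text.
  buildInit = rep ⟨ #0 ⟩≔ #0 ⨟ digit ⟨ #0 ⟩≔ #1 ⊕ N ⨟ v₁ ≔ #0
  buildBody =
    v₁ ≔ #1 ⊕ I ⨟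
    v₅ ≔ rem (text at I) ⨟
    digit ⟨ I ⟩≔ K ⨟
    text ⟨ I ⟩≔ quo (text at I) ⨟
    next ⟨ I ⟩≔ bucket at K ⨟
    bucket ⟨ K ⟩≔ I ⨟
    rep ⟨ I ⟩≔ #0

  walkInit = v₃ ≔ #1 ⊕ N ⨟ v₂ ≔ #0
  walkBody =
    if E ≈ #0
    -- Emptying each list as it is taken up leaves `bucket` clear for the next round and for
    -- `prevBody`.
    then v₃ ≔ D ⊖ #1 ⨟ v₂ ≔ bucket at D ⨟ bucket ⟨ D ⟩≔ #0
    else (v₄ ≔ name at E ⨟
          v₅ ≔ rep at Q ⨟
          -- `K` is 0 if the old name `Q` has no representative. Since `digit` holds `n + 1` at 0,
          -- the test fails then, too, and it also fails for a representative left over from a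
          -- larger digit.
          if digit at K ≈ D then name ⟨ E ⟩≔ K else (rep ⟨ Q ⟩≔ E ⨟ name ⟨ E ⟩≔ E) end ⨟
          v₂ ≔ next at E)
    end
  divide = v₆ ≔ quo M

  prevInit prevBody nextInit nextBody : Stm
  prevInit = v₁ ≔ #0
  prevBody =
    v₁ ≔ #1 ⊕ I ⨟
    v₄ ≔ name at I ⨟
    v₂ ≔ bucket at Q ⨟
    prev ⟨ I ⟩≔ E ⨟
    bucket ⟨ Q ⟩≔ I ⨟
    if E ≈ #0 then first ⟨ I ⟩≔ I else first ⟨ I ⟩≔ first at E end

  nextInit = v₁ ≔ N ⨟ v₄ ≔ N
  nextBody =
    if prev at I ≈ #0 then nop else v₄ ≔ I end ⨟
    repeated ⟨ I ⟩≔ Q ⨟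
    v₁ ≔ I ⊖ #1

  -- D is the centre of a palindrome reaching furthest to the right, namely up to
  -- position Q, and K is the radius known so far at the centre I.
  manacherInit grow settle manacherBody : Stm
  manacherInit = radius ⟨ N ⟩≔ #0 ⨟ v₁ ≔ #0 ⨟ v₃ ≔ #0 ⨟ v₄ ≔ #0 ⨟ v₅ ≔ #0
  grow = v₅ ≔ #1 ⊕ K ⨟ v₃ ≔ I ⨟ v₄ ≔ #1 ⊕ Q
  settle =
    radius ⟨ I ⟩≔ K ⨟
    v₁ ≔ #1 ⊕ I ⨟
    if I ≺ Q
    -- `D ⊕ D ⊖ I` is the mirror image of the centre `I` in the palindrome centred at `D`.
    then (v₅ ≔ radius at (D ⊕ D ⊖ I) ⨟
          if K ≺ Q ⊖ I then nop else v₅ ≔ Q ⊖ I end)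
    else (v₅ ≔ #0 ⨟ v₃ ≔ I ⨟ v₄ ≔ I)
    end
  manacherBody =
    if I ⊕ K ≺ Q then settle else
      if Q ≺ N then
        if K ≺ I then
          if name at (I ⊖ K) ≈ name at (#1 ⊕ Q) then grow else settle end
        else settle end
      else settle end
    end

  reportInit select reportBody : Stm
  reportInit = v₁ ≔ #0 ⨟ v₂ ≔ #0
  select =
    v₅ ≔ radius at I ⨟
    if #0 ≺ K
    -- The maximal palindrome begins at position `I - K + 1`.
    then (v₄ ≔ repeated at (#1 ⊕ I ⊖ K) ⨟
          if Q ≺ I
          then if I ⊕ K ≺ N
               -- If the letter after the palindrome occurs before `I - K`, its first occurrence
               -- does. The pivot is then of type 1, and `E` stays 0.
               then if (first at (#1 ⊕ (I ⊕ K))) ⊕ K ≺ I then nop else v₂ ≔ prev at Q end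
               else v₂ ≔ prev at Q end
          else nop end)
    else nop end
  reportBody =
    if E ≈ #0
    then (v₁ ≔ #1 ⊕ I ⨟ if I ≺ N then select else nop end)
    -- `w` is the letter at `E`, the gap is `E + 1, …, Q`, and `u` is `Q + 1, …, I`.
    else (write I #1 (Q ⊖ E) (I ⊖ Q) ⨟ v₂ ≔ prev at E)
    end

  round algorithm : Prog
  round =
    compile buildInit ⨾ loopWhile (I ≺ N) (compile buildBody) ⨾
    compile walkInit ⨾ loopWhile (#0 ≺ D ⊕ E) (compile walkBody) ⨾
    compile divide

  -- Register 1 belongs to `N` and is 0 at the beginning, so the load fetches the length from
  -- address 0; then register 0 receives `n + 1`.
  start : Prog
  start = load 1 1 ⨾ imm 0 1 ⨾ arith add 0 0 1

  reportStage manacherStage nextStage prevStage main : Prog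
  reportStage = compile reportInit ⨾ loopWhile (I ≺ N) (compile reportBody)
  manacherStage = compile manacherInit ⨾ loopWhile (I ≺ N) (compile manacherBody) ⨾ reportStage
  nextStage = compile nextInit ⨾ loopWhile (#0 ≺ I) (compile nextBody) ⨾ manacherStage
  prevStage = compile prevInit ⨾ loopWhile (I ≺ N) (compile prevBody) ⨾ nextStage
  main = compile maxInit ⨾ loopWhile (#0 ≺ I) (compile maxBody) ⨾ loopWhile (#0 ≺ M) round ⨾ prevStage

  algorithm = start ⨾ main

  -- The time of one step of the reporting loop, also the time charged to a report.
  reportCost : ℕ
  reportCost = suc (condCost (I ≺ N)) + cost reportBody

  roundCost : ℕ → ℕ
  roundCost n = cost buildInit + (loopCost (I ≺ N) (cost buildBody) n + (cost walkInit +
    -- At most one pass for each of the `n + 1` digits and one for each position.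
    (loopCost (#0 ≺ D ⊕ E) (cost walkBody) (suc n + n) + cost divide)))

  reportTime manacherTime nextTime prevTime : ℕ → ℕ
  reportTime n = cost reportInit + suc n * reportCost
  -- Every pass raises `I` or `Q`, neither of which exceeds `n`.
  manacherTime n = cost manacherInit + (loopCost (I ≺ N) (cost manacherBody) (n + n) + reportTime n)
  nextTime n = cost nextInit + (loopCost (#0 ≺ I) (cost nextBody) n + manacherTime n)
  prevTime n = cost prevInit + (loopCost (I ≺ N) (cost prevBody) n + nextTime n)

  totalCost : ℕ → ℕ → ℕ
  totalCost rounds n = cost maxInit + (loopCost (#0 ≺ I) (cost maxBody) n +
    (loopCost (#0 ≺ M) (roundCost n) rounds + prevTime n))

-- Radix refinement

-- The value 0 means that there is none; positions start at 1, so `none` covers this case as well.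
record Latest (P : ℕ → Set) (i v : ℕ) : Set where
  constructor latest
  field
    before : v ≡ 0 ⊎ v < i
    holds  : v ≢ 0 → P v
    none   : ∀ {j} → v < j → j < i → ¬ P j

Latest-start : ∀ {P} → Latest P 1 0
Latest-start = latest (inj₁ refl) (λ 0≢0 → contradiction refl 0≢0) λ { 0<j (s≤s j≤0) _ → <⇒≱ 0<j j≤0 }

Latest-here : ∀ {P : ℕ → Set} {i} → P i → Latest P (suc i) i
Latest-here p = latest (inj₂ ≤-refl) (λ _ → p) λ { i<j (s≤s j≤i) → contradiction j≤i (<⇒≱ i<j) }

module _ {P : ℕ → Set} {i v : ℕ} where

  Latest-skip : ¬ P i → Latest P i v → Latest P (suc i) v
  Latest-skip ¬p (latest b h n) = latest (step b) h none′
    where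
    step : v ≡ 0 ⊎ v < i → v ≡ 0 ⊎ v < suc i
    step (inj₁ z) = inj₁ z
    step (inj₂ v<i) = inj₂ (m≤n⇒m≤1+n v<i)
    none′ : ∀ {j} → v < j → j < suc i → ¬ P j
    none′ {j} v<j (s≤s j≤i) pj with j ≟ i
    ... | yes refl = ¬p pj
    ... | no j≢i = n v<j (≤∧≢⇒< j≤i j≢i) pj

Σ[_]_ : ℕ → (ℕ → ℕ) → ℕ
Σ[ zero ] f = 0
Σ[ suc n ] f = f (suc n) + Σ[ n ] f

Σ-update-above : ∀ n (f : ℕ → ℕ) {a} v → n < a → Σ[ n ] (f [ a ↦ v ]) ≡ Σ[ n ] f
Σ-update-above zero f v _ = refl
Σ-update-above (suc n) f {a} v n<a =
  cong₂ _+_ ([↦]-other f v (<⇒≢ n<a)) (Σ-update-above n f v (<-trans (n<1+n n) n<a))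

Σ-decrease : ∀ n (f : ℕ → ℕ) {a} → 0 < a → a ≤ n → 0 < f a → Σ[ n ] (f [ a ↦ 0 ]) < Σ[ n ] f
Σ-decrease zero f 0<a a≤0 = contradiction a≤0 (<⇒≱ 0<a)
Σ-decrease (suc n) f {a} 0<a a≤1+n 0<fa with a ≟ suc n
... | yes refl rewrite [↦]-same f a 0 | Σ-update-above n f 0 (n<1+n n) = m<n+m (Σ[ n ] f) 0<fa
... | no a≢ rewrite [↦]-other f 0 (λ e → a≢ (sym e)) =
  +-monoʳ-< (f (suc n)) (Σ-decrease n f 0<a (≤-pred (≤∧≢⇒< a≤1+n a≢)) 0<fa)

Σ-const : ∀ n → Σ[ n ] (λ _ → 1) ≡ n
Σ-const zero = refl
Σ-const (suc n) = cong suc (Σ-const n)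

-- The combinatorics of one refinement round, over the letters 1, …, n: the old
-- names are refined by the digits, Seen being the set of positions renamed so
-- far and d the digit under consideration.
module Refinement (n : ℕ) (dig old : ℕ → ℕ) where

  record Refined (Seen : ℕ → Set) (d : ℕ) (name rep : ℕ → ℕ) : Set where
    field
      same     : ∀ {a b} → Seen a → Seen b → name a ≡ name b → old a ≡ old b × dig a ≡ dig b
      differ   : ∀ {a b} → Seen a → Seen b → old a ≡ old b → dig a ≡ dig b → name a ≡ name b
      name-in  : ∀ {a} → Seen a → Seen (name a)
      unseen   : ∀ {a} → ¬ Seen a → name a ≡ old a
      rep-name : ∀ {c} → c ≤ n → rep c ≢ 0 → Seen (rep c) × old (rep c) ≡ c × name (rep c) ≡ rep c
      rep-dig  : ∀ {a} → Seen a → dig a ≡ d → rep (old a) ≢ 0 × dig (rep (old a)) ≡ d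

  open Refined

  Refined-resp : ∀ {S S′ d d′ name rep} → (∀ {a} → S a → S′ a) → (∀ {a} → S′ a → S a) →
    (∀ {a} → S a → dig a ≡ d′ → d ≡ d′) → Refined S d name rep → Refined S′ d′ name rep
  Refined-resp f g h r = record
    { same = λ a b → same r (g a) (g b) ; differ = λ a b → differ r (g a) (g b)
    ; name-in = λ a → f (name-in r (g a)) ; unseen = λ ¬a → unseen r (¬a ∘ f)
    ; rep-name = λ c≤n nz → let s , e = rep-name r c≤n nz in f s , e
    ; rep-dig = λ {a} s e → subst (λ d → rep′ r (old a) ≢ 0 × dig (rep′ r (old a)) ≡ d) (h (g s) e)
                              (rep-dig r (g s) (trans e (sym (h (g s) e)))) }
    where
    rep′ : ∀ {S d name rep} → Refined S d name rep → ℕ → ℕ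
    rep′ {rep = rep} _ = rep

  Insert : (ℕ → Set) → ℕ → ℕ → Set
  Insert S e a = S a ⊎ a ≡ e

  module _ {S d name rep} (r : Refined S d name rep) {e} (¬Se : ¬ S e) (dig-e : dig e ≡ d) (old≤n : old e ≤ n) where

    private
      off : ∀ {a} v → S a → (name [ e ↦ v ]) a ≡ name a
      off {a} v s = [↦]-other name v λ { refl → ¬Se s }

    insert-known : rep (old e) ≢ 0 → dig (rep (old e)) ≡ d →
                   Refined (Insert S e) d (name [ e ↦ rep (old e) ]) rep
    insert-known nz dig-x with rep-name r old≤n nz
    ... | Sx , old-x , name-x = record
      { same = same′ ; differ = differ′ ; name-in = name-in′
      ; unseen = λ {a} ¬s → trans ([↦]-other name x (¬s ∘ inj₂)) (unseen r (¬s ∘ inj₁))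
      ; rep-name = λ c≤n nz′ → let s , o , m = rep-name r c≤n nz′ in inj₁ s , o , trans (off x s) m
      ; rep-dig = rep-dig′ }
      where
      x : ℕ
      x = rep (old e)
      at-e : (name [ e ↦ x ]) e ≡ name x
      at-e = trans ([↦]-same name e x) (sym name-x)
      -- e may be replaced by its representative x.
      home : ∀ {a} → Insert S e a → ∃[ b ] (S b × (name [ e ↦ x ]) a ≡ name b × old a ≡ old b × dig a ≡ dig b)
      home {a} (inj₁ s) = a , s , off x s , refl , refl
      home (inj₂ refl) = x , Sx , at-e , sym old-x , trans dig-e (sym dig-x)
      same′ : ∀ {a b} → Insert S e a → Insert S e b → (name [ e ↦ x ]) a ≡ (name [ e ↦ x ]) b → old a ≡ old b ×
        dig a ≡ dig b
      same′ sa sb eq′ with home sa | home sb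
      ... | _ , s , n₁ , o₁ , d₁ | _ , s′ , n₂ , o₂ , d₂ with same r s s′ (trans (sym n₁) (trans eq′ n₂))
      ... | o , d′ = trans o₁ (trans o (sym o₂)) , trans d₁ (trans d′ (sym d₂))
      differ′ : ∀ {a b} → Insert S e a → Insert S e b → old a ≡ old b → dig a ≡ dig b → (name [ e ↦ x ]) a ≡
        (name [ e ↦ x ]) b
      differ′ sa sb o d′ with home sa | home sb
      ... | _ , s , n₁ , o₁ , d₁ | _ , s′ , n₂ , o₂ , d₂ =
        trans n₁ (trans (differ r s s′ (trans (sym o₁) (trans o o₂)) (trans (sym d₁) (trans d′ d₂))) (sym n₂))
      name-in′ : ∀ {a} → Insert S e a → Insert S e ((name [ e ↦ x ]) a)
      name-in′ sa with home sa
      ... | _ , s , n₁ , _ = inj₁ (subst S (sym n₁) (name-in r s))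
      rep-dig′ : ∀ {a} → Insert S e a → dig a ≡ d → rep (old a) ≢ 0 × dig (rep (old a)) ≡ d
      rep-dig′ (inj₁ s) = rep-dig r s
      rep-dig′ (inj₂ refl) _ = nz , dig-x

    -- A seen position agreeing with `e` in old name and digit would make the representative
    -- current, by `rep-dig`. So `e` opens a class of its own; its name is new because names of seen
    -- positions are seen, and `e` is not.
    insert-fresh : e ≢ 0 → (rep (old e) ≢ 0 → dig (rep (old e)) ≢ d) →
                   Refined (Insert S e) d (name [ e ↦ e ]) (rep [ old e ↦ e ])
    insert-fresh e≢0 stale = record
      { same = same′ ; differ = differ′ ; name-in = name-in′
      ; unseen = λ {a} ¬s → trans ([↦]-other name e (¬s ∘ inj₂)) (unseen r (¬s ∘ inj₁))
      ; rep-name = rep-name′ ; rep-dig = rep-dig′ }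
      where
      at-e : (name [ e ↦ e ]) e ≡ e
      at-e = [↦]-same name e e
      clash : ∀ {b} → S b → old b ≡ old e → dig b ≢ d
      clash s o d′ with rep-dig r s d′
      ... | nz , d″ rewrite o = stale nz d″
      apart : ∀ {b} → S b → (name [ e ↦ e ]) b ≢ (name [ e ↦ e ]) e
      apart s n≡ = ¬Se (subst S (trans (sym (off e s)) (trans n≡ at-e)) (name-in r s))
      same′ : ∀ {a b} → Insert S e a → Insert S e b → (name [ e ↦ e ]) a ≡ (name [ e ↦ e ]) b → old a ≡ old b ×
        dig a ≡ dig b
      same′ (inj₁ s) (inj₁ s′) n≡ = same r s s′ (trans (sym (off e s)) (trans n≡ (off e s′)))
      same′ (inj₁ s) (inj₂ refl) n≡ = contradiction n≡ (apart s)
      same′ (inj₂ refl) (inj₁ s) n≡ = contradiction (sym n≡) (apart s)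
      same′ (inj₂ refl) (inj₂ refl) n≡ = refl , refl
      differ′ : ∀ {a b} → Insert S e a → Insert S e b → old a ≡ old b → dig a ≡ dig b → (name [ e ↦ e ]) a ≡
        (name [ e ↦ e ]) b
      differ′ (inj₁ s) (inj₁ s′) o d′ = trans (off e s) (trans (differ r s s′ o d′) (sym (off e s′)))
      differ′ (inj₁ s) (inj₂ refl) o d′ = contradiction (trans d′ dig-e) (clash s o)
      differ′ (inj₂ refl) (inj₁ s) o d′ = contradiction (trans (sym d′) dig-e) (clash s (sym o))
      differ′ (inj₂ refl) (inj₂ refl) o d′ = refl
      name-in′ : ∀ {a} → Insert S e a → Insert S e ((name [ e ↦ e ]) a)
      name-in′ (inj₁ s) = inj₁ (subst S (sym (off e s)) (name-in r s))
      name-in′ (inj₂ refl) = inj₂ at-e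
      rep-name′ : ∀ {c} → c ≤ n → (rep [ old e ↦ e ]) c ≢ 0 → Insert S e ((rep [ old e ↦ e ]) c) ×
        old ((rep [ old e ↦ e ]) c) ≡ c × (name [ e ↦ e ]) ((rep [ old e ↦ e ]) c) ≡ (rep [ old e ↦ e ]) c
      rep-name′ {c} c≤n nz with c ≟ old e
      ... | yes refl rewrite [↦]-same rep (old e) e = inj₂ refl , refl , at-e
      ... | no c≢ rewrite [↦]-other rep e c≢ with rep-name r c≤n nz
      ... | s , o , m = inj₁ s , o , trans (off e s) m
      rep-dig′ : ∀ {a} → Insert S e a → dig a ≡ d → (rep [ old e ↦ e ]) (old a) ≢ 0 × dig
        ((rep [ old e ↦ e ]) (old a)) ≡ d
      rep-dig′ (inj₂ refl) _ rewrite [↦]-same rep (old e) e = e≢0 , dig-e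
      rep-dig′ {a} (inj₁ s) d′ with old a ≟ old e
      ... | yes o = contradiction d′ (clash s o)
      ... | no o≢ rewrite [↦]-other rep e o≢ = rep-dig r s d′

In : ℕ → ℕ → Set
In n a = 0 < a × a ≤ n

module Walking (n : ℕ) (dig old : ℕ → ℕ) (dig≤n : ∀ a → dig a ≤ n) (old≤n : ∀ {a} → In n a → old a ≤ n) where

  open Refinement n dig old
  open Refined

  -- The walk takes the digits downwards and, since the links lead to earlier positions, takes each
  -- class downwards, too.
  Seen : ℕ → ℕ → ℕ → Set
  Seen d e a = In n a × (d < dig a ⊎ (dig a ≡ d × e < a))

  Chained : ℕ → ℕ → Set
  Chained d e = e ≡ 0 ⊎ (In n e × dig e ≡ d)

  record Walk (μ d e : ℕ) (digit next bucket rep name : ℕ → ℕ) : Set where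
    field
      d≤      : d ≤ suc n
      chained : Chained d e
      digit0  : digit 0 ≡ suc n
      digits  : ∀ {a} → In n a → digit a ≡ dig a
      links   : ∀ {a} → In n a → Latest (λ j → dig j ≡ dig a) a (next a)
      buckets : ∀ {c} → c < d → Latest (λ j → dig j ≡ c) (suc n) (bucket c)
      emptied : ∀ {c} → d ≤ c → c ≤ n → bucket c ≡ 0
      refined : Refined (Seen d e) d name rep
      -- With `d` this is the potential of the walk: one pass for every digit left and one for every
      -- unseen position.
      left    : ℕ → ℕ
      left-1  : ∀ {a} → In n a → ¬ Seen d e a → left a ≡ 1
      left≤   : d + Σ[ n ] left ≤ μ

  open Walk

  latest-chained : ∀ {c i v} → i ≤ suc n → Latest (λ j → dig j ≡ c) i v → Chained c v
  latest-chained {v = zero} _ _ = inj₁ refl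
  latest-chained {v = suc v} i≤ (latest (inj₂ v<i) h _) = inj₂ ((s≤s z≤n , ≤-pred (≤-trans v<i i≤)) , h λ ())

  module _ {μ d digit next bucket rep name} (W : Walk μ (suc d) 0 digit next bucket rep name) where

    private
      e : ℕ
      e = bucket d
      L : Latest (λ j → dig j ≡ d) (suc n) e
      L = buckets W ≤-refl
      to : ∀ {a} → Seen (suc d) 0 a → Seen d e a
      to (i , inj₁ p<) = i , inj₁ (<-trans (n<1+n d) p<)
      to (i , inj₂ (e≡ , _)) = i , inj₁ (≤-reflexive (sym e≡))
      from : ∀ {a} → Seen d e a → Seen (suc d) 0 a
      from {a} (i , inj₁ p<) with dig a ≟ suc d
      ... | yes e≡ = i , inj₂ (e≡ , proj₁ i)
      ... | no e≢ = i , inj₁ (≤∧≢⇒< p< (e≢ ∘ sym))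
      from {a} (i , inj₂ (e≡ , p<)) = contradiction e≡ (Latest.none L p< (s≤s (proj₂ i)))

    -- The set of seen positions stays the same: `bucket d` is the last position with digit `d`, so
    -- none beyond it remains to be counted. In particular `rep-dig` holds vacuously for the new
    -- digit.
    descend : ∃[ μ′ ] (μ′ < μ × Walk μ′ d e digit next (bucket [ d ↦ 0 ]) rep name)
    descend = d + Σ[ n ] left W , left≤ W , record
      { d≤ = ≤-trans (n≤1+n d) (d≤ W) ; chained = latest-chained ≤-refl L
      ; digit0 = digit0 W ; digits = digits W ; links = links W
      ; buckets = λ {c} c<d → subst (Latest _ _) (sym ([↦]-other bucket 0 (<⇒≢ c<d))) (buckets W (m≤n⇒m≤1+n c<d))
      ; emptied = λ {c} d≤c c≤n → [↦]-elim (λ _ v → v ≡ 0) bucket c refl λ c≢d → emptied W (≤∧≢⇒< d≤c (c≢d ∘ sym)) c≤n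
      ; refined = Refined-resp to from (λ { (_ , inj₁ p<) refl → contradiction p< (<-asym (n<1+n d))
                                          ; (_ , inj₂ (e≡ , _)) refl → contradiction (sym e≡) 1+n≢n }) (refined W)
      ; left = left W ; left-1 = λ i ¬s → left-1 W i (¬s ∘ to) ; left≤ = ≤-refl }

  module _ {μ d e digit next bucket rep name} (W : Walk μ d e digit next bucket rep name) (e≢0 : e ≢ 0) where

    element : In n e × dig e ≡ d
    element = [ (λ z → contradiction z e≢0) , (λ x → x) ]′ (chained W)

    private
      e-in : In n e
      e-in = proj₁ element
      dig-e : dig e ≡ d
      dig-e = proj₂ element
      e′ : ℕ
      e′ = next e
      L : Latest (λ j → dig j ≡ d) e e′
      L = subst (λ c → Latest (λ j → dig j ≡ c) e e′) dig-e (links W e-in)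
      ¬seen : ¬ Seen d e e
      ¬seen (_ , inj₁ p<) = <-irrefl (sym dig-e) p<
      ¬seen (_ , inj₂ (_ , p<)) = <-irrefl refl p<
      to : ∀ {a} → Insert (Seen d e) e a → Seen d e′ a
      to (inj₁ (i , inj₁ p<)) = i , inj₁ p<
      to (inj₁ (i , inj₂ (e≡ , p<))) = i , inj₂ (e≡ , <-trans e′<e p<)
        where
        e′<e : e′ < e
        e′<e = [ (λ z → subst (_< e) (sym z) (proj₁ e-in)) , (λ x → x) ]′ (Latest.before L)
      to (inj₂ refl) = e-in , inj₂
        (dig-e , [ (λ z → subst (_< e) (sym z) (proj₁ e-in)) , (λ x → x) ]′ (Latest.before L))
      from : ∀ {a} → Seen d e′ a → Insert (Seen d e) e a
      from (i , inj₁ p<) = inj₁ (i , inj₁ p<)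
      from {a} (i , inj₂ (e≡ , p<)) with a ≟ e
      ... | yes a≡e = inj₂ a≡e
      ... | no a≢e with a <? e
      ... | yes a<e = contradiction e≡ (Latest.none L p< a<e)
      ... | no a≮e = inj₁ (i , inj₂ (e≡ , ≤∧≢⇒< (≮⇒≥ a≮e) (a≢e ∘ sym)))
      old-e : name e ≡ old e
      old-e = unseen (refined W) ¬seen
      close : ∀ {rep′ name′} → Refined (Insert (Seen d e) e) d name′ rep′ →
              ∃[ μ′ ] (μ′ < μ × Walk μ′ d e′ digit next bucket rep′ name′)
      close r = d + Σ[ n ] (left W [ e ↦ 0 ]) ,
        <-≤-trans (+-monoʳ-< d
          (Σ-decrease n (left W) (proj₁ e-in) (proj₂ e-in) (subst (0 <_) (sym (left-1 W e-in ¬seen)) (s≤s z≤n))))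
          (left≤ W) ,
        record
        { d≤ = d≤ W ; chained = latest-chained (m≤n⇒m≤1+n (proj₂ e-in)) L
        ; digit0 = digit0 W ; digits = digits W ; links = links W ; buckets = buckets W ; emptied = emptied W
        ; refined = Refined-resp to from (λ _ _ → refl) r
        ; left = left W [ e ↦ 0 ]
        ; left-1 = λ {a} i ¬s → trans ([↦]-other (left W) 0 λ { refl → ¬s (to (inj₂ refl)) })
          (left-1 W i (¬s ∘ to ∘ inj₁))
        ; left≤ = ≤-refl }

    name≤ : name e ≤ n
    name≤ = subst (_≤ n) (sym old-e) (old≤n e-in)

    rep-in : rep (name e) ≢ 0 → In n (rep (name e))
    rep-in nz = proj₁ (proj₁ (rep-name (refined W) name≤ nz))

    rep≤ : rep (name e) ≤ n
    rep≤ with rep (name e) ≟ 0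
    ... | yes z = subst (_≤ n) (sym z) z≤n
    ... | no nz = proj₂ (rep-in nz)

    known : digit (rep (name e)) ≡ d →
            ∃[ μ′ ] (μ′ < μ × Walk μ′ d (next e) digit next bucket rep (name [ e ↦ rep (name e) ]))
    known hit = close (subst (λ c → Refined _ d (name [ e ↦ rep c ]) rep) (sym old-e)
      (insert-known (refined W) ¬seen dig-e (old≤n e-in) (subst (λ c → rep c ≢ 0) old-e nz)
        (subst (λ c → dig (rep c) ≡ d) old-e (trans (sym (digits W (rep-in nz))) hit))))
      where
      nz : rep (name e) ≢ 0
      -- `digit 0` is `n + 1`, while `d` is the digit of `e` and at most `n`.
      nz z = <⇒≢ (s≤s (dig≤n e)) (trans dig-e (trans (sym hit) (trans (cong digit z) (digit0 W))))

    fresh : digit (rep (name e)) ≢ d →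
            ∃[ μ′ ] (μ′ < μ × Walk μ′ d (next e) digit next bucket (rep [ name e ↦ e ]) (name [ e ↦ e ]))
    fresh miss = close (subst (λ c → Refined _ d (name [ e ↦ e ]) (rep [ c ↦ e ])) (sym old-e)
      (insert-fresh (refined W) ¬seen dig-e (old≤n e-in) e≢0
        (subst (λ c → rep c ≢ 0 → dig (rep c) ≢ d) old-e λ nz hit → miss (trans (digits W (rep-in nz)) hit))))

-- Palindromes and Manacher's algorithm

module Palindromes (n : ℕ) (f : ℕ → ℕ) where

  -- The palindrome of radius r centred between c and c + 1; the positions y and
  -- y′ are mirror images if y + y′ ≡ 2 c + 1.
  record Pal (c r : ℕ) : Set where
    constructor pal
    field
      r≤c    : r ≤ c
      c+r≤n  : c + r ≤ n
      mirror : ∀ {y y′} → y + y′ ≡ suc (c + c) → y ≤ c + r → y′ ≤ c + r → f y ≡ f y′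

  open Pal

  MaxPal : ℕ → ℕ → Set
  MaxPal c r = Pal c r × (∀ {r′} → Pal c r′ → r′ ≤ r)

  -- Two positions up to `c` cannot sum to `2 c + 1`, so nothing is to be mirrored.
  pal-zero : ∀ {c} → c ≤ n → Pal c 0
  pal-zero {c} c≤n = pal z≤n (subst (_≤ n) (sym (+-identityʳ c)) c≤n) λ {y} {y′} s p q →
    contradiction (lia 3
      (λ y y′ c → y :+ y′ :≡ lit 1 :+ (c :+ c) ∷ y :≤ c :+ lit 0 ∷ y′ :≤ c :+ lit 0 ∷ [] ⊢ :⊥) y y′ c s p q) λ ()

  pal-≤ : ∀ {c k r} → k ≤ r → Pal c r → Pal c k
  pal-≤ {c} k≤r P = pal (≤-trans k≤r (r≤c P)) (≤-trans (+-monoʳ-≤ c k≤r) (c+r≤n P)) λ s p q →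
    mirror P s (≤-trans p (+-monoʳ-≤ c k≤r)) (≤-trans q (+-monoʳ-≤ c k≤r))

  pal-suc : ∀ {c k x} → x + k ≡ c → 0 < x → c + suc k ≤ n → f x ≡ f (suc (c + k)) → Pal c k → Pal c (suc k)
  pal-suc {c} {k} {x} refl 0<x ≤n fx P = pal (+-monoˡ-≤ k 0<x) ≤n mirror′
    where
    below : ∀ {y} → y ≤ c + suc k → y ≢ suc (c + k) → y ≤ c + k
    below {y} p ne = ≤-pred (≤∧≢⇒< (subst (y ≤_) (+-suc c k) p) ne)
    partner : ∀ {y} → suc (c + k) + y ≡ suc (c + c) → y ≡ x
    partner {y} s = lia 3 (λ x k y → lit 1 :+ (x :+ k :+ k) :+ y :≡ lit 1 :+ (x :+ k :+ (x :+ k)) ∷ [] ⊢ y :≡ x) x k y s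
    mirror′ : ∀ {y y′} → y + y′ ≡ suc (c + c) → y ≤ c + suc k → y′ ≤ c + suc k → f y ≡ f y′
    mirror′ {y} {y′} s p q with y ≟ suc (c + k) | y′ ≟ suc (c + k)
    ... | yes refl | _ = trans (sym fx) (cong f (sym (partner s)))
    ... | no _ | yes refl = trans (cong f (partner (trans (+-comm (suc (c + k)) y) s))) fx
    ... | no a | no b = mirror P s (below p a) (below q b)

  pal-edge : ∀ {c k x} → x + k ≡ c → Pal c (suc k) → f x ≡ f (suc (c + k))
  pal-edge {c} {k} {x} refl P = mirror P
    (lia 2 (λ x k → [] ⊢ x :+ (lit 1 :+ (x :+ k :+ k)) :≡ lit 1 :+ (x :+ k :+ (x :+ k))) x k)
    (≤-trans (m≤m+n x k) (m≤m+n c (suc k))) (≤-reflexive (sym (+-suc c k)))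

  maximal : ∀ {c k} → Pal c k → ¬ Pal c (suc k) → MaxPal c k
  maximal {c} {k} P ¬P = P , λ {r′} P′ → ≮⇒≥ λ k<r′ → ¬P (pal-≤ k<r′ P′)

  -- The symmetry that Manacher's algorithm exploits. Mirroring at `c` carries the pair `y`, `y′`
  -- around `x` to a pair `z`, `z′` around `m`, whence `f y = f z = f z′ = f y′`. Bounding the right
  -- ends is enough, as each left end mirrors the right end of the other palindrome.
  reflect : ∀ {c r m x k} → Pal c r → m + x ≡ c + c → x + k ≤ c + r → m + k ≤ c + r → Pal m k → Pal x k
  reflect {c} {r} {m} {x} {k} P mx x+k m+k Q = pal
    (lia 5 (λ c r m x k → m :+ x :≡ c :+ c ∷ m :+ k :≤ c :+ r ∷ r :≤ c ∷ [] ⊢ k :≤ x) c r m x k mx m+k (r≤c P))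
    (≤-trans x+k (c+r≤n P)) mirror′
    where
    bounds : ∀ y y′ → y + y′ ≡ suc (x + x) → y ≤ x + k → y′ ≤ x + k → ∃[ z ]
      (y + z ≡ suc (c + c) × z ≤ m + k × z ≤ c + r)
    bounds y y′ s p q = suc (c + c) ∸ y , m+[n∸m]≡n y≤ , z≤m+k , ≤-trans z≤m+k m+k
      where
      y≤ : y ≤ suc (c + c)
      y≤ = lia 5 (λ y x k c r → y :≤ x :+ k ∷ x :+ k :≤ c :+ r ∷ r :≤ c ∷ [] ⊢ y :≤ lit 1 :+ (c :+ c)) y x k c r p x+k
        (r≤c P)
      z : ℕ
      z = suc (c + c) ∸ y
      z≤m+k : z ≤ m + k
      z≤m+k = lia 7 (λ y y′ x m c k z → y :+ y′ :≡ lit 1 :+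
        (x :+ x) ∷ y′ :≤ x :+ k ∷ m :+ x :≡ c :+ c ∷ y :+ z :≡ lit 1 :+ (c :+ c) ∷ [] ⊢ z :≤ m :+ k)
        y y′ x m c k z s q mx (m+[n∸m]≡n y≤)
    mirror′ : ∀ {y y′} → y + y′ ≡ suc (x + x) → y ≤ x + k → y′ ≤ x + k → f y ≡ f y′
    mirror′ {y} {y′} s p q with bounds y y′ s p q | bounds y′ y (trans (+-comm y′ y) s) q p
    ... | z , yz , z≤ , z≤′ | z′ , yz′ , z′≤ , z′≤′ = trans (mirror P yz (≤-trans p x+k) z≤′)
      (trans (mirror Q (lia 7
        (λ y y′ x m c z z′ → y :+ y′ :≡ lit 1 :+ (x :+ x) ∷ y :+ z :≡ lit 1 :+ (c :+ c) ∷ y′ :+ z′ :≡ lit 1 :+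
        (c :+ c) ∷ m :+ x :≡ c :+ c ∷ []
          ⊢ z :+ z′ :≡ lit 1 :+ (m :+ m)) y y′ x m c z z′ s yz yz′ mx) z≤ z′≤)
        (sym (mirror P yz′ (≤-trans q x+k) z′≤′)))

  -- By `exact` a radius that ends before `q` is final, so letters are compared only with position
  -- `q + 1`. Each comparison raises `q` or settles `i`; as `i` and `q` are at most `n`, `budget`
  -- limits the passes to `2 n`.
  record Manacher (μ i c q k : ℕ) (radius : ℕ → ℕ) : Set where
    field
      c≤i     : c ≤ i
      {r}     : ℕ
      c+r     : c + r ≡ q
      widest  : Pal c r
      current : Pal i k
      reach   : i + k ≤ q
      exact   : i + k < q → MaxPal i k
      settled : ∀ {a} → a < i → MaxPal a (radius a)
      last    : radius n ≡ 0
      budget  : n + n ≤ μ + (i + q)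

  open Manacher

  q≤n : ∀ {μ i c q k rd} → Manacher μ i c q k rd → q ≤ n
  q≤n M = subst (_≤ n) (c+r M) (c+r≤n (widest M))

  module _ {μ i c q k rd} (M : Manacher μ i c q k rd) (i<n : i < n) where

    -- While `i < n`, the sum `i + q` is below `n + n`, so a unit of the budget is left.
    spend : ∀ {q′} → q ≤ q′ → ∃[ μ′ ] (μ′ < μ × n + n ≤ μ′ + (suc i + q′))
    spend {q′} q≤q′ = go μ (budget M)
      where
      go : ∀ μ → n + n ≤ μ + (i + q) → ∃[ μ′ ] (μ′ < μ × n + n ≤ μ′ + (suc i + q′))
      go zero b = contradiction
        (lia 3 (λ n i q → n :+ n :≤ i :+ q ∷ i :< n ∷ q :≤ n ∷ [] ⊢ :⊥) n i q b i<n (q≤n M)) λ ()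
      go (suc μ) b = μ , ≤-refl , lia 5
        (λ n i q q′ μ → n :+ n :≤ lit 1 :+ μ :+ (i :+ q) ∷ q :≤ q′ ∷ [] ⊢ n :+ n :≤ μ :+
        (lit 1 :+ i :+ q′)) n i q q′ μ b q≤q′

    grown : q ≤ i + k → q < n → k < i → f (i ∸ k) ≡ f (suc q) → ∃[ μ′ ] (μ′ < μ × Manacher μ′ i i (suc q) (suc k) rd)
    grown q≤i+k q<n k<i fx with spend ≤-refl
    ... | μ′ , μ′< , b = μ′ , μ′< , record
      { c≤i = ≤-refl ; c+r = i+sk ; widest = P ; current = P ; reach = ≤-reflexive i+sk
      ; exact = λ p → contradiction i+sk (<⇒≢ p) ; settled = settled M ; last = last M
      -- `spend` credits `i`, but here `q` has grown; their sum is the same.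
      ; budget = subst (n + n ≤_) (cong (μ′ +_) (sym (+-suc i q))) b }
      where
      q≡ : i + k ≡ q
      q≡ = ≤-antisym (reach M) q≤i+k
      i+sk : i + suc k ≡ suc q
      i+sk = trans (+-suc i k) (cong suc q≡)
      P : Pal i (suc k)
      P = pal-suc (m∸n+n≡m (<⇒≤ k<i)) (m<n⇒0<n∸m k<i) (subst (_≤ n) (sym i+sk) q<n) (trans fx (cong (f ∘ suc) (sym q≡)))
        (current M)

    stuck : q ≤ i + k → f (i ∸ k) ≢ f (suc q) → MaxPal i k
    stuck q≤i+k fx = maximal (current M) λ P → fx
      (trans (pal-edge (m∸n+n≡m (<⇒≤ (r≤c P))) P) (cong (f ∘ suc) (≤-antisym (reach M) q≤i+k)))

    boundary : q ≤ i + k → i ≤ k ⊎ n ≤ q → MaxPal i k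
    boundary q≤i+k (inj₁ i≤k) = maximal (current M) λ P → <⇒≱ (r≤c P) i≤k
    boundary q≤i+k (inj₂ n≤q) = maximal (current M) λ P → <⇒≱ (≤-<-trans q≤i+k (subst (_≤ n) (+-suc i k) (c+r≤n P))) n≤q

    module _ (max : MaxPal i k) where

      private
        rd′ : ℕ → ℕ
        rd′ = rd [ i ↦ k ]

      settled′ : ∀ {a} → a < suc i → MaxPal a (rd′ a)
      settled′ {a} a≤i = [↦]-elim MaxPal rd a max λ a≢i → settled M (≤∧≢⇒< (≤-pred a≤i) a≢i)

      last′ : rd′ n ≡ 0
      last′ = trans ([↦]-other rd k (<⇒≢ i<n ∘ sym)) (last M)

      restart : q ≤ suc i → ∃[ μ′ ] (μ′ < μ × Manacher μ′ (suc i) (suc i) (suc i) 0 rd′)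
      restart q≤ with spend q≤
      ... | μ′ , μ′< , b = μ′ , μ′< , record
        { c≤i = ≤-refl ; c+r = +-identityʳ (suc i) ; widest = pal-zero i<n ; current = pal-zero i<n
        ; reach = ≤-reflexive (+-identityʳ (suc i)) ; exact = λ p → contradiction (+-identityʳ (suc i)) (<⇒≢ p)
        ; settled = settled′ ; last = last′ ; budget = b }

      module _ (1+i<q : suc i < q) where

        private
          rM : r M ≤ c
          rM = r≤c (widest M)

        -- Since `r ≤ c`, even `q` is at most `c + c`. This makes the subtraction in the mirror
        -- image of the centre exact.
        1+i≤2c : suc i ≤ c + c
        1+i≤2c = lia 4 (λ i c q r → lit 1 :+ i :< q ∷ c :+ r :≡ q ∷ r :≤ c ∷ [] ⊢ lit 1 :+ i :≤ c :+ c) i c q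
          (r M) 1+i<q (c+r M) rM

        private
          m : ℕ
          m = c + c ∸ suc i
          m+ : m + suc i ≡ c + c
          m+ = m∸n+n≡m 1+i≤2c
          m≤i : m ≤ i
          m≤i = lia 3 (λ m i c → m :+ (lit 1 :+ i) :≡ c :+ c ∷ c :≤ i ∷ [] ⊢ m :≤ i) m i c m+ (c≤i M)
          inner : MaxPal m (rd′ m)
          inner = settled′ (s≤s m≤i)
          to : ∀ {k} → suc i + k ≤ q → Pal m k → Pal (suc i) k
          to {k} b = reflect (widest M) m+ (subst (suc i + k ≤_) (sym (c+r M)) b)
            (lia 6 (λ m i k q c r → lit 1 :+ i :+ k :≤ q ∷ m :≤ i ∷ c :+ r :≡ q ∷ [] ⊢ m :+ k :≤ c :+ r) m i k q c
              (r M) b m≤i (c+r M))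
          back : ∀ {k} → suc i + k ≤ q → Pal (suc i) k → Pal m k
          back {k} b = reflect (widest M) (trans (+-comm (suc i) m) m+)
            (lia 6 (λ m i k q c r → lit 1 :+ i :+ k :≤ q ∷ m :≤ i ∷ c :+ r :≡ q ∷ [] ⊢ m :+ k :≤ c :+ r) m i k q c
              (r M) b m≤i (c+r M))
            (subst (suc i + k ≤_) (sym (c+r M)) b)

        mirror≤n : m ≤ n
        mirror≤n = ≤-trans m≤i (<⇒≤ i<n)

        -- A palindrome at `suc i` that is one larger would still end within the one at `c`, and its
        -- mirror image would exceed the maximal radius at `m`.
        copied : rd′ m < q ∸ suc i → ∃[ μ′ ] (μ′ < μ × Manacher μ′ (suc i) c q (rd′ m) rd′)
        copied p with spend ≤-refl
        ... | μ′ , μ′< , b = μ′ , μ′< , record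
          { c≤i = m≤n⇒m≤1+n (c≤i M) ; c+r = c+r M ; widest = widest M ; current = P
          ; reach = <⇒≤ below ; exact =
            λ _ → maximal P λ P′ → 1+n≰n (proj₂ inner (back (subst (_≤ q) (sym (+-suc (suc i) (rd′ m))) below) P′))
          ; settled = settled′ ; last = last′ ; budget = b }
          where
          below : suc i + rd′ m < q
          below = subst (suc i + rd′ m <_) (m+[n∸m]≡n (<⇒≤ 1+i<q)) (+-monoʳ-< (suc i) p)
          P : Pal (suc i) (rd′ m)
          P = to (<⇒≤ below) (proj₁ inner)

        -- The mirror image vouches for the letters up to `q` only. The radius ends exactly there,
        -- which leaves `exact` void and hands the rest to comparisons.
        clipped : q ∸ suc i ≤ rd′ m → ∃[ μ′ ] (μ′ < μ × Manacher μ′ (suc i) c q (q ∸ suc i) rd′)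
        clipped p with spend ≤-refl
        ... | μ′ , μ′< , b = μ′ , μ′< , record
          { c≤i = m≤n⇒m≤1+n (c≤i M) ; c+r = c+r M ; widest = widest M ; current =
            to (≤-reflexive e≡) (pal-≤ p (proj₁ inner))
          ; reach = ≤-reflexive e≡ ; exact = λ l → contradiction e≡ (<⇒≢ l)
          ; settled = settled′ ; last = last′ ; budget = b }
          where
          e≡ : suc i + (q ∸ suc i) ≡ q
          e≡ = m+[n∸m]≡n (<⇒≤ 1+i<q)

-- Correctness of the scans

module Naming (n w m κ : ℕ) (A≤m : 10 * suc n ≤ m) (A≤2^w : 10 * suc n ≤ 2 ^ w) (2n<2^w : suc n + suc n < 2 ^ w) where

  open Algorithm
  open Semantics n
  open Execution w m κ A≤m A≤2^w 2n<2^w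

  -- Names stand for the digits already consumed and `text` holds those to come; only both together
  -- determine the letter.
  record Named (L text bucket name : ℕ → ℕ) (top : ℕ) : Set where
    field
      sound    : ∀ {a b} → In n a → In n b → name a ≡ name b → text a ≡ text b → L a ≡ L b
      complete : ∀ {a b} → In n a → In n b → L a ≡ L b → name a ≡ name b × text a ≡ text b
      bounded  : ∀ {a} → In n a → name a ≤ n
      empty    : ∀ {c} → c ≤ n → bucket c ≡ 0
      text≤    : ∀ {a} → In n a → text a ≤ top

  open Named

  NamedState : (ℕ → ℕ) → ℕ → Vars → Arrs → Set
  NamedState L top (n′ ∷ i ∷ e ∷ d ∷ q ∷ k ∷ t ∷ []) (tx ∷ dg ∷ nx ∷ bk ∷ rp ∷ nm ∷ _) =
    n′ ≡ n × t ≡ top × Named L tx bk nm top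

  module _ (L : ℕ → ℕ) (S : ℕ) (L≤S : ∀ {a} → In n a → L a ≤ S) where

    MaxInv : ℕ → Vars → Arrs → Set
    MaxInv μ (n′ ∷ i ∷ e ∷ d ∷ q ∷ k ∷ t ∷ []) (tx ∷ dg ∷ nx ∷ bk ∷ rp ∷ nm ∷ _) =
      n′ ≡ n × i ≡ μ × i ≤ n × tx ≡ L × (∀ {c} → c ≤ n → bk c ≡ 0) × (∀ {a} → In n a → nm a ≡ 0)
      × t ≤ S × (∀ {a} → i < a → a ≤ n → L a ≤ t)

    -- As in the later steps, the tuple supplies in program order what `wp` demands: bounds on
    -- indices, sums and differences, then the empty output and the invariant.
    maxStep : ∀ {μ vs as} → MaxInv μ vs as → True (#0 ≺ I) vs as →
      Wp maxBody (λ vs′ as′ o → o ≡ [] × ∃[ μ′ ] (μ′ < μ × MaxInv μ′ vs′ as′)) vs as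
    maxStep {vs = n′ ∷ suc i ∷ e ∷ d ∷ q ∷ k ∷ t ∷ []} {tx ∷ dg ∷ nx ∷ bk ∷ rp ∷ nm ∷ _}
      (refl , refl , i≤n , refl , bk0 , nm0 , t≤S , above) _ =
      [ i≤n ,
      (λ t< → i≤n , s≤s z≤n , refl , i , ≤-refl , refl , refl , <⇒≤ i≤n , refl , bk0 , nm0 , L≤S (s≤s z≤n , i≤n) ,
         λ {a} i<a a≤n → case a ≟ suc i of λ
           { (yes refl) → ≤-refl
           ; (no a≢) → ≤-trans (above (≤∧≢⇒< i<a (a≢ ∘ sym)) a≤n) (<⇒≤ t<) }) ,
      (λ t≥ → s≤s z≤n , refl , i , ≤-refl , refl , refl , <⇒≤ i≤n , refl , bk0 , nm0 , t≤S ,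
         λ {a} i<a a≤n → case a ≟ suc i of λ
           { (yes refl) → t≥
           ; (no a≢) → above (≤∧≢⇒< i<a (a≢ ∘ sym)) a≤n }) ]ʷ

    findMax : ∀ {vs as} → MaxInv n vs as → Spec (loopWhile (#0 ≺ I) (compile maxBody))
      (loopCost (#0 ≺ I) (cost maxBody) n +κ)
      (λ vs′ as′ o → o ≡ [] × ∃[ top ] (top ≤ S × NamedState L top vs′ as′)) vs as
    findMax {vs} {as} inv = weaken ≤-refl (λ {vs} {as} → finish {vs} {as})
      (repeat (#0 ≺ I) (compile maxBody) MaxInv
        (λ {μ} {vs} {as} i → λ g → silent (maxStep {μ} {vs} {as} i g)) n {vs} {as} inv)
      where
      finish : ∀ {vs as o} → o ≡ [] × False (#0 ≺ I) vs as × ∃[ μ ] MaxInv μ vs as → o ≡ [] × ∃[ top ]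
        (top ≤ S × NamedState L top vs as)
      finish {n′ ∷ zero ∷ e ∷ d ∷ q ∷ k ∷ t ∷ []} {tx ∷ dg ∷ nx ∷ bk ∷ rp ∷ nm ∷ _}
        (refl , _ , μ , refl , refl , _ , refl , bk0 , nm0 , t≤S , above) =
        refl , t , t≤S , refl , refl , record
          { sound = λ _ _ _ e → e ; complete = λ a b e → trans (nm0 a) (sym (nm0 b)) , e
          ; bounded = λ i → ≤-trans (≤-reflexive (nm0 i)) z≤n ; empty = bk0 ; text≤ = λ (p , q) → above p q }

  module _ (text₀ name₀ : ℕ → ℕ) where

    dig : ℕ → ℕ
    dig a = text₀ a % suc n

    dig≤n : ∀ a → dig a ≤ n
    dig≤n a = ≤-pred (m%n<n (text₀ a) (suc n))

    record Build (i : ℕ) (text digit next bucket rep : ℕ → ℕ) : Set where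
      field
        processed     : ∀ {a} → 0 < a → a ≤ i → text a ≡ text₀ a / suc n
        pending     : ∀ {a} → i < a → a ≤ n → text a ≡ text₀ a
        digit0   : digit 0 ≡ suc n
        digits   : ∀ {a} → 0 < a → a ≤ i → digit a ≡ dig a
        links    : ∀ {a} → 0 < a → a ≤ i → Latest (λ j → dig j ≡ dig a) a (next a)
        buckets  : ∀ {c} → c ≤ n → Latest (λ j → dig j ≡ c) (suc i) (bucket c)
        rep0     : ∀ {a} → a ≤ i → rep a ≡ 0

    open Build

    extend : ∀ {P : ℕ → ℕ → Set} {f : ℕ → ℕ} {i v} → P (suc i) v → (∀ {a} → 0 < a → a ≤ i → P a (f a)) →
             ∀ {a} → 0 < a → a ≤ suc i → P a ((f [ suc i ↦ v ]) a)
    extend {P} {f} p ps {a} 0<a a≤ = [↦]-elim P f a p λ a≢ → ps 0<a (≤-pred (≤∧≢⇒< a≤ a≢))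

    Build-suc : ∀ {i tx dg nx bk rp} → suc i ≤ n → Build i tx dg nx bk rp →
      let k = tx (suc i) % suc n in
      Build (suc i) (tx [ suc i ↦ tx (suc i) / suc n ]) (dg [ suc i ↦ k ]) (nx [ suc i ↦ bk k ]) (bk [ k ↦ suc i ])
        (rp [ suc i ↦ 0 ])
    Build-suc {i} {tx} {dg} {nx} {bk} {rp} i<n b = record
      { processed = extend {λ a v → v ≡ text₀ a / suc n} (cong (_/ suc n) tx≡) (processed b)
      ; pending = λ i<a a≤n → trans ([↦]-other tx _ (<⇒≢ i<a ∘ sym)) (pending b (<-trans (n<1+n i) i<a) a≤n)
      ; digit0 = digit0 b
      ; digits = extend {λ a v → v ≡ dig a} k≡ (digits b)
      ; links = extend {λ a v → Latest (λ j → dig j ≡ dig a) a v}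
        (subst (λ c → Latest (λ j → dig j ≡ c) (suc i) (bk (tx (suc i) % suc n))) k≡
        (buckets b (≤-pred (m%n<n (tx (suc i)) (suc n))))) (links b)
      ; buckets = λ {c} c≤n → [↦]-elim (λ c → Latest (λ j → dig j ≡ c) (suc (suc i))) bk c (Latest-here (sym k≡))
          λ c≢k → Latest-skip (λ e → c≢k (trans (sym e) (sym k≡))) (buckets b c≤n)
      ; rep0 = λ {a} a≤ → [↦]-elim (λ _ v → v ≡ 0) rp a refl λ a≢ → rep0 b (≤-pred (≤∧≢⇒< a≤ a≢)) }
      where
      tx≡ : tx (suc i) ≡ text₀ (suc i)
      tx≡ = pending b (n<1+n i) i<n
      k : ℕ
      k = tx (suc i) % suc n
      k≡ : k ≡ dig (suc i)
      k≡ = cong (_% suc n) tx≡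

    BuildInv : ℕ → ℕ → Vars → Arrs → Set
    BuildInv top μ (n′ ∷ i ∷ e ∷ d ∷ q ∷ k ∷ t ∷ []) (tx ∷ dg ∷ nx ∷ bk ∷ rp ∷ nm ∷ _) =
      n′ ≡ n × t ≡ top × nm ≡ name₀ × i + μ ≡ n × Build i tx dg nx bk rp

    buildStep : ∀ {top μ vs as} → BuildInv top μ vs as → True (I ≺ N) vs as →
      Wp buildBody (λ vs′ as′ o → o ≡ [] × ∃[ μ′ ] (μ′ < μ × BuildInv top μ′ vs′ as′)) vs as
    buildStep {μ = zero} {vs = n′ ∷ i ∷ e ∷ d ∷ q ∷ k ∷ t ∷ []} {tx ∷ dg ∷ nx ∷ bk ∷ rp ∷ nm ∷ _}
      (refl , refl , refl , e≡ , b) i<n =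
      contradiction (trans (sym (+-identityʳ i)) e≡) (<⇒≢ i<n)
    buildStep {μ = suc μ} {vs = n′ ∷ i ∷ e ∷ d ∷ q ∷ k ∷ t ∷ []} {tx ∷ dg ∷ nx ∷ bk ∷ rp ∷ nm ∷ _}
      (refl , refl , refl , e≡ , b) i<n =
      [ ≤n⇒safe i<n , i<n , i<n , i<n , i<n , i<n , k≤n , k≤n , i<n , refl , μ , ≤-refl ,
      refl , refl , refl , trans (sym (+-suc i μ)) e≡ , Build-suc i<n b ]ʷ
      where
      k≤n : tx (suc i) % suc n ≤ n
      k≤n = ≤-pred (m%n<n (tx (suc i)) (suc n))

    module _ (old≤n : ∀ {a} → In n a → name₀ a ≤ n) where

      open Walking n dig name₀ dig≤n old≤n

      WalkInv : (ℕ → ℕ) → ℕ → ℕ → Vars → Arrs → Set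
      WalkInv text₁ top μ (n′ ∷ i ∷ e ∷ d ∷ q ∷ k ∷ t ∷ []) (tx ∷ dg ∷ nx ∷ bk ∷ rp ∷ nm ∷ _) =
        n′ ≡ n × t ≡ top × tx ≡ text₁ × Walk μ d e dg nx bk rp nm

      walkStep : ∀ {text₁ top μ vs as} → WalkInv text₁ top μ vs as →
        safeᶜ (#0 ≺ D ⊕ E) vs as (True (#0 ≺ D ⊕ E) vs as →
        Wp walkBody (λ vs′ as′ o → o ≡ [] × ∃[ μ′ ] (μ′ < μ × WalkInv text₁ top μ′ vs′ as′)) vs as)
      walkStep {vs = n′ ∷ i ∷ e ∷ d ∷ q ∷ k ∷ t ∷ []} {tx ∷ dg ∷ nx ∷ bk ∷ rp ∷ nm ∷ rest} (refl , refl , refl , W) =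
        d+e≤ (Walk.chained W) , λ 0<d+e →
          [ (λ { refl → down d 0<d+e W }) ,
          (λ e≢0 → let e≤n = proj₂ (proj₁ (element W e≢0)) in
            e≤n , name≤ W e≢0 , rep≤ W e≢0 ,
            (λ hit → e≤n , e≤n , refl , (let μ′ , μ′< , W′ = known W e≢0 hit in μ′ , μ′< , refl , refl , refl , W′)) ,
            (λ miss → name≤ W e≢0 , e≤n , e≤n , refl ,
              (let μ′ , μ′< , W′ = fresh W e≢0 miss in μ′ , μ′< , refl , refl , refl , W′))) ]ʷ
        where
        d+e≤ : Chained d e → d + e ≤ suc n + suc n
        d+e≤ (inj₁ refl) = +-mono-≤ (Walk.d≤ W) z≤n
        d+e≤ (inj₂ ((_ , e≤n) , _)) = +-mono-≤ (Walk.d≤ W) (m≤n⇒m≤1+n e≤n)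
        down : ∀ {μ} d → 0 < d + 0 → Walk μ d 0 dg nx bk rp nm →
          wp (v₃ ≔ D ⊖ #1 ⨟ v₂ ≔ bucket at D ⨟ bucket ⟨ D ⟩≔ #0)
            (λ vs′ as′ o → o ≡ [] × ∃[ μ′ ] (μ′ < μ × WalkInv tx t μ′ vs′ as′))
             (n ∷ i ∷ 0 ∷ d ∷ q ∷ k ∷ t ∷ []) (tx ∷ dg ∷ nx ∷ bk ∷ rp ∷ nm ∷ rest)
        down (suc d) _ W = s≤s z≤n , ≤-pred (Walk.d≤ W) , ≤-pred (Walk.d≤ W) , refl ,
          (let μ′ , μ′< , W′ = descend W in μ′ , μ′< , refl , refl , refl , W′)

      seen-none : ∀ {a} → ¬ Seen (suc n) 0 a
      seen-none {a} (_ , inj₁ p<) = <⇒≱ p< (m≤n⇒m≤1+n (dig≤n a))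
      seen-none {a} (_ , inj₂ (e≡ , _)) = <⇒≢ (s≤s (dig≤n a)) e≡

      Build⇒Walk : ∀ {tx dg nx bk rp} → Build n tx dg nx bk rp → Walk (suc n + n) (suc n) 0 dg nx bk rp name₀
      Build⇒Walk b = record
        { d≤ = ≤-refl ; chained = inj₁ refl ; digit0 = digit0 b
        ; digits = λ (p , q) → digits b p q ; links = λ (p , q) → links b p q
        ; buckets = λ c< → buckets b (≤-pred c<) ; emptied = λ n<c c≤n → contradiction c≤n (<⇒≱ n<c)
        ; refined = record
          { same = λ s → contradiction s seen-none ; differ = λ s → contradiction s seen-none
          ; name-in = λ s → contradiction s seen-none ; unseen = λ _ → refl
          ; rep-name = λ c≤n nz → contradiction (rep0 b c≤n) nz
          ; rep-dig = λ s → contradiction s seen-none }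
        ; left = λ _ → 1 ; left-1 = λ _ _ → refl ; left≤ = ≤-reflexive (cong (suc n +_) (Σ-const n)) }

      -- At the end every position is seen, and division with remainder recovers the old text from
      -- digit and quotient. So the new names with the quotients distinguish exactly what the old
      -- names with the old texts did.
      Walk⇒Named : ∀ {L top μ bk₀ text₁ dg nx bk rp nm} → (∀ {a} → In n a → text₁ a ≡ text₀ a / suc n) →
        Named L text₀ bk₀ name₀ top → Walk μ 0 0 dg nx bk rp nm → Named L text₁ bk nm (top / suc n)
      Walk⇒Named {L} {text₁ = text₁} {nm = nm} tx N W = record
        { sound = sound′ ; complete = complete′ ; bounded = λ i → proj₂ (proj₁ (name-in (seen i)))
        ; empty = Walk.emptied W z≤n
        ; text≤ = λ i → subst (_≤ _) (sym (tx i)) (/-monoˡ-≤ (suc n) (text≤ N i)) }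
        where
        open Refinement.Refined (Walk.refined W)
        seen : ∀ {a} → In n a → Seen 0 0 a
        seen {a} i with dig a ≟ 0
        ... | yes z = i , inj₂ (z , proj₁ i)
        ... | no nz = i , inj₁ (n≢0⇒n>0 nz)
        sound′ : ∀ {a b} → In n a → In n b → nm a ≡ nm b → text₁ a ≡ text₁ b → L a ≡ L b
        sound′ {a} {b} i j n≡ t≡ with same (seen i) (seen j) n≡
        ... | o , d = sound N i j o (trans (m≡m%n+[m/n]*n (text₀ a) (suc n))
          (trans (cong₂ (λ x y → x + y * suc n) d (trans (sym (tx i)) (trans t≡ (tx j))))
            (sym (m≡m%n+[m/n]*n (text₀ b) (suc n)))))
        complete′ : ∀ {a b} → In n a → In n b → L a ≡ L b → nm a ≡ nm b × text₁ a ≡ text₁ b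
        complete′ i j l with complete N i j l
        ... | o , t = differ (seen i) (seen j) o (cong (_% suc n) t) , trans (tx i)
          (trans (cong (_/ suc n) t) (sym (tx j)))

  Build-start : ∀ {L tx bk dg nx rp nm top} → Named L tx bk nm top → Build tx nm 0 tx (dg [ 0 ↦ suc n ]) nx bk
    (rp [ 0 ↦ 0 ])
  Build-start {tx = tx} {rp = rp} N = record
    { processed = λ 0<a a≤0 → contradiction a≤0 (<⇒≱ 0<a) ; pending = λ _ _ → refl ; digit0 = refl
    ; digits = λ 0<a a≤0 → contradiction a≤0 (<⇒≱ 0<a) ; links = λ 0<a a≤0 → contradiction a≤0 (<⇒≱ 0<a)
    ; buckets = λ {c} c≤n → subst (Latest (λ j → tx j % suc n ≡ c) 1) (sym (empty N c≤n)) Latest-start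
    ; rep0 = rep0′ }
    where
    rep0′ : ∀ {a} → a ≤ 0 → (rp [ 0 ↦ 0 ]) a ≡ 0
    rep0′ z≤n = refl

  module _ {L tx bk₀ nm : ℕ → ℕ} {top : ℕ} (named : Named L tx bk₀ nm top) where

    WalkInv′ : ℕ → Vars → Arrs → Set
    WalkInv′ μ vs as = ∃[ text₁ ]
      ((∀ {a} → In n a → text₁ a ≡ tx a / suc n) × WalkInv tx nm (bounded named) text₁ top μ vs as)

    walkPhase : ∀ {vs as} → WalkInv′ (suc n + n) vs as →
      Spec (loopWhile (#0 ≺ D ⊕ E) (compile walkBody) ⨾ compile divide)
        (loopCost (#0 ≺ D ⊕ E) (cost walkBody) (suc n + n) + cost divide +κ)
        (λ vs as o → o ≡ [] × NamedState L (top / suc n) vs as) vs as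
    walkPhase {vs} {as} (text₁ , t≡ , inv) =
      repeat (#0 ≺ D ⊕ E) (compile walkBody) (WalkInv tx nm (bounded named) text₁ top)
        (λ {μ} {vs} {as} inv → safeᶜ-map (#0 ≺ D ⊕ E) {vs} {as} (λ k g → silent (k g))
          (walkStep tx nm (bounded named) {μ = μ} {vs} {as} inv))
        (suc n + n) {vs} {as} inv ▷ λ {vs} {as} →
      λ { (refl , stop , μ , inv) → silent (finish vs as stop inv) }
      where
      finish : ∀ {μ} vs as → False (#0 ≺ D ⊕ E) vs as → WalkInv tx nm (bounded named) text₁ top μ vs as →
        Wp divide (λ vs as o → o ≡ [] × NamedState L (top / suc n) vs as) vs as
      finish (n′ ∷ i ∷ zero ∷ zero ∷ q ∷ k ∷ t ∷ []) (_ ∷ dg ∷ nx ∷ bk ∷ rp ∷ nm′ ∷ _) _ (refl , refl , refl , W) =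
        [ refl , refl , refl , Walk⇒Named tx nm (bounded named) t≡ named W ]ʷ

    walkStart : ∀ {μ} vs as → False (I ≺ N) vs as → BuildInv tx nm top μ vs as →
      Wp walkInit (λ vs as o → o ≡ [] × WalkInv′ (suc n + n) vs as) vs as
    walkStart {μ} (n′ ∷ i ∷ e ∷ d ∷ q ∷ k ∷ t ∷ []) (tx′ ∷ dg ∷ nx ∷ bk ∷ rp ∷ nm′ ∷ _) n≤i
      (refl , refl , refl , i+μ , b) =
      [ m≤n+m (suc n) (suc n) , refl , tx′ , (λ (p , q) → Build.processed b′ p q) , refl , refl , refl ,
        Build⇒Walk tx nm (bounded named) b′ ]ʷ
      where
      i≡n : i ≡ n
      i≡n = lia 3 (λ i μ n → n :≤ i ∷ i :+ μ :≡ n ∷ [] ⊢ i :≡ n) i μ n n≤i i+μ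
      b′ : Build tx nm n tx′ dg nx bk rp
      b′ = subst (λ i → Build tx nm i tx′ dg nx bk rp) i≡n b

  refine : ∀ {L top vs as} → NamedState L top vs as → Spec round (roundCost n +κ)
    (λ vs as o → o ≡ [] × NamedState L (top / suc n) vs as) vs as
  refine {L} {top} {n′ ∷ i ∷ e ∷ d ∷ q ∷ k ∷ t ∷ []} {tx ∷ dg ∷ nx ∷ bk ∷ rp ∷ nm ∷ _} (refl , refl , named) =
    silent {buildInit} {Q = λ vs as o → o ≡ [] × BuildInv tx nm top n vs as}
      [ z≤n , z≤n , m≤n+m (suc n) (suc n) , refl , refl , refl , refl , refl , Build-start named ]ʷ ▷ λ {vs} {as} →
    λ { (refl , inv) → repeat (I ≺ N) (compile buildBody) (BuildInv tx nm top)
      (λ {μ} {vs} {as} inv g → silent (buildStep tx nm {top} {μ} {vs} {as} inv g)) n {vs} {as} inv ▷ λ {vs} {as} →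
    λ { (refl , stop , μ , inv) → silent (walkStart named {μ} vs as stop inv) ▷ λ {vs} {as} →
    λ { (refl , inv) → walkPhase named {vs} {as} inv } } }

  -- top < (n + 1)^rounds bounds the number of rounds.
  Rounds : (ℕ → ℕ) → ℕ → Vars → Arrs → Set
  Rounds L μ vs as = ∃[ top ] (top < suc n ^ μ × NamedState L top vs as)

  naming : ∀ {L rounds vs as} → Rounds L rounds vs as →
    Spec (loopWhile (#0 ≺ M) round) (loopCost (#0 ≺ M) (roundCost n) rounds +κ)
      (λ vs as o → o ≡ [] × NamedState L 0 vs as) vs as
  naming {L} {rounds} {vs} {as} inv = weaken ≤-refl (λ {vs} {as} → finish {vs} {as})
    (repeat (#0 ≺ M) round (Rounds L) (λ {μ} {vs} {as} → step {μ} {vs} {as}) rounds {vs} {as} inv)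
    where
    step : ∀ {μ vs as} → Rounds L μ vs as → True (#0 ≺ M) vs as →
      Spec round (roundCost n +κ) (λ vs′ as′ o → o ≡ [] × ∃[ μ′ ] (μ′ < μ × Rounds L μ′ vs′ as′)) vs as
    -- With no round left `top < 1`, so `M` is 0 and the guard fails.
    step {zero} {_ ∷ _ ∷ _ ∷ _ ∷ _ ∷ _ ∷ zero ∷ []} {_ ∷ _ ∷ _ ∷ _ ∷ _ ∷ _ ∷ _} (top , _ , _ , refl , _) ()
    step {zero} {_ ∷ _ ∷ _ ∷ _ ∷ _ ∷ _ ∷ suc _ ∷ []} {_ ∷ _ ∷ _ ∷ _ ∷ _ ∷ _ ∷ _} (top , s≤s () , _ , refl , _) _
    step {suc μ} {vs} {as} (top , top< , named) _ =
      weaken ≤-refl (λ { (o≡ , named′) → o≡ , μ , ≤-refl , top / suc n , m<n*o⇒m/o<n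
        (subst (top <_) (*-comm (suc n) (suc n ^ μ)) top<) , named′ }) (refine {L} {top} {vs} {as} named)
    finish : ∀ {vs as o} → o ≡ [] × False (#0 ≺ M) vs as × ∃[ μ ] Rounds L μ vs as → o ≡ [] × NamedState L 0 vs as
    finish {_ ∷ _ ∷ _ ∷ _ ∷ _ ∷ _ ∷ zero ∷ []} {_ ∷ _ ∷ _ ∷ _ ∷ _ ∷ _ ∷ _}
      (refl , _ , _ , top , _ , refl , refl , named) = refl , refl , refl , named

-- Links between equal letters, repeated positions and radii

module Scanning (n w m κ : ℕ) (A≤m : 10 * suc n ≤ m) (A≤2^w : 10 * suc n ≤ 2 ^ w) (2n<2^w : suc n + suc n < 2 ^ w) where

  open Algorithm
  open Semantics n
  open Execution w m κ A≤m A≤2^w 2n<2^w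

  module _ (nm : ℕ → ℕ) where

    First : ℕ → ℕ → Set
    First a v = 0 < v × nm v ≡ nm a × (∀ {j} → 0 < j → nm j ≡ nm a → v ≤ j)

    Previous : ℕ → ℕ → Set
    Previous a = Latest (λ j → nm j ≡ nm a) a

    record Links (i : ℕ) (bucket prev first : ℕ → ℕ) : Set where
      field
        buckets : ∀ {c} → c ≤ n → Latest (λ j → nm j ≡ c) (suc i) (bucket c)
        prevs   : ∀ {a} → 0 < a → a ≤ i → Previous a (prev a)
        firsts  : ∀ {a} → 0 < a → a ≤ i → First a (first a)

    open Links

    Links-suc : ∀ {i bk pv ft v} → nm (suc i) ≤ n → Links i bk pv ft → First (suc i) v →
      Links (suc i) (bk [ nm (suc i) ↦ suc i ]) (pv [ suc i ↦ bk (nm (suc i)) ]) (ft [ suc i ↦ v ])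
    Links-suc {i} {bk} {pv} {ft} {v} c≤ L F = record
      { buckets = λ {c} c≤n → [↦]-elim (λ c → Latest (λ j → nm j ≡ c) (suc (suc i))) bk c (Latest-here refl)
          λ c≢ → Latest-skip (c≢ ∘ sym) (buckets L c≤n)
      ; prevs = λ {a} 0<a a≤ → [↦]-elim Previous pv a (buckets L c≤) λ a≢ → prevs L 0<a (≤-pred (≤∧≢⇒< a≤ a≢))
      ; firsts = λ {a} 0<a a≤ → [↦]-elim First ft a F λ a≢ → firsts L 0<a (≤-pred (≤∧≢⇒< a≤ a≢)) }

    module _ {i bk pv ft} (c≤ : nm (suc i) ≤ n) (L : Links i bk pv ft) where

      first-new : bk (nm (suc i)) ≡ 0 → First (suc i) (suc i)
      first-new z = s≤s z≤n , refl , λ {j} 0<j e → ≮⇒≥ λ j< → Latest.none (buckets L c≤) (subst (_< j) (sym z) 0<j) j< e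

      -- The previous occurrence has the same first occurrence, which is simply inherited.
      first-old : bk (nm (suc i)) ≢ 0 → First (suc i) (ft (bk (nm (suc i)))) × bk (nm (suc i)) ≤ i
      first-old nz with buckets L c≤
      ... | latest (inj₁ z) _ _ = contradiction z nz
      ... | latest (inj₂ v<) h _ with firsts L (n≢0⇒n>0 nz) (≤-pred v<)
      ... | 0<f , nf , least = (0<f , trans nf (h nz) , λ 0<j e → least 0<j (trans e (sym (h nz)))) , ≤-pred v<

    PrevInv : ℕ → Vars → Arrs → Set
    PrevInv μ (n′ ∷ i ∷ _) (tx ∷ dg ∷ nx ∷ bk ∷ rp ∷ nm′ ∷ pv ∷ ft ∷ _) =
      n′ ≡ n × nm′ ≡ nm × i + μ ≡ n × Links i bk pv ft

    module _ (bounded : ∀ {a} → In n a → nm a ≤ n) where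

      prevStep : ∀ {μ vs as} → PrevInv μ vs as → True (I ≺ N) vs as →
        Wp prevBody (λ vs′ as′ o → o ≡ [] × ∃[ μ′ ] (μ′ < μ × PrevInv μ′ vs′ as′)) vs as
      prevStep {zero} {n′ ∷ i ∷ e ∷ d ∷ q ∷ k ∷ t ∷ []} {tx ∷ dg ∷ nx ∷ bk ∷ rp ∷ nm′ ∷ pv ∷ ft ∷ rest}
        (refl , refl , e≡ , L) i<n =
        contradiction (trans (sym (+-identityʳ i)) e≡) (<⇒≢ i<n)
      prevStep {suc μ} {n′ ∷ i ∷ e ∷ d ∷ q ∷ k ∷ t ∷ []} {tx ∷ dg ∷ nx ∷ bk ∷ rp ∷ nm′ ∷ pv ∷ ft ∷ rest}
        (refl , refl , e≡ , L) i<n =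
        [ ≤n⇒safe i<n , i<n , c≤ , i<n , c≤ ,
          (λ z → i<n , refl , μ , ≤-refl , refl , refl , next′ , Links-suc c≤ L (first-new c≤ L z)) ,
          (λ nz → let F , v≤ = first-old c≤ L nz in
             i<n , ≤-trans v≤ (<⇒≤ i<n) , refl , μ , ≤-refl , refl , refl , next′ , Links-suc c≤ L F) ]ʷ
        where
        c≤ : nm (suc i) ≤ n
        c≤ = bounded (s≤s z≤n , i<n)
        next′ : suc i + μ ≡ n
        next′ = trans (sym (+-suc i μ)) e≡

      Linked : (pv ft : ℕ → ℕ) → Set
      Linked pv ft = ∀ {a} → In n a → Previous a (pv a) × First a (ft a)

      LinkedState : Vars → Arrs → Set
      LinkedState (n′ ∷ _) (tx ∷ dg ∷ nx ∷ bk ∷ rp ∷ nm′ ∷ pv ∷ ft ∷ _) = n′ ≡ n × nm′ ≡ nm × Linked pv ft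

      linking : ∀ {vs as} → PrevInv n vs as → Spec (loopWhile (I ≺ N) (compile prevBody))
        (loopCost (I ≺ N) (cost prevBody) n +κ)
        (λ vs as o → o ≡ [] × LinkedState vs as) vs as
      linking {vs} {as} inv = weaken ≤-refl (λ {vs} {as} → finish {vs} {as})
        (repeat (I ≺ N) (compile prevBody) PrevInv
          (λ {μ} {vs} {as} inv g → silent (prevStep {μ} {vs} {as} inv g)) n {vs} {as} inv)
        where
        finish : ∀ {vs as o} → o ≡ [] × False (I ≺ N) vs as × ∃[ μ ] PrevInv μ vs as → o ≡ [] × LinkedState vs as
        finish {n′ ∷ i ∷ _} {tx ∷ dg ∷ nx ∷ bk ∷ rp ∷ nm′ ∷ pv ∷ ft ∷ rest} (refl , n≤i , μ , refl , refl , _ , L) =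
          refl , refl , refl , λ (0<a , a≤n) → prevs L 0<a (≤-trans a≤n n≤i) , firsts L 0<a (≤-trans a≤n n≤i)

    module _ (pv ft : ℕ → ℕ) where

      -- The first position p ≥ j other than n whose letter occurs before p, or n.
      Repeat : ℕ → ℕ → Set
      Repeat j z = (∀ {p} → j ≤ p → p < z → pv p ≡ 0) × (z < n → j ≤ z × pv z ≢ 0)

      NextInv : ℕ → Vars → Arrs → Set
      NextInv μ (n′ ∷ i ∷ e ∷ d ∷ q ∷ _) (tx ∷ dg ∷ nx ∷ bk ∷ rp ∷ nm′ ∷ pv′ ∷ ft′ ∷ nr ∷ _) =
        n′ ≡ n × nm′ ≡ nm × pv′ ≡ pv × ft′ ≡ ft × i ≡ μ × i ≤ n × Repeat (suc i) q ×
          (∀ {a} → i < a → a ≤ n → Repeat a (nr a))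

      nextStep : ∀ {μ vs as} → NextInv μ vs as → True (#0 ≺ I) vs as →
        Wp nextBody (λ vs′ as′ o → o ≡ [] × ∃[ μ′ ] (μ′ < μ × NextInv μ′ vs′ as′)) vs as
      nextStep {vs = n′ ∷ suc i ∷ e ∷ d ∷ q ∷ k ∷ t ∷ []} {tx ∷ dg ∷ nx ∷ bk ∷ rp ∷ nm′ ∷ pv′ ∷ ft′ ∷ nr ∷ rest}
        (refl , refl , refl , refl , refl , i<n , (zeros , pos) , old) _ =
        [ i<n , (λ z → put (λ {p} i<p p<q →
          case p ≟ suc i of λ { (yes refl) → z ; (no p≢) → zeros (≤∧≢⇒< i<p (p≢ ∘ sym)) p<q })
                             (λ q<n → let r , nz = pos q<n in <⇒≤ r , nz)) ,
                (λ nz → put (λ i<p p≤i → contradiction p≤i (<⇒≱ (s≤s i<p))) (λ _ → ≤-refl , nz)) ]ʷ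
        where
        Q′ : Post
        Q′ vs′ as′ o = o ≡ [] × ∃[ μ′ ] (μ′ < suc i × NextInv μ′ vs′ as′)
        put : ∀ {z} → (∀ {p} → suc i ≤ p → p < z → pv p ≡ 0) → (z < n → suc i ≤ z × pv z ≢ 0) →
          wp (repeated ⟨ I ⟩≔ Q ⨟ v₁ ≔ I ⊖ #1) Q′ (n ∷ suc i ∷ e ∷ d ∷ z ∷ k ∷ t ∷ [])
            (tx ∷ dg ∷ nx ∷ bk ∷ rp ∷ nm ∷ pv ∷ ft ∷ nr ∷ rest)
        put {z} zeros′ pos′ = i<n , s≤s z≤n , refl , i , ≤-refl , refl , refl , refl , refl , refl , <⇒≤ i<n ,
          (zeros′ , pos′) , new
          where
          new : ∀ {a} → i < a → a ≤ n → Repeat a ((nr [ suc i ↦ z ]) a)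
          new {a} i<a a≤n = [↦]-elim Repeat nr a (zeros′ , pos′) λ a≢ → old (≤∧≢⇒< i<a (a≢ ∘ sym)) a≤n

      RepeatState : Vars → Arrs → Set
      RepeatState (n′ ∷ _) (tx ∷ dg ∷ nx ∷ bk ∷ rp ∷ nm′ ∷ pv′ ∷ ft′ ∷ nr ∷ _) =
        n′ ≡ n × nm′ ≡ nm × pv′ ≡ pv × ft′ ≡ ft × (∀ {a} → In n a → Repeat a (nr a))

      repeating : ∀ {vs as} → NextInv n vs as → Spec (loopWhile (#0 ≺ I) (compile nextBody))
        (loopCost (#0 ≺ I) (cost nextBody) n +κ)
        (λ vs as o → o ≡ [] × RepeatState vs as) vs as
      repeating {vs} {as} inv = weaken ≤-refl (λ {vs} {as} → finish {vs} {as})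
        (repeat (#0 ≺ I) (compile nextBody) NextInv
          (λ {μ} {vs} {as} inv g → silent (nextStep {μ} {vs} {as} inv g)) n {vs} {as} inv)
        where
        finish : ∀ {vs as o} → o ≡ [] × False (#0 ≺ I) vs as × ∃[ μ ] NextInv μ vs as → o ≡ [] × RepeatState vs as
        finish {n′ ∷ zero ∷ e ∷ d ∷ q ∷ _} {tx ∷ dg ∷ nx ∷ bk ∷ rp ∷ nm′ ∷ pv′ ∷ ft′ ∷ nr ∷ _}
          (refl , _ , μ , refl , refl , refl , refl , refl , _ , _ , R) =
          refl , refl , refl , refl , refl , λ (p , q) → R p q

      module _ (nr : ℕ → ℕ) where

        open Palindromes n nm

        ManacherInv : ℕ → Vars → Arrs → Set
        ManacherInv μ (n′ ∷ i ∷ e ∷ d ∷ q ∷ k ∷ _) (tx ∷ dg ∷ nx ∷ bk ∷ rp ∷ nm′ ∷ pv′ ∷ ft′ ∷ nr′ ∷ rd ∷ []) =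
          n′ ≡ n × nm′ ≡ nm × pv′ ≡ pv × ft′ ≡ ft × nr′ ≡ nr × i ≤ n × Manacher μ i d q k rd

        manacherStep : ∀ {μ vs as} → ManacherInv μ vs as →
          safeᶜ (I ≺ N) vs as (True (I ≺ N) vs as → Wp manacherBody
            (λ vs′ as′ o → o ≡ [] × ∃[ μ′ ] (μ′ < μ × ManacherInv μ′ vs′ as′)) vs as)
        manacherStep {μ} {n′ ∷ i ∷ e ∷ c ∷ q ∷ k ∷ t ∷ []} {tx ∷ dg ∷ nx ∷ bk ∷ rp ∷ nm′ ∷ pv′ ∷ ft′ ∷ nr′ ∷ rd ∷ []}
          (refl , refl , refl , refl , refl , _ , M) i<n =
          [ i+k≤ , (λ reach< → settling (Manacher.exact M reach<)) ,
            (λ q≤ → (λ q<n → (λ k<i → <⇒≤ k<i , ≤-trans (m∸n≤m i k) (<⇒≤ i<n) ,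
                ≤n⇒safe q<n , q<n ,
                (λ same → 1+k≤ , 1+q≤ , refl ,
                  (let μ′ , μ′< , M′ = grown M i<n q≤ q<n k<i same in μ′ , μ′< , refl , refl , refl , refl , refl ,
                  <⇒≤ i<n , M′)) ,
                (λ differ → settling (stuck M i<n q≤ differ))) ,
              (λ i≤k → settling (boundary M i<n q≤ (inj₁ i≤k)))) ,
             (λ n≤q → settling (boundary M i<n q≤ (inj₂ n≤q)))) ]ʷ
          where
          q≤ : q ≤ n
          q≤ = q≤n M
          Q′ : Post
          Q′ vs′ as′ o = o ≡ [] × ∃[ μ′ ] (μ′ < μ × ManacherInv μ′ vs′ as′)
          2n : ∀ {x} → x ≤ n + n → x ≤ suc n + suc n
          2n p = ≤-trans p (+-mono-≤ (n≤1+n n) (n≤1+n n))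
          i+k≤ : i + k ≤ suc n + suc n
          i+k≤ = 2n (≤-trans (Manacher.reach M) (≤-trans q≤ (m≤m+n n n)))
          1+k≤ : suc k ≤ suc n + suc n
          1+k≤ = ≤-trans (s≤s (≤-trans (m≤n+m k i) (≤-trans (Manacher.reach M) q≤))) (m≤m+n (suc n) (suc n))
          1+q≤ : suc q ≤ suc n + suc n
          1+q≤ = ≤-trans (s≤s q≤) (m≤m+n (suc n) (suc n))
          c+c≤ : c + c ≤ suc n + suc n
          c+c≤ = 2n (+-mono-≤ c≤n c≤n)
            where
            c≤n : c ≤ n
            c≤n = ≤-trans (Manacher.c≤i M) (<⇒≤ i<n)
          settling : MaxPal i k → wp settle Q′ (n ∷ i ∷ e ∷ c ∷ q ∷ k ∷ t ∷ [])
            (tx ∷ dg ∷ nx ∷ bk ∷ rp ∷ nm ∷ pv ∷ ft ∷ nr ∷ rd ∷ [])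
          settling max = <⇒≤ i<n , ≤n⇒safe i<n ,
            (λ 1+i<q → c+c≤ , 1+i≤2c M i<n max 1+i<q , mirror≤n M i<n max 1+i<q , <⇒≤ 1+i<q ,
              (λ l → refl , (let μ′ , μ′< , M′ = copied M i<n max 1+i<q l in μ′ , μ′< , refl , refl , refl , refl ,
                refl , i<n , M′)) ,
              (λ l → <⇒≤ 1+i<q , refl ,
                (let μ′ , μ′< , M′ = clipped M i<n max 1+i<q l in μ′ , μ′< , refl , refl , refl , refl , refl , i<n ,
                M′))) ,
            (λ q≤1+i → refl , (let μ′ , μ′< , M′ = restart M i<n max q≤1+i in μ′ , μ′< , refl , refl , refl , refl ,
              refl , i<n , M′))

        RadiusState : Vars → Arrs → Set
        RadiusState (n′ ∷ _) (tx ∷ dg ∷ nx ∷ bk ∷ rp ∷ nm′ ∷ pv′ ∷ ft′ ∷ nr′ ∷ rd ∷ []) =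
          n′ ≡ n × nm′ ≡ nm × pv′ ≡ pv × ft′ ≡ ft × nr′ ≡ nr × (∀ {a} → a ≤ n → MaxPal a (rd a))

        radii : ∀ {vs as} → ManacherInv (n + n) vs as → Spec (loopWhile (I ≺ N) (compile manacherBody))
          (loopCost (I ≺ N) (cost manacherBody) (n + n) +κ)
          (λ vs as o → o ≡ [] × RadiusState vs as) vs as
        radii {vs} {as} inv = weaken ≤-refl (λ {vs} {as} → finish {vs} {as})
          (repeat (I ≺ N) (compile manacherBody) ManacherInv
            (λ {μ} {vs} {as} inv → safeᶜ-map (I ≺ N) {vs} {as} (λ k g → silent (k g)) (manacherStep {μ} {vs} {as} inv))
              (n + n) {vs} {as} inv)
          where
          finish : ∀ {vs as o} → o ≡ [] × False (I ≺ N) vs as × ∃[ μ ] ManacherInv μ vs as → o ≡ [] × RadiusState vs as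
          finish {n′ ∷ i ∷ e ∷ d ∷ q ∷ k ∷ _} {tx ∷ dg ∷ nx ∷ bk ∷ rp ∷ nm′ ∷ pv′ ∷ ft′ ∷ nr′ ∷ rd ∷ []}
            (refl , n≤i , μ , refl , refl , refl , refl , refl , _ , M) =
              refl , refl , refl , refl , refl , refl , radius-max
            where
            radius-max : ∀ {a} → a ≤ n → MaxPal a (rd a)
            -- The loop stops before centre `n`; its radius 0 was written at the start.
            radius-max {a} a≤n with a ≟ n
            ... | yes refl = subst (MaxPal a) (sym (Manacher.last M))
              (pal-zero ≤-refl , λ P → +-cancelˡ-≤ a _ _ (≤-trans (Pal.c+r≤n P) (≤-reflexive (sym (+-identityʳ a)))))
            ... | no a≢n = Manacher.settled M (<-≤-trans (≤∧≢⇒< a≤n a≢n) n≤i)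

-- Canonical longest SAGPs on positions

module Canonical (n : ℕ) (f : ℕ → ℕ) where

  open Palindromes n f public
  open Pal

  -- A SAGP in terms of positions. The letters of `w` are mirrored at the pivot after a shift to the
  -- right by the gap, hence the summand `∣g∣ q` in `outer`.
  record Sag (q : Quad) : Set where
    field
      0<w   : 0 < ∣w∣ q
      0<g   : 0 < ∣g∣ q
      0<u   : 0 < ∣u∣ q
      fits  : ∣w∣ q + ∣g∣ q + ∣u∣ q ≤ pivot q
      inner : Pal (pivot q) (∣u∣ q)
      right : pivot q + ∣u∣ q + ∣w∣ q ≤ n
      outer : ∀ {y y′} → y + y′ + ∣g∣ q ≡ suc (pivot q + pivot q) → pivot q + ∣u∣ q < y′ →
        y′ ≤ pivot q + ∣u∣ q + ∣w∣ q → f y ≡ f y′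

  open Sag

  module Notions (S : Quad → Set) where

    Longest′ Canonical′ : Quad → Set
    Longest′ q = S q × (∀ q′ → S q′ → pivot q′ ≡ pivot q → armLength q′ ≤ armLength q)
    Canonical′ q = Longest′ q × (∀ q′ → Longest′ q′ → pivot q′ ≡ pivot q → ∣u∣ q′ ≤ ∣u∣ q)

  open Notions Sag

  -- If r is the maximal radius at i, this says that i is of type 1.
  Extensible : ℕ → ℕ → Set
  Extensible i r = 0 < r × i + r < n × ∃[ j ] (0 < j × j + r < i × f j ≡ f (suc (i + r)))

  Repeated : ℕ → Set
  Repeated p = ∃[ j ] (0 < j × j < p × f j ≡ f p)

  -- `i < p + r` expresses `p ≥ i - r + 1` without subtraction: `p` lies in the maximal palindrome.
  -- That `p < i` leaves room for a non-empty `u`.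
  Best : ℕ → ℕ → ℕ → Set
  Best i r p = i < p + r × p < i × Repeated p × (∀ {p′} → i < p′ + r → p′ < p → ¬ Repeated p′)

  -- w is the letter at position j, and u extends from p + 1 to the pivot.
  data Answer (q : Quad) : Set where
    answer : ∀ {r p j} → MaxPal (pivot q) r → ¬ Extensible (pivot q) r → Best (pivot q) r p →
             0 < j → f j ≡ f p → ∣w∣ q ≡ 1 → j + ∣g∣ q ≡ p → p + ∣u∣ q ≡ pivot q → 0 < ∣g∣ q → Answer q

  -- One construction for both uses of a single letter as `w`: with `p` inside the palindrome, and
  -- with `p = i - r`, whose mirror image is the first letter after it.
  Sag-letter : ∀ {i r p j g u} → Pal i r → i ≤ p + r → p < i → 0 < j → 0 < g → j + g ≡ p → p + u ≡ i → i + u < n →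
    (∀ {y′} → p + y′ ≡ suc (i + i) → f j ≡ f y′) → Sag (quad i 1 g u)
  Sag-letter {i} {r} {p} {j} {g} {u} P i≤ p<i 0<j 0<g refl refl u<n fj = record
    { 0<w = s≤s z≤n ; 0<g = 0<g
    ; 0<u = lia 2 (λ p u → p :< p :+ u ∷ [] ⊢ lit 0 :< u) p u p<i
    ; fits = lia 3 (λ j g u → lit 0 :< j ∷ [] ⊢ lit 1 :+ g :+ u :≤ j :+ g :+ u) j g u 0<j
    ; inner = pal-≤ (lia 3 (λ p u r → p :+ u :≤ p :+ r ∷ [] ⊢ u :≤ r) p u r i≤) P
    ; right = subst (_≤ n) (+-comm 1 (i + u)) u<n
    ; outer = λ {y} {y′} s a b → outer′ y y′ s a b }
    where
    outer′ : ∀ y y′ → y + y′ + g ≡ suc (i + i) → i + u < y′ → y′ ≤ i + u + 1 → f y ≡ f y′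
    outer′ y y′ s a b = trans (cong f y≡)
      (fj (trans (lia 4 (λ j g y y′ → y :≡ j ∷ [] ⊢ j :+ g :+ y′ :≡ y :+ y′ :+ g) j g y y′ y≡) s))
      where
      y≡ : y ≡ j
      y≡ = lia 5 (λ j g u y y′ → y :+ y′ :+ g :≡ lit 1 :+
        (j :+ g :+ u :+ (j :+ g :+ u)) ∷ j :+ g :+ u :+ u :< y′ ∷ y′ :≤ j :+ g :+ u :+ u :+ lit 1 ∷ []
        ⊢ y :≡ j) j g u y y′ s a b

  Sag-repeat : ∀ {i r p j g u} → Pal i r → i < p + r → p < i → 0 < j → 0 < g → f j ≡ f p → j + g ≡ p → p + u ≡ i → Sag
    (quad i 1 g u)
  Sag-repeat {i} {r} {p} {j} {g} {u} P i< p<i 0<j 0<g fj jg pu = Sag-letter P (<⇒≤ i<) p<i 0<j 0<g jg pu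
    (≤-trans (lia 4 (λ i u p r → p :+ u :≡ i ∷ i :< p :+ r ∷ [] ⊢ i :+ u :< i :+ r) i u p r pu i<) (c+r≤n P))
    λ {y′} s → trans fj (mirror P s (≤-trans (<⇒≤ p<i) (m≤m+n i r))
      (lia 4 (λ i p r y → p :+ y :≡ lit 1 :+ (i :+ i) ∷ i :< p :+ r ∷ [] ⊢ y :≤ i :+ r) i p r y′ s i<))

  -- `u` has the full length `r`, `w` is the letter at `j`, and the gap ends at `i - r`.
  Extensible⇒Sag : ∀ {i r} → Pal i r → Extensible i r → ∃[ g ] Sag (quad i 1 g r)
  Extensible⇒Sag {i} {r} P (0<r , r<n , j , 0<j , j+r< , fj) =
    i ∸ r ∸ j , Sag-letter {p = i ∸ r} P (≤-reflexive (sym ir))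
    (lia 3 (λ i r p → p :+ r :≡ i ∷ lit 0 :< r ∷ [] ⊢ p :< i) i r (i ∸ r) ir 0<r)
    0<j (m<n⇒0<n∸m j<) (m+[n∸m]≡n (<⇒≤ j<)) ir r<n
    λ {y′} s → trans fj (cong f
      (sym (lia 4 (λ i r p y → p :+ r :≡ i ∷ p :+ y :≡ lit 1 :+ (i :+ i) ∷ [] ⊢ y :≡ lit 1 :+ (i :+ r)) i r
      (i ∸ r) y′ ir s)))
    where
    ir : i ∸ r + r ≡ i
    ir = m∸n+n≡m (r≤c P)
    j< : j < i ∸ r
    j< = lia 4 (λ i r p j → p :+ r :≡ i ∷ j :+ r :< i ∷ [] ⊢ j :< p) i r (i ∸ r) j ir j+r<

  Sag⇒Extensible : ∀ {q r} → Sag q → ∣u∣ q ≤ r → r < armLength q → Extensible (pivot q) r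
  Sag⇒Extensible {quad i lw lg lu} {r} S u≤ r< = ≤-trans (0<u S) u≤ ,
    lia 5 (λ i lw lu r n → i :+ lu :+ lw :≤ n ∷ r :< lw :+ lu ∷ [] ⊢ i :+ r :< n) i lw lu r n (right S) r< ,
    j , m<n⇒0<n∸m room , lia 4 (λ i r lg j → lit 0 :< lg ∷ lg :+ r :+ j :≡ i ∷ [] ⊢ j :+ r :< i) i r lg j (0<g S) j≡ ,
    outer S (lia 4 (λ i r lg j → lg :+ r :+ j :≡ i ∷ [] ⊢ j :+ (lit 1 :+ (i :+ r)) :+ lg :≡ lit 1 :+
      (i :+ i)) i r lg j j≡)
      (s≤s (+-monoʳ-≤ i u≤))
        (lia 4 (λ i r lw lu → r :< lw :+ lu ∷ [] ⊢ lit 1 :+ (i :+ r) :≤ i :+ lu :+ lw) i r lw lu r<)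
    where
    j : ℕ
    -- The partner in `w` of position `i + r + 1`; it lies before `i - r` because the gap is
    -- non-empty.
    j = i ∸ (lg + r)
    room : lg + r < i
    room = lia 5 (λ i lw lg lu r → lw :+ lg :+ lu :≤ i ∷ r :< lw :+ lu ∷ [] ⊢ lg :+ r :< i) i lw lg lu r (fits S) r<
    j≡ : lg + r + j ≡ i
    j≡ = m+[n∸m]≡n (<⇒≤ room)

  arm≤ : ∀ {q r} → Sag q → MaxPal (pivot q) r → ¬ Extensible (pivot q) r → armLength q ≤ r
  arm≤ S (_ , max) ¬E = ≮⇒≥ λ r< → ¬E (Sag⇒Extensible S (max (inner S)) r<)

  -- wᴿ ends at the mirror image of p, so its last letter, which is the first
  -- letter of w, recurs at p.
  Sag⇒Repeated : ∀ {q r p} → Sag q → Pal (pivot q) r → armLength q ≤ r → p + armLength q ≡ suc (pivot q) →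
    ∃[ j ] (0 < j × j + ∣g∣ q ≡ p × f j ≡ f p)
  Sag⇒Repeated {quad i lw lg lu} {r} {p} S P a≤ p≡ = j , m<n⇒0<n∸m room , jg ,
    trans (outer S {j} {i + lu + lw} sum (m<m+n (i + lu) (0<w S)) ≤-refl)
      (sym (mirror P {p} {i + lu + lw}
        (lia 4 (λ i lw lu p → p :+ (lw :+ lu) :≡ lit 1 :+ i ∷ [] ⊢ p :+ (i :+ lu :+ lw) :≡ lit 1 :+
        (i :+ i)) i lw lu p p≡)
        (≤-trans p≤i (m≤m+n i r)) (lia 4 (λ i lw lu r → lw :+ lu :≤ r ∷ [] ⊢ i :+ lu :+ lw :≤ i :+ r) i lw lu r a≤)))
    where
    j : ℕ
    j = p ∸ lg
    room : lg < p
    room = lia 5 (λ i lw lg lu p → lw :+ lg :+ lu :≤ i ∷ p :+ (lw :+ lu) :≡ lit 1 :+ i ∷ [] ⊢ lg :< p) i lw lg lu p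
      (fits S) p≡
    jg : j + lg ≡ p
    jg = m∸n+n≡m (<⇒≤ room)
    p≤i : p ≤ i
    p≤i = lia 4 (λ i lw lu p → p :+ (lw :+ lu) :≡ lit 1 :+ i ∷ lit 0 :< lw ∷ [] ⊢ p :≤ i) i lw lu p p≡ (0<w S)
    sum : j + (i + lu + lw) + lg ≡ suc (i + i)
    sum = lia 6 (λ i lw lg lu p j → p :+ (lw :+ lu) :≡ lit 1 :+ i ∷ j :+ lg :≡ p ∷ [] ⊢ j :+
      (i :+ lu :+ lw) :+ lg :≡ lit 1 :+ (i :+ i)) i lw lg lu p j p≡ jg

  Answer-pivot< : ∀ {q} → Answer q → pivot q < n
  Answer-pivot< {quad i _ _ _} (answer {r} {p} (P , _) _ (i< , p<i , _) _ _ _ _ _ _) =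
    lia 4 (λ i p r n → i :< p :+ r ∷ p :< i ∷ i :+ r :≤ n ∷ [] ⊢ i :< n) i p r n i< p<i (c+r≤n P)

  -- A repeated position left of `p` would give a longer arm, so `p` is least. The same arm can also
  -- be split with a one-letter `w`, so the largest `u` leaves a single letter.
  canonical : ∀ {q r} → MaxPal (pivot q) r → ¬ Extensible (pivot q) r → Canonical′ q → Answer q
  canonical {quad i lw lg lu} {r} M@(P , _) ¬E ((S , longest) , canon) = build (Sag⇒Repeated S P a≤r p+)
    where
    a≤r : lw + lu ≤ r
    a≤r = arm≤ S M ¬E
    p : ℕ
    -- The mirror image of the last position of `wᴿ`.
    p = suc i ∸ (lw + lu)
    p+ : p + (lw + lu) ≡ suc i
    p+ = m∸n+n≡m (≤-trans a≤r (m≤n⇒m≤1+n (r≤c P)))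
    i< : i < p + r
    i< = subst (_≤ p + r) p+ (+-monoʳ-≤ p a≤r)
    p<i : p < i
    p<i = lia 4 (λ i lw lu p → p :+ (lw :+ lu) :≡ lit 1 :+ i ∷ lit 0 :< lw ∷ lit 0 :< lu ∷ [] ⊢ p :< i) i lw lu p p+
      (0<w S) (0<u S)
    least : ∀ {p′} → i < p′ + r → p′ < p → ¬ Repeated p′
    least {p′} i<′ p′<p (j , 0<j , j<p′ , fj) = contradiction
      (longest (quad i 1 (p′ ∸ j) (i ∸ p′))
        (Sag-repeat P i<′ p′<i 0<j (m<n⇒0<n∸m j<p′) fj (m+[n∸m]≡n (<⇒≤ j<p′)) (m+[n∸m]≡n (<⇒≤ p′<i))) refl)
      (<⇒≱ (lia 6 (λ i lw lu p p′ u → p :+ (lw :+ lu) :≡ lit 1 :+ i ∷ p′ :< p ∷ p′ :+ u :≡ i ∷ []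
        ⊢ lw :+ lu :< lit 1 :+ u) i lw lu p p′ (i ∸ p′) p+ p′<p (m+[n∸m]≡n (<⇒≤ p′<i))))
      where
      p′<i : p′ < i
      p′<i = <-trans p′<p p<i
    build : ∃[ j ] (0 < j × j + lg ≡ p × f j ≡ f p) → Answer (quad i lw lg lu)
    build (j , 0<j , jg , fj) = answer M ¬E (i< , p<i , (j , 0<j , j<p , fj) , least) 0<j fj lw≡1 jg
        (lia 4 (λ i lw lu p → p :+ (lw :+ lu) :≡ lit 1 :+ i ∷ lw :≡ lit 1 ∷ [] ⊢ p :+ lu :≡ i) i lw lu p p+ lw≡1)
          (0<g S)
      where
      j<p : j < p
      j<p = subst (j <_) jg (m<m+n j (0<g S))
      u′ : ℕ
      u′ = i ∸ p
      pu′ : p + u′ ≡ i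
      pu′ = m+[n∸m]≡n (<⇒≤ p<i)
      -- The competitor with the same gap and arm length but one letter in `w`.
      S′ : Sag (quad i 1 lg u′)
      S′ = Sag-repeat P i< p<i 0<j (0<g S) fj jg pu′
      arm≡ : 1 + u′ ≡ lw + lu
      arm≡ = lia 5 (λ i lw lu p u′ → p :+ (lw :+ lu) :≡ lit 1 :+ i ∷ p :+ u′ :≡ i ∷ []
        ⊢ lit 1 :+ u′ :≡ lw :+ lu) i lw lu p u′ p+ pu′
      lw≡1 : lw ≡ 1
      lw≡1 = lia 3 (λ lw lu u′ → lit 1 :+ u′ :≡ lw :+ lu ∷ u′ :≤ lu ∷ lit 0 :< lw ∷ [] ⊢ lw :≡ lit 1) lw lu u′ arm≡
        (canon (quad i 1 lg u′) (S′ , λ q′ Sq′ e → ≤-trans (longest q′ Sq′ e) (≤-reflexive (sym arm≡))) refl) (0<w S)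

  Answer⇒Sag : ∀ {q} → Answer q → Sag q
  Answer⇒Sag (answer (P , _) _ (i< , p<i , _) 0<j fj refl jg pu 0<g) = Sag-repeat P i< p<i 0<j 0<g fj jg pu

  -- A longer arm would yield a repeated `p′ < p`, against the choice of `p`. Among arms of length
  -- `1 + ∣u∣` none has a longer `u`, since `w` must not be empty.
  answer-canonical : ∀ {q} → Answer q → Canonical′ q
  answer-canonical {quad i lw lg lu} A@(answer {r} {p} M@(P , _) ¬E (i< , p<i , _ , least) 0<j fj refl jg pu 0<g) =
    (Answer⇒Sag A , longest) , λ { q′@(quad _ lw′ _ lu′) (S′ , longest′) refl →
      lia 3 (λ lw′ lu′ lu → lw′ :+ lu′ :≤ lit 1 :+ lu ∷ lit 0 :< lw′ ∷ [] ⊢ lu′ :≤ lu) lw′ lu′ lu (longest q′ S′ refl)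
        (0<w S′) }
    where
    longest : ∀ q′ → Sag q′ → pivot q′ ≡ i → armLength q′ ≤ 1 + lu
    longest q′@(quad _ lw′ lg′ lu′) S′ refl = ≮⇒≥ λ a> →
      least {p′} (subst (_≤ p′ + r) p′+ (+-monoʳ-≤ p′ a≤r))
        (lia 5 (λ i p p′ a lu → p′ :+ a :≡ lit 1 :+ i ∷ p :+ lu :≡ i ∷ lit 1 :+ lu :< a ∷ [] ⊢ p′ :< p) i p p′
          (lw′ + lu′) lu p′+ pu a>)
        (let j , 0<j , jg , fj = Sag⇒Repeated S′ P a≤r p′+ in j , 0<j , subst (j <_) jg (m<m+n j (Sag.0<g S′)) , fj)
      where
      a≤r : lw′ + lu′ ≤ r
      a≤r = arm≤ S′ M ¬E
      p′ : ℕ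
      p′ = suc i ∸ (lw′ + lu′)
      p′+ : p′ + (lw′ + lu′) ≡ suc i
      p′+ = m∸n+n≡m (≤-trans a≤r (m≤n⇒m≤1+n (r≤c P)))

  MaxPal-unique : ∀ {i r r′} → MaxPal i r → MaxPal i r′ → r ≡ r′
  MaxPal-unique (P , max) (P′ , max′) = ≤-antisym (max′ P) (max P′)

  Type1′ : ℕ → Set
  Type1′ i = ∃[ q ] (Sag q × pivot q ≡ i × MaxPal i (∣u∣ q))

  Extensible⇒Type1 : ∀ {i r} → MaxPal i r → Extensible i r → Type1′ i
  Extensible⇒Type1 M@(P , _) E = let g , S = Extensible⇒Sag P E in _ , S , refl , M

  Type1⇒Extensible : ∀ {i r} → MaxPal i r → Type1′ i → Extensible i r
  Type1⇒Extensible {r = r} M (quad _ lw _ lu , S , refl , M′) with MaxPal-unique M M′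
  ... | refl = Sag⇒Extensible S ≤-refl (m<n+m lu (0<w S))

-- Reporting

module _ {A : Set} {P R : A → Set} where

  Enumerates-resp : ∀ {xs} → (∀ {x} → P x → R x) → (∀ {x} → R x → P x) → xs Enumerates P → xs Enumerates R
  Enumerates-resp f g (unique , mem) = unique , λ x → mk⇔ (f ∘ Equivalence.to (mem x)) (Equivalence.from (mem x) ∘ g)

  Enumerates-∷ : ∀ {x xs} → ¬ P x → R x → (∀ {y} → P y → R y) → (∀ {y} → R y → y ≡ x ⊎ P y) → xs Enumerates P →
    (x ∷ xs) Enumerates R
  Enumerates-∷ {x} {xs} ¬Px Rx f g (unique , mem) =
    All.tabulate (λ { y∈ refl → ¬Px (Equivalence.to (mem _) y∈) }) ∷ unique ,
    λ y → mk⇔ (λ { (here refl) → Rx ; (there y∈) → f (Equivalence.to (mem y) y∈) })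
              (λ r → [ here , there ∘ Equivalence.from (mem y) ]′ (g r))

Enumerates-[] : {A : Set} {P : A → Set} → (∀ {x} → ¬ P x) → [] Enumerates P
Enumerates-[] none = [] , λ x → mk⇔ (λ ()) (λ p → contradiction p none)

module Reporting (n w m κ : ℕ) (A≤m : 10 * suc n ≤ m) (A≤2^w : 10 * suc n ≤ 2 ^ w)
  (2n<2^w : suc n + suc n < 2 ^ w) where

  open Algorithm
  open Semantics n
  open Execution w m κ A≤m A≤2^w 2n<2^w
  open Scanning n w m κ A≤m A≤2^w 2n<2^w

  module _ (nm pv ft nr rd : ℕ → ℕ)
    (links : ∀ {a} → In n a → Previous nm a (pv a) × First nm a (ft a))
    (repeats : ∀ {a} → In n a → Repeat nm pv ft a (nr a))
    (radii : ∀ {a} → a ≤ n → Palindromes.MaxPal n nm a (rd a)) where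

    open Canonical n nm

    -- The answers still to be reported when e is the next position of w for pivot i.
    Left : ℕ → ℕ → Quad → Set
    Left i e q = Answer q × (i < pivot q ⊎ (pivot q ≡ i × pivot q ≤ ∣g∣ q + ∣u∣ q + e))

    -- For `e ≡ 0` the pivot is finished or has nothing to report, and then `p` is unconstrained.
    Active : ℕ → ℕ → ℕ → Set
    Active i p e = e ≡ 0 ⊎ (i < n × ¬ Extensible i (rd i) × Best i (rd i) p × 0 < e × e < p × nm e ≡ nm p)

    pv< : ∀ {a} → In n a → pv a < a
    pv< {a} i = [ (λ z → subst (_< a) (sym z) (proj₁ i)) , (λ l → l) ]′ (Latest.before (proj₁ (links i)))

    Best-unique : ∀ {i r p p′} → Best i r p → Best i r p′ → p ≡ p′
    Best-unique (a , _ , b , c) (a′ , _ , b′ , c′) = ≤-antisym (≮⇒≥ λ p′<p → c a′ p′<p b′) (≮⇒≥ λ p<p′ → c′ a p<p′ b)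

    Repeated⇒prev : ∀ {p} → In n p → Repeated p → pv p ≢ 0
    Repeated⇒prev {p} i (j , 0<j , j<p , e) z = Latest.none (proj₁ (links i)) (subst (_< j) (sym z) 0<j) j<p e

    prev⇒Repeated : ∀ {p} → In n p → pv p ≢ 0 → Repeated p
    prev⇒Repeated i nz = _ , n≢0⇒n>0 nz , pv< i , Latest.holds (proj₁ (links i)) nz

    ≤prev : ∀ {p j} → In n p → j < p → nm j ≡ nm p → j ≤ pv p
    ≤prev i j<p e = ≮⇒≥ λ l → Latest.none (proj₁ (links i)) l j<p e

    module _ {i p e} (i<n : i < n) (¬E : ¬ Extensible i (rd i)) (best : Best i (rd i) p) (0<e : 0 < e) (e<p : e < p)
      (ep : nm e ≡ nm p) where

      private
        p<i : p < i
        p<i = proj₁ (proj₂ best)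
        eg : e + (p ∸ e) ≡ p
        eg = m+[n∸m]≡n (<⇒≤ e<p)
        pu : p + (i ∸ p) ≡ i
        pu = m+[n∸m]≡n (<⇒≤ p<i)
        x : Quad
        x = quad i 1 (p ∸ e) (i ∸ p)
        e-in : In n e
        e-in = 0<e , <⇒≤ (<-trans e<p (<-trans p<i i<n))

        x-answer : Answer x
        x-answer = answer (radii (<⇒≤ i<n)) ¬E best 0<e ep refl eg pu (m<n⇒0<n∸m e<p)

        x-not-left : ¬ Left i (pv e) x
        x-not-left (_ , inj₁ i<i) = <-irrefl refl i<i
        x-not-left (_ , inj₂ (_ , le)) = contradiction
          (lia 6 (λ i p e g u v → e :+ g :≡ p ∷ p :+ u :≡ i ∷ i :≤ g :+ u :+ v ∷ [] ⊢ e :≤ v) i p e (p ∸ e) (i ∸ p)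
            (pv e) eg pu le) (<⇒≱ (pv< e-in))

        split : ∀ {y} → Left i e y → y ≡ x ⊎ Left i (pv e) y
        split (A , inj₁ i<) = inj₂ (A , inj₁ i<)
        split {quad _ lw g u} (A@(answer {r} {p′} {j} M _ best′ 0<j fj refl jg pu′ 0<g) , inj₂ (refl , le))
          with MaxPal-unique (radii (<⇒≤ i<n)) M
        ... | refl with Best-unique best best′
        ... | refl with j ≟ e
        ... | yes refl = inj₁ (cong₂ (quad i 1)
                (+-cancelˡ-≡ j _ _ (trans jg (sym eg))) (+-cancelˡ-≡ p _ _ (trans pu′ (sym pu))))
        ... | no j≢e = inj₂ (A , inj₂
          (refl , lia 6 (λ i p j g u v → j :+ g :≡ p ∷ p :+ u :≡ i ∷ j :≤ v ∷ [] ⊢ i :≤ g :+ u :+ v) i p j g u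
          (pv e) jg pu′
                (≤prev e-in (≤∧≢⇒< j≤e j≢e) (trans fj (sym ep)))))
          where
          j≤e : j ≤ e
          j≤e = lia 6 (λ i p j g u e → j :+ g :≡ p ∷ p :+ u :≡ i ∷ i :≤ g :+ u :+ e ∷ [] ⊢ j :≤ e) i p j g u e jg pu′ le

      report-one : ∀ {o} → o Enumerates Left i (pv e) → (x ∷ o) Enumerates Left i e
      report-one = Enumerates-∷ x-not-left
        (x-answer , inj₂ (refl , lia 5 (λ i p e g u → e :+ g :≡ p ∷ p :+ u :≡ i ∷ [] ⊢ i :≤ g :+ u :+ e) i p e (p ∸ e)
          (i ∸ p) eg pu))
        (λ { (A , inj₁ i<) → A , inj₁ i< ; (A , inj₂ (e≡ , le)) → A , inj₂
          (e≡ , ≤-trans le (+-monoʳ-≤ _ (<⇒≤ (pv< e-in)))) })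
        split

      active-prev : Active i p (pv e)
      active-prev with pv e ≟ 0
      ... | yes z = inj₁ z
      ... | no nz = inj₂ (i<n , ¬E , best , n≢0⇒n>0 nz , <-trans (pv< e-in) e<p , trans
        (Latest.holds (proj₁ (links e-in)) nz) ep)

    -- For an answer with `w` at `j` the pivot is `j + ∣g∣ + ∣u∣`, so the inequality says `j ≤ e`.
    Complete : ℕ → ℕ → Set
    Complete i e = ∀ {q} → Answer q → pivot q ≡ i → pivot q ≤ ∣g∣ q + ∣u∣ q + e

    -- With `e` at 0 no answer for pivot `i` remains, because `j` is positive. All those for `suc i`
    -- are still due, because `e` is complete.
    advance : ∀ {i e o} → Complete (suc i) e → o Enumerates Left (suc i) e → o Enumerates Left i 0
    advance {i} {e} complete = Enumerates-resp
      (λ { (A , inj₁ 1+i<) → A , inj₁ (<-trans (n<1+n i) 1+i<) ; (A , inj₂ (refl , _)) → A , inj₁ (n<1+n i) })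
      λ { {q} (A , inj₁ i<) → A ,
        (case pivot q ≟ suc i of λ { (yes e≡) → inj₂ (e≡ , complete A e≡) ; (no e≢) → inj₁ (≤∧≢⇒< i< (e≢ ∘ sym)) })
        ; {quad _ _ g u} (answer {p = p} {j} _ _ _ 0<j _ _ jg pu _ , inj₂ (refl , le)) → contradiction
            (lia 5 (λ i p j g u → lit 0 :< j ∷ j :+ g :≡ p ∷ p :+ u :≡ i ∷ i :≤ g :+ u :+ lit 0 ∷ []
              ⊢ :⊥) i p j g u 0<j jg pu le) λ () }

    Selected : ℕ → ℕ → ℕ → Set
    Selected i p e = Active i p e × Complete i e

    none : ∀ {i p} → (∀ {q} → Answer q → pivot q ≡ i → ∀ {A : Set} → A) → Selected i p 0
    none absurd = inj₁ refl , λ A e → absurd A e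

    -- This and the following `select-` lemmas correspond to the leaves of the code that chooses `E`
    -- for a new pivot.
    select-bound : ∀ {i p} → n ≤ i → Selected i p 0
    select-bound n≤i = none λ { A refl → contradiction n≤i (<⇒≱ (Answer-pivot< A)) }

    module _ {i} (i<n : i < n) where

      private
        r j : ℕ
        r = rd i
        j = 1 + i ∸ r
        R₀ : MaxPal i r
        R₀ = radii (<⇒≤ i<n)
        r≤i : r ≤ i
        r≤i = Pal.r≤c (proj₁ R₀)
        jr : j + r ≡ suc i
        jr = m∸n+n≡m (m≤n⇒m≤1+n r≤i)

      radius≤ : r ≤ 1 + i
      radius≤ = m≤n⇒m≤1+n r≤i

      select-empty : ∀ {p} → r ≤ 0 → Selected i p 0
      select-empty r≤0 = none λ { (answer {r′} {p} M′ _ (i< , p<i , _) _ _ _ _ _ _) refl →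
        case MaxPal-unique R₀ M′ of λ { refl → contradiction
          (lia 3 (λ i p r → i :< p :+ r ∷ p :< i ∷ r :≤ lit 0 ∷ [] ⊢ :⊥) i p r′ i< p<i r≤0) λ () } }

      start-in : 0 < r → In n j
      start-in 0<r = lia 3 (λ i j r → j :+ r :≡ lit 1 :+ i ∷ r :≤ i ∷ [] ⊢ lit 0 :< j) i j r jr r≤i ,
        ≤-trans (lia 3 (λ i j r → j :+ r :≡ lit 1 :+ i ∷ lit 0 :< r ∷ [] ⊢ j :≤ i) i j r jr 0<r) (<⇒≤ i<n)

      module _ (0<r : 0 < r) where

        private
          p : ℕ
          p = nr j
          chosen : Repeat nm pv ft j p
          chosen = repeats (start-in 0<r)
          barren : ∀ {p′} → i < p′ + r → p′ < i → p′ < p → ¬ Repeated p′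
          barren {p′} i< p′<i p′<p R =
            Repeated⇒prev (≤-trans (s≤s z≤n) (≤-trans (proj₁ (start-in 0<r)) j≤) , <⇒≤ (<-trans p′<i i<n)) R
            (proj₁ chosen j≤ p′<p)
            where
            j≤ : j ≤ p′
            j≤ = lia 4 (λ i j r p′ → j :+ r :≡ lit 1 :+ i ∷ i :< p′ :+ r ∷ [] ⊢ j :≤ p′) i j r p′ jr i<

        select-barren : i ≤ p → Selected i p 0
        select-barren i≤p = none λ { (answer {p = p′} M′ _ (i< , p′<i , R , _) _ _ _ _ _ _) refl →
          case MaxPal-unique R₀ M′ of λ { refl → contradiction R (barren i< p′<i (<-≤-trans p′<i i≤p)) } }

        module _ (p<i : p < i) where

          private
            p-in : In n p
            p-in = ≤-trans (proj₁ (start-in 0<r)) (proj₁ (proj₂ chosen (<-trans p<i i<n))) , <⇒≤ (<-trans p<i i<n)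
            best : Best i r p
            best = lia 4 (λ i j r p → j :+ r :≡ lit 1 :+ i ∷ j :≤ p ∷ [] ⊢ i :< p :+ r) i j r p jr
              (proj₁ (proj₂ chosen (<-trans p<i i<n))) ,
              p<i , prev⇒Repeated p-in nz , λ i< p′<p → barren i< (<-trans p′<p p<i) p′<p
              where
              nz : pv p ≢ 0
              nz = proj₂ (proj₂ chosen (<-trans p<i i<n))

          chosen≤ : p ≤ n
          chosen≤ = proj₂ p-in

          select-type1 : i + r < n → ft (1 + (i + r)) + r < i → Selected i p 0
          select-type1 r<n f<i = none λ { (answer M′ ¬E _ _ _ _ _ _ _) refl →
            case MaxPal-unique R₀ M′ of λ { refl → contradiction
              (0<r , r<n , _ , proj₁ F , f<i , proj₁ (proj₂ F)) ¬E } }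
            where
            F : First nm (suc (i + r)) (ft (suc (i + r)))
            F = proj₂ (links (s≤s z≤n , r<n))

          private
            found : ¬ Extensible i r → Selected i p (pv p)
            found ¬E = inj₂ (i<n , ¬E , best , n≢0⇒n>0 nz , pv< p-in , Latest.holds (proj₁ (links p-in)) nz) , complete
              where
              nz : pv p ≢ 0
              nz = proj₂ (proj₂ chosen (<-trans p<i i<n))
              complete : Complete i (pv p)
              complete {quad _ _ g u} (answer {p = p′} {j′} M′ _ best′ 0<j fj _ jg pu 0<g) refl with MaxPal-unique R₀ M′
              ... | refl with Best-unique best best′
              ... | refl = lia 6 (λ i p j g u v → j :+ g :≡ p ∷ p :+ u :≡ i ∷ j :≤ v ∷ [] ⊢ i :≤ g :+ u :+ v) i p j′ g u
                (pv p) jg pu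
                (≤prev p-in (subst (j′ <_) jg (m<m+n j′ 0<g)) fj)

          -- The condition `j + r < i` is inherited by smaller `j`; if the first occurrence violates
          -- it, all do.
          select-inner : i + r < n → i ≤ ft (1 + (i + r)) + r → Selected i p (pv p)
          select-inner r<n i≤ = found λ { (_ , _ , j , 0<j , j< , e) →
            contradiction (≤-trans i≤ (+-monoˡ-≤ r (proj₂ (proj₂ (proj₂ (links (s≤s z≤n , r<n)))) 0<j e))) (<⇒≱ j<) }

          -- No letter follows the maximal palindrome, so the pivot cannot be of type 1.
          select-suffix : n ≤ i + r → Selected i p (pv p)
          select-suffix n≤ = found λ { (_ , r<n , _) → contradiction n≤ (<⇒≱ r<n) }

    module _ (cost≤κ : reportCost ≤ κ) where

      -- `μ` bounds the pivots left and pays for the passes that move on. `ε` bounds `e` and serves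
      -- only the recursion along the links: a pass that reports is paid by its output and leaves
      -- `μ` as it is.
      reporting : ∀ μ ε {i e d p k t tx dg nx bk rp nm′} → n ≤ i + μ → e ≤ ε → Active i p e →
        Spec (loopWhile (I ≺ N) (compile reportBody)) (suc μ * reportCost +κ) (λ _ _ o → o Enumerates Left i e)
          (n ∷ i ∷ e ∷ d ∷ p ∷ k ∷ t ∷ []) (tx ∷ dg ∷ nx ∷ bk ∷ rp ∷ nm′ ∷ pv ∷ ft ∷ nr ∷ rd ∷ [])
      reporting μ ε {i} {e} {d} {p} {k} {t} {tx} {dg} {nx} {bk} {rp} {nm′} n≤i+μ e≤ε active =
        iterate (I ≺ N) (compile reportBody) {B = λ _ → cost reportBody}
          (≤-trans (m≤m+n _ (cost reportBody)) (m≤m+n reportCost (μ * reportCost)))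
          ((λ i<n → loud [ (λ { refl → ≤n⇒safe i<n , selecting μ n≤i+μ i<n }) ,
                           (λ e≢0 → listing ε e≤ε active e≢0) ]ʷ) ,
           (λ n≤i → Enumerates-[] λ { (A , inj₁ i<) → <⇒≱ (Answer-pivot< A) (≤-trans n≤i (<⇒≤ i<)) ;
             (A , inj₂ (refl , _)) → <⇒≱ (Answer-pivot< A) n≤i }))
        where
        as′ : Arrs
        as′ = tx ∷ dg ∷ nx ∷ bk ∷ rp ∷ nm′ ∷ pv ∷ ft ∷ nr ∷ rd ∷ []
        Q′ : ℕ → ℕ → ℕ → Post
        Q′ μ i e vs as o = ∃[ t′ ] reportCost + t′ ≤ (suc μ * reportCost +κ) o
          × Spec (loopWhile (I ≺ N) (compile reportBody)) (t′ +κ) (λ _ _ o′ → (o ++ o′) Enumerates Left i e) vs as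

        listing : ∀ ε → e ≤ ε → Active i p e → e ≢ 0 →
          wp (write I #1 (Q ⊖ E) (I ⊖ Q) ⨟ v₂ ≔ prev at E) (Q′ μ i e) (n ∷ i ∷ e ∷ d ∷ p ∷ k ∷ t ∷ []) as′
        listing ε e≤ε (inj₁ z) nz = contradiction z nz
        listing zero e≤0 (inj₂ (_ , _ , _ , 0<e , _)) nz = contradiction e≤0 (<⇒≱ 0<e)
        listing (suc ε) e≤ε (inj₂ (i<n , ¬E , best , 0<e , e<p , ep)) nz =
          <⇒≤ e<p , <⇒≤ (proj₁ (proj₂ best)) , e≤n , suc μ * reportCost ,
          subst (reportCost + suc μ * reportCost ≤_)
            (trans (+-comm κ (suc μ * reportCost)) (cong (suc μ * reportCost +_) (sym (*-identityʳ κ))))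
            (+-monoˡ-≤ (suc μ * reportCost) cost≤κ) ,
          weaken ≤-refl (report-one i<n ¬E best 0<e e<p ep)
            (reporting μ ε n≤i+μ (≤-pred (<-≤-trans (pv< (0<e , e≤n)) e≤ε)) (active-prev i<n ¬E best 0<e e<p ep))
          where
          e≤n : e ≤ n
          e≤n = <⇒≤ (<-trans e<p (<-trans (proj₁ (proj₂ best)) i<n))

        selecting : ∀ μ → n ≤ i + μ → i < n →
          wp (if I ≺ N then select else nop end) (Q′ μ i 0)
            (n ∷ suc i ∷ 0 ∷ d ∷ p ∷ k ∷ t ∷ []) as′
        selecting zero n≤ i<n = contradiction (subst (n ≤_) (+-identityʳ i) n≤) (<⇒≱ i<n)
        selecting (suc μ) n≤ i<n =
          (λ 1+i<n → i<n , (λ 0<r → ≤n⇒safe 1+i<n , radius≤ 1+i<n , proj₂ (start-in 1+i<n 0<r) ,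
              (λ p<i → i+r≤ , (λ r<n → i+r≤ , ≤n⇒safe r<n , r<n , f+r≤ r<n ,
                  (λ f<i → leaf (select-type1 1+i<n 0<r p<i r<n f<i)) ,
                  (λ i≤f → chosen≤ 1+i<n 0<r p<i , leaf (select-inner 1+i<n 0<r p<i r<n i≤f))) ,
                (λ n≤r → chosen≤ 1+i<n 0<r p<i , leaf (select-suffix 1+i<n 0<r p<i n≤r))) ,
              (λ i≤p → leaf (select-barren 1+i<n 0<r i≤p))) ,
            (λ r≤0 → leaf (select-empty 1+i<n r≤0))) ,
          (λ n≤1+i → leaf (select-bound n≤1+i))
          where
          r : ℕ
          r = rd (suc i)
          i+r≤ : suc i + r ≤ suc n + suc n
          i+r≤ = ≤n⇒safe (Pal.c+r≤n (proj₁ (radii i<n)))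
          f+r≤ : suc i + r < n → ft (1 + (suc i + r)) + r ≤ suc n + suc n
          f+r≤ r<n = +-mono-≤ (≤-trans (proj₂ (proj₂ (proj₂ (links (s≤s z≤n , r<n)))) (s≤s z≤n) refl)
            (≤-trans r<n (n≤1+n n)))
            (≤-trans (m≤n+m r (suc i)) (≤-trans (<⇒≤ r<n) (n≤1+n n)))
          leaf : ∀ {e p k} → Selected (suc i) p e → Q′ (suc μ) i 0
            (n ∷ suc i ∷ e ∷ d ∷ p ∷ k ∷ t ∷ []) as′ []
          leaf {e} {p} (active , complete) = suc μ * reportCost , m≤m+n (reportCost + suc μ * reportCost) (κ * 0) ,
            -- `ε` starts afresh with each pivot.
            weaken ≤-refl (advance complete) (reporting μ n (subst (n ≤_) (+-suc i μ) n≤) (e≤n active) active)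
            where
            e≤n : Active (suc i) p e → e ≤ n
            e≤n (inj₁ refl) = z≤n
            e≤n (inj₂ (i<n , _ , (_ , p<i , _) , _ , e<p , _)) = <⇒≤ (<-trans e<p (<-trans p<i i<n))

-- Strings and positions

module _ {σ : ℕ} where

  -- Indexed from 0. The default 0 is no letter and agrees with the memory beyond the text.
  at : Str σ → ℕ → ℕ
  at [] _ = 0
  at (a ∷ s) zero = letter a
  at (a ∷ s) (suc j) = at s j

  at-++ˡ : ∀ s {t j} → j < length s → at (s ++ t) j ≡ at s j
  at-++ˡ (a ∷ s) {j = zero} _ = refl
  at-++ˡ (a ∷ s) {j = suc j} (s≤s l) = at-++ˡ s l

  at-++ʳ : ∀ s {t} j → at (s ++ t) (length s + j) ≡ at t j
  at-++ʳ [] j = refl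
  at-++ʳ (a ∷ s) j = at-++ʳ s j

  at-ext : ∀ s t → length s ≡ length t → (∀ {j} → j < length s → at s j ≡ at t j) → s ≡ t
  at-ext [] [] _ _ = refl
  at-ext (a ∷ s) (b ∷ t) len eq′ = cong₂ _∷_ (toℕ-injective (suc-injective (eq′ {0} (s≤s z≤n))))
    (at-ext s t (suc-injective len) (λ l → eq′ (s≤s l)))

  at-reverse : ∀ s {i j} → suc (i + j) ≡ length s → at (reverse s) i ≡ at s j
  at-reverse (a ∷ s) {i} {zero} e = trans (cong (λ t → at t i) (unfold-reverse a s))
    (trans (cong (at (reverse s ++ a ∷ []))
      (trans (sym (+-identityʳ i)) (trans (suc-injective e) (trans (sym (length-reverse s)) (sym (+-identityʳ _))))))
      (at-++ʳ (reverse s) 0))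
  at-reverse (a ∷ s) {i} {suc j} e = trans (cong (λ t → at t i) (unfold-reverse a s))
    (trans (at-++ˡ (reverse s) (subst (i <_) (sym (length-reverse s)) (subst (i <_) e′ (s≤s (m≤m+n i j)))))
      (at-reverse s e′))
    where
    e′ : suc (i + j) ≡ length s
    e′ = trans (sym (+-suc i j)) (suc-injective e)

  cut : ∀ k (s : Str σ) → k ≤ length s → ∃[ x ] ∃[ y ] (s ≡ x ++ y × length x ≡ k)
  cut zero s _ = [] , s , refl , refl
  cut (suc k) (a ∷ s) (s≤s l) with cut k s l
  ... | x , y , refl , refl = a ∷ x , y , refl , refl

  -- Cell 0 of the initial memory holds the length, cell j the letter at position j.
  cell : Str σ → ℕ → ℕ
  cell T zero = length T
  cell T (suc j) = at T j

  module _ (T : Str σ) where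

    private
      n : ℕ
      n = length T

    open Canonical n (cell T)
    open Sag

    even⇒pal : ∀ {i r} → EvenPalindrome T i r → Pal i r
    even⇒pal {i} {r} (s , b , (x , y , T≡ , b≡) , b+r , |s| , s≡) = pal
      (lia 3 (λ i r x → x :+ r :≡ i ∷ [] ⊢ r :≤ i) i r (length x) xr)
      (lia 5 (λ i r x n y → x :+ r :≡ i ∷ n :≡ x :+ (r :+ r :+ y) ∷ [] ⊢ i :+ r :≤ n) i r (length x) n (length y) xr n≡)
      λ {y₁} {y₂} → mirror′ y₁ y₂
      where
      xr : length x + r ≡ i
      xr = suc-injective (trans (cong (_+ r) (sym b≡)) b+r)
      n≡ : n ≡ length x + (r + r + length y)
      n≡ = trans (cong length T≡)
        (trans (length-++ x) (cong (length x +_) (trans (length-++ s) (cong (_+ length y) |s|))))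
      inside : ∀ a → a < length s → cell T (suc (length x + a)) ≡ at s a
      inside a l = trans (cong (λ T → at T (length x + a)) T≡) (trans (at-++ʳ x a) (at-++ˡ s l))
      mirror′ : ∀ y₁ y₂ → y₁ + y₂ ≡ suc (i + i) → y₁ ≤ i + r → y₂ ≤ i + r → cell T y₁ ≡ cell T y₂
      mirror′ y₁ y₂ sum p q = trans (cong (cell T) (sym e₁)) (trans (inside a a<) (trans (cong (λ s → at s a) s≡)
          (trans (at-reverse s (trans ab (sym |s|))) (trans (sym (inside b′ b<)) (cong (cell T) e₂)))))
        where
        above : ∀ y₁ y₂ → y₁ + y₂ ≡ suc (i + i) → y₂ ≤ i + r → suc (length x) ≤ y₁
        above y₁ y₂ sum q = lia 5
          (λ i r x y₁ y₂ → x :+ r :≡ i ∷ y₁ :+ y₂ :≡ lit 1 :+ (i :+ i) ∷ y₂ :≤ i :+ r ∷ [] ⊢ lit 1 :+ x :≤ y₁) i r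
          (length x) y₁ y₂ xr sum q
        a b′ : ℕ
        a = y₁ ∸ suc (length x)
        b′ = y₂ ∸ suc (length x)
        e₁ : suc (length x + a) ≡ y₁
        e₁ = m+[n∸m]≡n (above y₁ y₂ sum q)
        e₂ : suc (length x + b′) ≡ y₂
        e₂ = m+[n∸m]≡n (above y₂ y₁ (trans (+-comm y₂ y₁) sum) p)
        ab : suc (a + b′) ≡ r + r
        ab = lia 7 (λ i r x y₁ y₂ a b → x :+ r :≡ i ∷ y₁ :+ y₂ :≡ lit 1 :+ (i :+ i) ∷ lit 1 :+ (x :+ a) :≡ y₁ ∷ lit 1 :+
          (x :+ b) :≡ y₂ ∷ [] ⊢ lit 1 :+ (a :+ b) :≡ r :+ r)
          i r (length x) y₁ y₂ a b′ xr sum e₁ e₂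
        a< : a < length s
        a< = subst (a <_) (sym |s|) (lia 3 (λ a b r → lit 1 :+ (a :+ b) :≡ r :+ r ∷ [] ⊢ a :< r :+ r) a b′ r ab)
        b< : b′ < length s
        b< = subst (b′ <_) (sym |s|) (lia 3 (λ a b r → lit 1 :+ (a :+ b) :≡ r :+ r ∷ [] ⊢ b :< r :+ r) a b′ r ab)

    remaining : ∀ {S S₁ : Str σ} {l} x → S ≡ x ++ S₁ → length x + l ≤ length S → l ≤ length S₁
    remaining x refl l = +-cancelˡ-≤ (length x) _ _ (≤-trans l (≤-reflexive (length-++ x)))

    pal⇒even : ∀ {i r} → Pal i r → EvenPalindrome T i r
    pal⇒even {i} {r} P with cut (i ∸ r) T (≤-trans (m∸n≤m i r) (≤-trans (m≤m+n i r) (Pal.c+r≤n P)))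
    ... | x , T₁ , T≡ , x≡ with cut (r + r) T₁ (remaining x T≡ (subst (_≤ n) fits′ (Pal.c+r≤n P)))
      where
      fits′ : i + r ≡ length x + (r + r)
      fits′ = trans (cong (_+ r) (sym (trans (cong (_+ r) x≡) (m∸n+n≡m (Pal.r≤c P))))) (+-assoc (length x) r r)
    ... | s , y , T₁≡ , s≡ = s , suc (length x) , (x , y , trans T≡ (cong (x ++_) T₁≡) , refl) , cong suc xr , s≡ ,
      at-ext s (reverse s) (sym (length-reverse s)) λ {j} → palindromic j
      where
      xr : length x + r ≡ i
      xr = trans (cong (_+ r) x≡) (m∸n+n≡m (Pal.r≤c P))
      inside : ∀ a → a < length s → cell T (suc (length x + a)) ≡ at s a
      inside a l = trans (cong (λ T → at T (length x + a)) (trans T≡ (cong (x ++_) T₁≡)))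
        (trans (at-++ʳ x a) (at-++ˡ s l))
      palindromic : ∀ j → j < length s → at s j ≡ at (reverse s) j
      palindromic j l = trans (sym (inside j l)) (trans (Pal.mirror P
          (lia 5 (λ i r x j j′ → x :+ r :≡ i ∷ lit 1 :+ (j :+ j′) :≡ r :+ r ∷ [] ⊢ lit 1 :+ (x :+ j) :+
            (lit 1 :+ (x :+ j′)) :≡ lit 1 :+ (i :+ i)) i r (length x) j j′ xr jj)
          (low j j′ jj) (low j′ j (trans (cong suc (+-comm j′ j)) jj)))
        (trans (inside j′ (subst (j′ <_) (sym s≡)
          (lia 3 (λ j j′ r → lit 1 :+ (j :+ j′) :≡ r :+ r ∷ [] ⊢ j′ :< r :+ r) j j′ r jj)))
          (sym (at-reverse s (trans jj (sym s≡))))))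
        where
        j′ : ℕ
        j′ = length s ∸ suc j
        jj : suc (j + j′) ≡ r + r
        jj = trans (m+[n∸m]≡n l) s≡
        low : ∀ j j′ → suc (j + j′) ≡ r + r → suc (length x + j) ≤ i + r
        low j j′ jj = lia 5 (λ i r x j j′ → x :+ r :≡ i ∷ lit 1 :+ (j :+ j′) :≡ r :+ r ∷ [] ⊢ lit 1 :+
          (x :+ j) :≤ i :+ r) i r (length x) j j′ xr jj

    length-segments : ∀ (x w g u v z y : Str σ) → length (x ++ w ++ g ++ u ++ v ++ z ++ y) ≡
      length x + (length w + (length g + (length u + (length v + (length z + length y)))))
    length-segments x w g u v z y rewrite length-++ x {w ++ g ++ u ++ v ++ z ++ y} | length-++ w {g ++ u ++ v ++ z ++ y}
      | length-++ g {u ++ v ++ z ++ y} | length-++ u {v ++ z ++ y} | length-++ v {z ++ y} | length-++ z {y} = refl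

    flatten : ∀ (w g u v z y : Str σ) → (w ++ g ++ u ++ v ++ z) ++ y ≡ w ++ g ++ u ++ v ++ z ++ y
    flatten w g u v z y = trans (++-assoc w (g ++ u ++ v ++ z) y) (cong (w ++_) (trans (++-assoc g (u ++ v ++ z) y)
      (cong (g ++_) (trans (++-assoc u (v ++ z) y) (cong (u ++_) (++-assoc v z y))))))

    nonempty : ∀ {s : Str σ} → s ≢ [] → 0 < length s
    nonempty {[]} ne = contradiction refl ne
    nonempty {_ ∷ _} _ = s≤s z≤n

    nonempty⁻¹ : ∀ {s : Str σ} → 0 < length s → s ≢ []
    nonempty⁻¹ () refl

    module Segments (x w g u v z y : Str σ) (T≡ : T ≡ x ++ w ++ g ++ u ++ v ++ z ++ y) where

      ix : ∀ {j} → cell T (suc (length x + j)) ≡ at (w ++ g ++ u ++ v ++ z ++ y) j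
      ix {j} = trans (cong (λ T → at T (length x + j)) T≡) (at-++ʳ x j)

      in-w : ∀ {j} → j < length w → cell T (suc (length x + j)) ≡ at w j
      in-w l = trans ix (at-++ˡ w l)

      in-u : ∀ {j} → j < length u → cell T (suc (length x + (length w + (length g + j)))) ≡ at u j
      in-u l = trans ix (trans (at-++ʳ w _) (trans (at-++ʳ g _) (at-++ˡ u l)))

      in-v : ∀ {j} → j < length v → cell T (suc (length x + (length w + (length g + (length u + j))))) ≡ at v j
      in-v l = trans ix (trans (at-++ʳ w _) (trans (at-++ʳ g _) (trans (at-++ʳ u _) (at-++ˡ v l))))

      in-z : ∀ {j} → j < length z → cell T
        (suc (length x + (length w + (length g + (length u + (length v + j)))))) ≡ at z j
      in-z l = trans ix (trans (at-++ʳ w _) (trans (at-++ʳ g _) (trans (at-++ʳ u _) (trans (at-++ʳ v _) (at-++ˡ z l)))))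

    SAGP⇒Sag : ∀ {q} → SAGP T q → Sag q
    SAGP⇒Sag {quad i lw lg lu} (w , g , u , b , w≢ , g≢ , u≢ , (x , y , T≡ , refl) , i≡ , refl , refl , refl) = record
      { 0<w = nonempty w≢ ; 0<g = nonempty g≢ ; 0<u = nonempty u≢
      ; fits = lia 5 (λ i x w g u → i :≡ x :+ (w :+ (g :+ u)) ∷ [] ⊢ w :+ g :+ u :≤ i) i (length x) lw lg lu i≡′
      -- The same occurrence, read as `uuᴿ` after the prefix `xwg`.
      ; inner = even⇒pal (u ++ reverse u , suc (length (x ++ w ++ g)) ,
          (x ++ w ++ g , reverse w ++ y , trans T≡′ reassoc , refl) , cong suc centre ,
          trans (length-++ u) (cong (lu +_) (length-reverse u)) ,
          sym (trans (reverse-++ u (reverse u)) (cong (_++ reverse u) (reverse-involutive u))))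
      ; right = lia 7 (λ n i x w g u y → n :≡ x :+ (w :+ (g :+ (u :+ (u :+ (w :+ y))))) ∷ i :≡ x :+ (w :+ (g :+ u)) ∷ []
        ⊢ i :+ u :+ w :≤ n)
          n i (length x) lw lg lu (length y) n≡ i≡′
      ; outer = λ {y₁} {y₂} → outer′ y₁ y₂ }
      where
      T≡′ : T ≡ x ++ w ++ g ++ u ++ reverse u ++ reverse w ++ y
      T≡′ = trans T≡ (cong (x ++_) (flatten w g u (reverse u) (reverse w) y))
      open Segments x w g u (reverse u) (reverse w) y T≡′
      i≡′ : i ≡ length x + (lw + (lg + lu))
      i≡′ = trans i≡ (cong (length x +_) (trans (length-++ w) (cong (lw +_) (length-++ g))))
      n≡ : n ≡ length x + (lw + (lg + (lu + (lu + (lw + length y)))))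
      n≡ = trans (cong length T≡′) (trans (length-segments x w g u (reverse u) (reverse w) y)
        (cong₂ (λ a b → length x + (lw + (lg + (lu + (a + (b + length y)))))) (length-reverse u) (length-reverse w)))
      reassoc : x ++ w ++ g ++ u ++ reverse u ++ reverse w ++ y ≡ (x ++ w ++ g) ++ (u ++ reverse u) ++ reverse w ++ y
      reassoc = sym (trans (++-assoc x (w ++ g) _)
        (cong (x ++_) (trans (++-assoc w g _) (cong (w ++_) (cong (g ++_) (++-assoc u (reverse u) _))))))
      centre : length (x ++ w ++ g) + lu ≡ i
      centre = trans (cong (_+ lu) (trans (length-++ x) (cong (length x +_) (length-++ w))))
        (trans (+-assoc (length x) (lw + lg) lu) (trans (cong (length x +_) (+-assoc lw lg lu)) (sym i≡′)))
      outer′ : ∀ y₁ y₂ → y₁ + y₂ + lg ≡ suc (i + i) → i + lu < y₂ → y₂ ≤ i + lu + lw → cell T y₁ ≡ cell T y₂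
      outer′ y₁ y₂ sum p q =
        trans (cong (cell T) (sym e₁)) (trans (in-w (lia 3 (λ a b w → lit 1 :+ (a :+ b) :≡ w ∷ [] ⊢ b :< w) a b′ lw ab))
          (trans (sym (at-reverse w ab))
            (trans (sym (in-z (subst (a <_) (sym (length-reverse w))
            (lia 3 (λ a b w → lit 1 :+ (a :+ b) :≡ w ∷ [] ⊢ a :< w) a b′ lw ab)))) (cong (cell T) e₂))))
        where
        a b′ : ℕ
        -- `a` is the offset of `y₂` in `wᴿ`, and `b′` is that of `y₁` in `w`; under reversal
        -- `suc (a + b′)` is the length of `w`.
        a = y₂ ∸ suc (i + lu)
        b′ = lw ∸ suc a
        a+ : suc (i + lu + a) ≡ y₂
        a+ = m+[n∸m]≡n p
        ab : suc (a + b′) ≡ lw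
        ab = m+[n∸m]≡n (lia 5
          (λ i u a y₂ w → lit 1 :+ (i :+ u :+ a) :≡ y₂ ∷ y₂ :≤ i :+ u :+ w ∷ [] ⊢ lit 1 :+ a :≤ w) i lu a y₂ lw a+ q)
        e₁ : suc (length x + b′) ≡ y₁
        e₁ = lia 9 (λ i x w g u a b y₁ y₂ → y₁ :+ y₂ :+ g :≡ lit 1 :+ (i :+ i) ∷ i :≡ x :+ (w :+ (g :+ u)) ∷ lit 1 :+
          (i :+ u :+ a) :≡ y₂ ∷ lit 1 :+ (a :+ b) :≡ w ∷ [] ⊢ lit 1 :+ (x :+ b) :≡ y₁)
          i (length x) lw lg lu a b′ y₁ y₂ sum i≡′ a+ ab
        e₂ : suc (length x + (lw + (lg + (lu + (length (reverse u) + a))))) ≡ y₂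
        e₂ = lia 8 (λ i x w g u a y₂ u′ → i :≡ x :+ (w :+ (g :+ u)) ∷ lit 1 :+ (i :+ u :+ a) :≡ y₂ ∷ u′ :≡ u ∷ []
          ⊢ lit 1 :+ (x :+ (w :+ (g :+ (u :+ (u′ :+ a))))) :≡ y₂)
          i (length x) lw lg lu a y₂ (length (reverse u)) i≡′ a+ (length-reverse u)

    segments : ∀ {a b c d e f} → a + (b + (c + (d + (e + f)))) ≤ n → ∃[ x ] ∃[ w ] ∃[ g ] ∃[ u ] ∃[ v ] ∃[ z ] ∃[ y ]
      (T ≡ x ++ w ++ g ++ u ++ v ++ z ++ y × length x ≡ a × length w ≡ b × length g ≡ c × length u ≡ d × length v ≡ e ×
        length z ≡ f)
    segments {a} {b} {c} {d} {e} {f} l with cut a T (m+n≤o⇒m≤o _ l)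
    ... | x , T₁ , e₁ , refl with remaining x e₁ l
    ... | l₁ with cut b T₁ (m+n≤o⇒m≤o _ l₁)
    ... | w , T₂ , e₂ , refl with remaining w e₂ l₁
    ... | l₂ with cut c T₂ (m+n≤o⇒m≤o _ l₂)
    ... | g , T₃ , e₃ , refl with remaining g e₃ l₂
    ... | l₃ with cut d T₃ (m+n≤o⇒m≤o _ l₃)
    ... | u , T₄ , e₄ , refl with remaining u e₄ l₃
    ... | l₄ with cut e T₄ (m+n≤o⇒m≤o _ l₄)
    ... | v , T₅ , e₅ , refl with cut f T₅ (remaining v e₅ l₄)
    ... | z , y , e₆ , refl = x , w , g , u , v , z , y ,
      trans e₁ (cong (x ++_)
        (trans e₂ (cong (w ++_) (trans e₃ (cong (g ++_) (trans e₄ (cong (u ++_) (trans e₅ (cong (v ++_) e₆))))))))) ,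
      refl , refl , refl , refl , refl , refl

    -- The text is cut at the lengths that `q` prescribes; `inner` then identifies the piece after
    -- the pivot as `uᴿ`, and `outer` identifies the next one as `wᴿ`.
    Sag⇒SAGP : ∀ {q} → Sag q → SAGP T q
    Sag⇒SAGP {quad i lw lg lu} S with segments {i ∸ (lw + lg + lu)} {lw} {lg} {lu} {lu} {lw}
        (lia 6 (λ n i x w g u → x :+ (w :+ g :+ u) :≡ i ∷ i :+ u :+ w :≤ n ∷ [] ⊢ x :+
          (w :+ (g :+ (u :+ (u :+ w)))) :≤ n)
          n i (i ∸ (lw + lg + lu)) lw lg lu (m∸n+n≡m (fits S)) (right S))
    ... | x , w , g , u , v , z , y , T≡ , x≡ , refl , refl , refl , v≡ , z≡ =
      w , g , u , suc (length x) , nonempty⁻¹ (0<w S) , nonempty⁻¹ (0<g S) , nonempty⁻¹ (0<u S) ,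
      (x , y , T≡′ , refl) , trans i≡
        (cong (length x +_) (sym (trans (length-++ w) (cong (length w +_) (length-++ g))))) , refl , refl , refl
      where
      open Segments x w g u v z y T≡
      |x| |w| |g| |u| : ℕ
      |x| = length x
      |w| = length w
      |g| = length g
      |u| = length u
      i≡ : i ≡ |x| + (|w| + (|g| + |u|))
      i≡ = lia 5 (λ i x w g u → x :+ (w :+ g :+ u) :≡ i ∷ [] ⊢ i :≡ x :+ (w :+ (g :+ u))) i |x| |w| |g| |u|
        (trans (cong (_+ (|w| + |g| + |u|)) x≡) (m∸n+n≡m (fits S)))
      v-rev : v ≡ reverse u
      v-rev = at-ext v (reverse u) (trans v≡ (sym (length-reverse u))) λ {a} → pointwise a
        where
        pointwise : ∀ a → a < length v → at v a ≡ at (reverse u) a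
        pointwise a l = trans (sym (in-v l)) (trans (sym (Pal.mirror (inner S) {suc (|x| + (|w| + (|g| + b)))}
            (lia 7 (λ i x w g u a b → i :≡ x :+ (w :+ (g :+ u)) ∷ lit 1 :+ (a :+ b) :≡ u ∷ [] ⊢
               lit 1 :+ (x :+ (w :+ (g :+ b))) :+ (lit 1 :+ (x :+ (w :+ (g :+ (u :+ a))))) :≡ lit 1 :+
                 (i :+ i)) i |x| |w| |g| |u| a b i≡ ab)
            (lia 7 (λ i x w g u a b → i :≡ x :+ (w :+ (g :+ u)) ∷ lit 1 :+ (a :+ b) :≡ u ∷ [] ⊢
               lit 1 :+ (x :+ (w :+ (g :+ b))) :≤ i :+ u) i |x| |w| |g| |u| a b i≡ ab)
            (lia 7 (λ i x w g u a b → i :≡ x :+ (w :+ (g :+ u)) ∷ lit 1 :+ (a :+ b) :≡ u ∷ [] ⊢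
               lit 1 :+ (x :+ (w :+ (g :+ (u :+ a)))) :≤ i :+ u) i |x| |w| |g| |u| a b i≡ ab)))
          (trans (in-u (lia 3 (λ a b u → lit 1 :+ (a :+ b) :≡ u ∷ [] ⊢ b :< u) a b (length u) ab))
            (sym (at-reverse u ab))))
          where
          b : ℕ
          b = length u ∸ suc a
          ab : suc (a + b) ≡ length u
          ab = m+[n∸m]≡n (subst (a <_) v≡ l)
      z-rev : z ≡ reverse w
      z-rev = at-ext z (reverse w) (trans z≡ (sym (length-reverse w))) λ {a} → pointwise a
        where
        pointwise : ∀ a → a < length z → at z a ≡ at (reverse w) a
        pointwise a l = trans (sym (in-z l)) (trans (sym (outer S {suc (|x| + b)}
            (lia 8 (λ i x w g u a b v → i :≡ x :+ (w :+ (g :+ u)) ∷ lit 1 :+ (a :+ b) :≡ w ∷ v :≡ u ∷ [] ⊢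
               lit 1 :+ (x :+ b) :+ (lit 1 :+ (x :+ (w :+ (g :+ (u :+ (v :+ a)))))) :+ g :≡ lit 1 :+
                 (i :+ i)) i |x| |w| |g| |u| a b (length v) i≡ ab v≡)
            (lia 8 (λ i x w g u a b v → i :≡ x :+ (w :+ (g :+ u)) ∷ lit 1 :+ (a :+ b) :≡ w ∷ v :≡ u ∷ [] ⊢
               i :+ u :< lit 1 :+ (x :+ (w :+ (g :+ (u :+ (v :+ a)))))) i |x| |w| |g| |u| a b (length v) i≡ ab v≡)
            (lia 8 (λ i x w g u a b v → i :≡ x :+ (w :+ (g :+ u)) ∷ lit 1 :+ (a :+ b) :≡ w ∷ v :≡ u ∷ [] ⊢
               lit 1 :+ (x :+ (w :+ (g :+ (u :+ (v :+ a))))) :≤ i :+ u :+ w) i |x| |w| |g| |u| a b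
                 (length v) i≡ ab v≡)))
          (trans (in-w (lia 3 (λ a b w → lit 1 :+ (a :+ b) :≡ w ∷ [] ⊢ b :< w) a b (length w) ab))
            (sym (at-reverse w ab))))
          where
          b : ℕ
          b = length w ∸ suc a
          ab : suc (a + b) ≡ length w
          ab = m+[n∸m]≡n (subst (a <_) z≡ l)
      T≡′ : T ≡ x ++ sagp w g u ++ y
      T≡′ = trans T≡ (cong (x ++_)
        (trans (sym (flatten w g u v z y)) (cong₂ (λ v z → (w ++ g ++ u ++ v ++ z) ++ y) v-rev z-rev)))

-- Running the algorithm

module Transfer (n : ℕ) (f g : ℕ → ℕ) (f⇒g : ∀ {a b} → In n a → In n b → f a ≡ f b → g a ≡ g b) where

  private
    module F = Canonical n f
    module G = Canonical n g

  -- Used in both directions between letters and names, as only equality at the positions from 1 to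
  -- `n` enters.
  Pal-transfer : ∀ {c r} → F.Pal c r → G.Pal c r
  Pal-transfer {c} {r} P = Palindromes.pal (F.Pal.r≤c P) (F.Pal.c+r≤n P) λ {y} {y′} s p q →
    f⇒g (positive y y′ s q , ≤-trans p (F.Pal.c+r≤n P))
      (positive y′ y (trans (+-comm y′ y) s) p , ≤-trans q (F.Pal.c+r≤n P)) (F.Pal.mirror P s p q)
    where
    positive : ∀ y y′ → y + y′ ≡ suc (c + c) → y′ ≤ c + r → 0 < y
    positive y y′ s q = lia 4
      (λ y y′ c r → y :+ y′ :≡ lit 1 :+ (c :+ c) ∷ y′ :≤ c :+ r ∷ r :≤ c ∷ [] ⊢ lit 0 :< y) y y′ c r s q (F.Pal.r≤c P)

  Sag-transfer : ∀ {q} → F.Sag q → G.Sag q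
  Sag-transfer {quad i lw lg lu} S = record
    { 0<w = 0<w ; 0<g = 0<g ; 0<u = 0<u ; fits = fits ; inner = Pal-transfer inner ; right = right
    ; outer = λ {y} {y′} s p q → f⇒g
        (lia 6 (λ i w g u y y′ → y :+ y′ :+ g :≡ lit 1 :+ (i :+ i) ∷ y′ :≤ i :+ u :+ w ∷ w :+ g :+ u :≤ i ∷ []
          ⊢ lit 0 :< y) i lw lg lu y y′ s q fits ,
         lia 7 (λ i w g u y y′ n → y :+ y′ :+ g :≡ lit 1 :+ (i :+ i) ∷ i :+ u :< y′ ∷ i :+ u :+ w :≤ n ∷ []
           ⊢ y :≤ n) i lw lg lu y y′ n s p right)
        (≤-trans (s≤s z≤n) p , ≤-trans q right) (outer s p q) }
    where open F.Sag S

-- From names back to the SAGPs of the string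

module Correctness {σ : ℕ} (T : Str σ) (nm : ℕ → ℕ)
  (sound : ∀ {a b} → In (length T) a → In (length T) b → nm a ≡ nm b → cell T a ≡ cell T b)
  (complete : ∀ {a b} → In (length T) a → In (length T) b → cell T a ≡ cell T b → nm a ≡ nm b)
  (radius-of : ∀ {i} → i ≤ length T → ∃[ r ] Palindromes.MaxPal (length T) nm i r) where

  private
    n : ℕ
    n = length T

  open Canonical n nm
  open Notions Sag

  SAGP⇒ : ∀ {q} → SAGP T q → Sag q
  SAGP⇒ S = Transfer.Sag-transfer n (cell T) nm complete (SAGP⇒Sag T S)

  SAGP⇐ : ∀ {q} → Sag q → SAGP T q
  SAGP⇐ S = Sag⇒SAGP T (Transfer.Sag-transfer n nm (cell T) sound S)

  Max⇒ : ∀ {i r} → MaximalRadius T i r → MaxPal i r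
  Max⇒ (P , max) = Transfer.Pal-transfer n (cell T) nm complete (even⇒pal T P) ,
    λ P′ → max _ (pal⇒even T (Transfer.Pal-transfer n nm (cell T) sound P′))

  Max⇐ : ∀ {i r} → MaxPal i r → MaximalRadius T i r
  Max⇐ (P , max) = pal⇒even T (Transfer.Pal-transfer n nm (cell T) sound P) ,
    λ _ P′ → max (Transfer.Pal-transfer n (cell T) nm complete (even⇒pal T P′))

  Longest⇒ : ∀ {q} → Longest T q → Longest′ q
  Longest⇒ (S , max) = SAGP⇒ S , λ q′ S′ → max q′ (SAGP⇐ S′)

  Longest⇐ : ∀ {q} → Longest′ q → Longest T q
  Longest⇐ (S , max) = SAGP⇐ S , λ q′ S′ → max q′ (SAGP⇒ S′)

  SAGP₂⇒Answer : ∀ {q} → SAGP₂ T q → Answer q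
  SAGP₂⇒Answer ((position , ¬type1) , L , canon) with radius-of (proj₂ position)
  ... | r , M = canonical M
    (λ E → ¬type1 (position , (let q , S , i≡ , M′ = Extensible⇒Type1 M E in q , SAGP⇐ S , i≡ , Max⇐ M′)))
    (Longest⇒ L , λ q′ L′ → canon q′ (Longest⇐ L′))

  Answer⇒SAGP₂ : ∀ {q} → Answer q → SAGP₂ T q
  Answer⇒SAGP₂ A@(answer M ¬E (_ , p<i , _) _ _ _ _ _ _) with answer-canonical A
  ... | L , canon = ((≤-trans (s≤s z≤n) p<i , <⇒≤ (Answer-pivot< A)) ,
        λ (_ , q , S , i≡ , M′) → ¬E (Type1⇒Extensible M (q , SAGP⇒ S , i≡ , Max⇒ M′))) ,
      Longest⇐ L , λ q′ L′ → canon q′ (Longest⇒ L′)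

-- Composition of the stages

module Assembly {σ : ℕ} (T : Str σ) (w m κ : ℕ) (A≤m : 10 * suc (length T) ≤ m) (A≤2^w : 10 * suc (length T) ≤ 2 ^ w)
  (2n<2^w : suc (length T) + suc (length T) < 2 ^ w) (cost≤κ : Algorithm.reportCost ≤ κ) where

  private
    n : ℕ
    n = length T
    L : ℕ → ℕ
    L = cell T

  open Algorithm
  open Semantics n
  open Execution w m κ A≤m A≤2^w 2n<2^w
  open Naming n w m κ A≤m A≤2^w 2n<2^w
  open Scanning n w m κ A≤m A≤2^w 2n<2^w
  open Reporting n w m κ A≤m A≤2^w 2n<2^w

  Outcome : Post
  Outcome _ _ o = o Enumerates SAGP₂ T

  Faithful : (ℕ → ℕ) → Set
  Faithful nm = (∀ {a b} → In n a → In n b → nm a ≡ nm b → L a ≡ L b) ×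
    (∀ {a b} → In n a → In n b → L a ≡ L b → nm a ≡ nm b)

  record Prepared (nm pv ft nr rd : ℕ → ℕ) : Set where
    constructor prepared
    field
      faithful : Faithful nm
      links    : ∀ {a} → In n a → Previous nm a (pv a) × First nm a (ft a)
      repeats  : ∀ {a} → In n a → Repeat nm pv ft a (nr a)
      max      : ∀ {a} → a ≤ n → Palindromes.MaxPal n nm a (rd a)

  ReportReady : Vars → Arrs → Set
  ReportReady (n′ ∷ i ∷ e ∷ _) (tx ∷ dg ∷ nx ∷ bk ∷ rp ∷ nm ∷ pv ∷ ft ∷ nr ∷ rd ∷ []) =
    n′ ≡ n × i ≡ 0 × e ≡ 0 × Prepared nm pv ft nr rd

  reportPhase : ∀ vs as → ReportReady vs as → Spec (loopWhile (I ≺ N) (compile reportBody))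
    (suc n * reportCost +κ) Outcome vs as
  reportPhase (n′ ∷ i ∷ e ∷ d ∷ q ∷ k ∷ t ∷ []) (tx ∷ dg ∷ nx ∷ bk ∷ rp ∷ nm ∷ pv ∷ ft ∷ nr ∷ rd ∷ [])
    (refl , refl , refl , prepared (sound , complete) links repeats max) =
    weaken ≤-refl (Enumerates-resp (λ (A , _) → Answer⇒SAGP₂ A)
      (λ S → let A = SAGP₂⇒Answer S in A , inj₁ (proj₁ (proj₁ (proj₁ S)))))
      (reporting nm pv ft nr rd links repeats max cost≤κ n 0 ≤-refl z≤n (inj₁ refl))
    where open Correctness T nm sound complete (λ i≤n → _ , max i≤n)

  ready : ∀ {nm pv ft nr} → Faithful nm → (∀ {a} → In n a → Previous nm a (pv a) × First nm a (ft a)) →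
    (∀ {a} → In n a → Repeat nm pv ft a (nr a)) →
    ∀ vs as → RadiusState nm pv ft nr vs as → Wp reportInit (λ vs as o → o ≡ [] × ReportReady vs as) vs as
  ready F links repeats (n′ ∷ i ∷ e ∷ d ∷ q ∷ k ∷ t ∷ []) (tx ∷ dg ∷ nx ∷ bk ∷ rp ∷ nm ∷ pv ∷ ft ∷ nr ∷ rd ∷ [])
    (refl , refl , refl , refl , refl , max) =
    [ refl , refl , refl , refl , prepared F links repeats max ]ʷ

  record ManacherReady (vs : Vars) (as : Arrs) : Set where
    constructor manacherReady
    field
      {nm pv ft nr} : ℕ → ℕ
      faithful : Faithful nm
      links    : ∀ {a} → In n a → Previous nm a (pv a) × First nm a (ft a)
      repeats  : ∀ {a} → In n a → Repeat nm pv ft a (nr a)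
      entry    : ManacherInv nm pv ft nr (n + n) vs as

  manacherPhase : ∀ {vs as} → ManacherReady vs as →
    Spec (loopWhile (I ≺ N) (compile manacherBody) ⨾ reportStage)
      (loopCost (I ≺ N) (cost manacherBody) (n + n) + reportTime n +κ) Outcome vs as
  manacherPhase {vs} {as} (manacherReady {nm} {pv} {ft} {nr} F links repeats inv) =
    radii nm pv ft nr {vs} {as} inv ▷ λ {vs} {as} → λ { (refl , st) →
    silent (ready F links repeats vs as st) ▷ λ {vs} {as} → λ { (refl , st) → reportPhase vs as st } }

  startManacher : ∀ {nm pv ft} → Faithful nm → (∀ {a} → In n a → Previous nm a (pv a) × First nm a (ft a)) →
    ∀ vs as → RepeatState nm pv ft vs as → Wp manacherInit (λ vs as o → o ≡ [] × ManacherReady vs as) vs as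
  startManacher {nm} F links (n′ ∷ i ∷ e ∷ d ∷ q ∷ k ∷ t ∷ []) (tx ∷ dg ∷ nx ∷ bk ∷ rp ∷ nm′ ∷ pv ∷ ft ∷ nr ∷ rd ∷ [])
    (refl , refl , refl , refl , repeats) =
    [ ≤-refl , refl , manacherReady F links repeats (refl , refl , refl , refl , refl , z≤n , record
      { c≤i = z≤n ; c+r = refl ; widest = pal-zero z≤n ; current = pal-zero z≤n ; reach = z≤n ; exact = λ ()
      ; settled = λ () ; last = [↦]-same rd n 0 ; budget = m≤m+n (n + n) 0 }) ]ʷ
    where open Palindromes n nm

  record RepeatReady (vs : Vars) (as : Arrs) : Set where
    constructor repeatReady
    field
      {nm pv ft} : ℕ → ℕ
      faithful : Faithful nm
      links    : ∀ {a} → In n a → Previous nm a (pv a) × First nm a (ft a)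
      entry    : NextInv nm pv ft n vs as

  repeatPhase : ∀ {vs as} → RepeatReady vs as →
    Spec (loopWhile (#0 ≺ I) (compile nextBody) ⨾ manacherStage)
      (loopCost (#0 ≺ I) (cost nextBody) n + manacherTime n +κ) Outcome vs as
  repeatPhase {vs} {as} (repeatReady {nm} {pv} {ft} F links inv) =
    repeating nm pv ft {vs} {as} inv ▷ λ {vs} {as} → λ { (refl , st) →
    silent (startManacher F links vs as st) ▷ λ { (refl , st) → manacherPhase st } }

  startRepeat : ∀ {nm} (bounded : ∀ {a} → In n a → nm a ≤ n) → Faithful nm → ∀ vs as → LinkedState nm bounded vs as →
    Wp nextInit (λ vs as o → o ≡ [] × RepeatReady vs as) vs as
  startRepeat _ F (n′ ∷ i ∷ e ∷ d ∷ q ∷ k ∷ t ∷ []) (tx ∷ dg ∷ nx ∷ bk ∷ rp ∷ nm ∷ pv ∷ ft ∷ nr ∷ rd ∷ [])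
    (refl , refl , links) =
    [ refl , repeatReady F links (refl , refl , refl , refl , refl , ≤-refl ,
      ((λ n<p p<n → contradiction p<n (<⇒≯ n<p)) , (λ n<n → contradiction n<n (<-irrefl refl))) , λ n<a a≤n →
        contradiction a≤n (<⇒≱ n<a)) ]ʷ

  record LinkReady (vs : Vars) (as : Arrs) : Set where
    constructor linkReady
    field
      {nm}     : ℕ → ℕ
      bounded  : ∀ {a} → In n a → nm a ≤ n
      faithful : Faithful nm
      entry    : PrevInv nm n vs as

  linkPhase : ∀ {vs as} → LinkReady vs as →
    Spec (loopWhile (I ≺ N) (compile prevBody) ⨾ nextStage)
      (loopCost (I ≺ N) (cost prevBody) n + nextTime n +κ) Outcome vs as
  linkPhase {vs} {as} (linkReady {nm} bounded F inv) =
    linking nm bounded {vs} {as} inv ▷ λ {vs} {as} → λ { (refl , st) →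
    silent (startRepeat bounded F vs as st) ▷ λ { (refl , st) → repeatPhase st } }

  startLink : ∀ vs as → NamedState L 0 vs as → Wp prevInit (λ vs as o → o ≡ [] × LinkReady vs as) vs as
  startLink (n′ ∷ i ∷ e ∷ d ∷ q ∷ k ∷ t ∷ []) (tx ∷ dg ∷ nx ∷ bk ∷ rp ∷ nm ∷ pv ∷ ft ∷ nr ∷ rd ∷ []) (refl , refl , N) =
    [ refl , linkReady bounded
      -- The texts have been divided down to 0, so names alone now determine the letters.
      ((λ i j e → sound i j e (trans (n≤0⇒n≡0 (text≤ i)) (sym (n≤0⇒n≡0 (text≤ j))))) , λ i j e → proj₁ (complete i j e))
      (refl , refl , refl , record
        { buckets = λ {c} c≤n → subst (Latest (λ j → nm j ≡ c) 1) (sym (empty c≤n)) Latest-start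
        ; prevs = λ 0<a a≤0 → contradiction a≤0 (<⇒≱ 0<a) ; firsts = λ 0<a a≤0 → contradiction a≤0 (<⇒≱ 0<a) }) ]ʷ
    where open Named N

  startMax : ∀ {S} (L≤S : ∀ {a} → In n a → L a ≤ S) {as : Arrs} →
    as ≡ L ∷ replicate 9 (λ _ → 0) → Wp maxInit (λ vs as o → o ≡ [] × MaxInv L S L≤S n vs as) (n ∷ replicate 6 0) as
  startMax L≤S refl = [ refl , refl , refl , ≤-refl , refl , (λ _ → refl) , (λ _ → refl) , z≤n ,
    (λ n<a a≤n → contradiction a≤n (<⇒≱ n<a)) ]ʷ

  main-correct : ∀ {S rounds} → (∀ {a} → In n a → L a ≤ S) → S < suc n ^ rounds →
    Spec main (totalCost rounds n +κ) Outcome (n ∷ replicate 6 0) (L ∷ replicate 9 (λ _ → 0))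
  main-correct {S} {rounds} L≤S S< =
    silent (startMax L≤S refl) ▷ λ {vs} {as} → λ { (refl , inv) →
    findMax L S L≤S {vs} {as} inv ▷ λ {vs} {as} → λ { (refl , top , top≤S , st) →
    naming {L} {rounds} {vs} {as} (top , ≤-<-trans top≤S S< , st) ▷ λ {vs} {as} → λ { (refl , st) →
    silent (startLink vs as st) ▷ λ { (refl , st) → linkPhase st } } } }

-- Linearity of the time bounds

module LinearBounds where

  open Algorithm

  -- The bound uses `suc n` because constants must be covered at `n = 0`, too.
  Linear-bounded : (ℕ → ℕ) → Set
  Linear-bounded f = ∃[ C ] ∀ n → f n ≤ C * suc n

  const-linear : ∀ k → Linear-bounded (λ _ → k)
  const-linear k = k , λ n → m≤m*n k (suc n)

  id-linear : Linear-bounded (λ n → n)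
  id-linear = 1 , λ n → ≤-trans (n≤1+n n) (≤-reflexive (sym (*-identityˡ (suc n))))

  +-linear : ∀ {f g} → Linear-bounded f → Linear-bounded g → Linear-bounded (λ n → f n + g n)
  +-linear (C , f≤) (C′ , g≤) =
    C + C′ , λ n → ≤-trans (+-mono-≤ (f≤ n) (g≤ n)) (≤-reflexive (sym (*-distribʳ-+ (suc n) C C′)))

  *-linear : ∀ {f} → Linear-bounded f → ∀ k → Linear-bounded (λ n → f n * k)
  *-linear {f} (C , f≤) k = k * C , λ n → begin
    f n * k          ≡⟨ *-comm (f n) k ⟩
    k * f n          ≤⟨ *-monoʳ-≤ k (f≤ n) ⟩
    k * (C * suc n)  ≡⟨ *-assoc k C (suc n) ⟨
    k * C * suc n    ∎
    where open ≤-Reasoning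

  scale-linear : ∀ {f} k → Linear-bounded f → Linear-bounded (λ n → k * f n)
  scale-linear {f} k F with *-linear F k
  ... | C , b = C , λ n → subst (_≤ C * suc n) (*-comm (f n) k) (b n)

  opaque
    unfolding loopCost

    loop-linear : ∀ c t {μ} → Linear-bounded μ → Linear-bounded (λ n → loopCost c t (μ n))
    loop-linear c t F = *-linear (+-linear (const-linear 1) F) (suc (condCost c) + t)

    -- Opposite to `loop-linear`: the number of passes is constant, and the cost of a pass is
    -- linear.
    rounds-linear : ∀ c {t} ρ → Linear-bounded t → Linear-bounded (λ n → loopCost c (t n) ρ)
    rounds-linear c ρ F = scale-linear (suc ρ) (+-linear (const-linear (suc (condCost c))) F)

  1+n-linear : Linear-bounded suc
  1+n-linear = +-linear (const-linear 1) id-linear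

  total-linear : ∀ rounds → Linear-bounded (totalCost rounds)
  total-linear rounds =
    +-linear (const-linear (cost maxInit)) (+-linear (loop-linear (#0 ≺ I) (cost maxBody) id-linear)
    (+-linear (rounds-linear (#0 ≺ M) rounds round-linear)
    (+-linear (const-linear (cost prevInit)) (+-linear (loop-linear (I ≺ N) (cost prevBody) id-linear)
    (+-linear (const-linear (cost nextInit)) (+-linear (loop-linear (#0 ≺ I) (cost nextBody) id-linear)
    (+-linear (const-linear (cost manacherInit))
      (+-linear (loop-linear (I ≺ N) (cost manacherBody) (+-linear id-linear id-linear))
    (+-linear (const-linear (cost reportInit)) (*-linear 1+n-linear reportCost))))))))))
    where
    round-linear : Linear-bounded roundCost
    round-linear = +-linear (const-linear (cost buildInit)) (+-linear (loop-linear (I ≺ N) (cost buildBody) id-linear)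
      (+-linear (const-linear (cost walkInit))
        (+-linear (loop-linear (#0 ≺ D ⊕ E) (cost walkBody) (+-linear 1+n-linear id-linear))
        (const-linear (cost divide)))))

-- Size of the letters and the initial memory

m<2^m : ∀ m → m < 2 ^ m
m<2^m zero = s≤s z≤n
m<2^m (suc m) = ≤-trans (+-mono-≤ (m^n>0 2 m) (m<2^m m)) (≤-reflexive (cong (2 ^ m +_) (sym (+-identityʳ (2 ^ m)))))

letter≤ : ∀ {σ} (a : Fin σ) → letter a ≤ σ
letter≤ = toℕ<n

module _ {σ : ℕ} where

  at≤ : ∀ (T : Str σ) j → at T j ≤ σ
  at≤ [] j = z≤n
  at≤ (a ∷ T) zero = letter≤ a
  at≤ (a ∷ T) (suc j) = at≤ T j

  at-beyond : ∀ (T : Str σ) {j} → length T ≤ j → at T j ≡ 0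
  at-beyond [] _ = refl
  at-beyond (a ∷ T) (s≤s l) = at-beyond T l

  cells-trunc : ∀ {w} → σ < 2 ^ w → ∀ (T : Str σ) j → cells (map (trunc w) (map letter T)) j ≡ at T j
  cells-trunc {w} σ< [] j = refl
  cells-trunc {w} σ< (a ∷ T) zero = m<n⇒m%n≡m {{m^n≢0 2 w}} (≤-<-trans (letter≤ a) σ<)
  cells-trunc {w} σ< (a ∷ T) (suc j) = cells-trunc {w} σ< T j

  -- A bound S on the letters that the radix sort exhausts in the given number of rounds.
  letter-bound : ∀ (T : Str σ) c d → σ ≤ c * length T ^ d →
    ∃[ S ] ((∀ {a} → In (length T) a → cell T a ≤ S) × S < suc (length T) ^ (c + d))
  -- Here the base is 1 and its powers do not grow, but there are no letters and `S` can be 0.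
  letter-bound [] c d _ = 0 , (λ (0<a , a≤0) → contradiction a≤0 (<⇒≱ 0<a)) , m^n>0 1 (c + d)
  letter-bound T@(_ ∷ _) c d σ≤ = c * length T ^ d , (λ { {suc j} _ → ≤-trans (at≤ T j) σ≤ }) , (begin-strict
    c * n ^ d              ≤⟨ *-monoʳ-≤ c (^-monoˡ-≤ d (n≤1+n n)) ⟩
    -- The text is non-empty, so the base is at least 2 and the factor satisfies
    -- `c < 2 ^ c ≤ suc n ^ c`.
    c * suc n ^ d          <⟨ *-monoˡ-< (suc n ^ d) {{m^n≢0 (suc n) d}}
      (<-≤-trans (m<2^m c) (^-monoˡ-≤ c (s≤s (s≤s z≤n)))) ⟩
    suc n ^ c * suc n ^ d  ≡⟨ ^-distribˡ-+-* (suc n) c d ⟨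
    suc n ^ (c + d)        ∎)
    where
    open ≤-Reasoning
    n : ℕ
    n = length T

  module Initial (T : Str σ) (w m : ℕ) (A≤m : 10 * suc (length T) ≤ m) (A≤2^w : 10 * suc (length T) ≤ 2 ^ w)
    (2n<2^w : suc (length T) + suc (length T) < 2 ^ w) (σ< : σ < 2 ^ w) where

    open Algorithm
    open Semantics (length T)
    open Execution w m reportCost A≤m A≤2^w 2n<2^w

    private
      n : ℕ
      n = length T
      mem₀ : ℕ → ℕ
      mem₀ = mem (initial w T)
      r₁ r₂ r₃ : ℕ → ℕ
      r₁ = (λ _ → 0) [ 1 ↦ mem₀ 0 ]
      r₂ = r₁ [ 0 ↦ trunc w 1 ]
      r₃ = r₂ [ 0 ↦ trunc w (r₂ 0 + r₂ 1) ]
      0<2^w : 0 < 2 ^ w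
      0<2^w = m^n>0 2 w

    1+n<2^w : suc n < 2 ^ w
    1+n<2^w = ≤-<-trans (m≤m+n (suc n) (suc n)) 2n<2^w

    length-cell : mem₀ 0 ≡ n
    length-cell = trunc-< (<-trans (n<1+n n) 1+n<2^w)

    mem-cell : ∀ j → mem₀ j ≡ cell T j
    mem-cell zero = length-cell
    mem-cell (suc j) = cells-trunc {w} σ< T j

    run-start : Exec w m start (initial w T) (state r₃ mem₀) 3 []
    run-start = seq (load (<-≤-trans (s≤s z≤n) A≤m)) (seq imm arith)

    agree-start : Agree (n ∷ replicate 6 0) (cell T ∷ replicate 9 (λ _ → 0)) r₃ mem₀
    agree-start = agree (trans (cong (trunc w) (cong₂ _+_ (trunc-< 1<2^w) length-cell))
      (trunc-< 1+n<2^w)) vars′ vars<′ arrs′ arrs<′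
      where
      vars′ : ∀ x → r₃ (suc (toℕ x)) ≡ lookup (n ∷ replicate 6 0) x
      vars′ Fin.zero = length-cell
      vars′ (Fin.suc x) = sym (lookup-replicate x 0)
      vars<′ : ∀ x → lookup (n ∷ replicate 6 0) x < 2 ^ w
      vars<′ Fin.zero = <-trans (n<1+n n) 1+n<2^w
      vars<′ (Fin.suc x) = subst (_< 2 ^ w) (sym (lookup-replicate x 0)) 0<2^w
      arrs′ : ∀ a {j} → j ≤ n → mem₀ (j + toℕ a * suc n) ≡ lookup (cell T ∷ replicate 9 (λ _ → 0)) a j
      arrs′ Fin.zero {j} _ = trans (cong mem₀ (+-identityʳ j)) (mem-cell j)
      -- From address `n + 1` on, the memory lies beyond the text and is 0.
      arrs′ (Fin.suc a) {j} _ =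
        trans (trans (cong mem₀ address≡) (trans (mem-cell (suc (n + (j + toℕ a * suc n)))) (at-beyond T (m≤m+n n _))))
        (cong (λ f → f j) (sym (lookup-replicate a (λ _ → 0))))
        where
        address≡ : j + (suc n + toℕ a * suc n) ≡ suc (n + (j + toℕ a * suc n))
        address≡ = lia 3 (λ j n x → [] ⊢ j :+ (lit 1 :+ n :+ x) :≡ lit 1 :+ (n :+ (j :+ x))) j n (toℕ a * suc n)
      arrs<′ : ∀ a {j} → j ≤ n → lookup (cell T ∷ replicate 9 (λ _ → 0)) a j < 2 ^ w
      arrs<′ Fin.zero {zero} _ = <-trans (n<1+n n) 1+n<2^w
      arrs<′ Fin.zero {suc j} _ = ≤-<-trans (at≤ T j) σ<
      arrs<′ (Fin.suc a) {j} _ = subst (_< 2 ^ w) (cong (λ f → f j) (sym (lookup-replicate a (λ _ → 0)))) 0<2^w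

-- The 3 is the time of `start`; the summand 10, there for the ten arrays, absorbs it.
budget : ∀ C k n {l t} → t ≤ C * suc n + k * l → 3 + t ≤ (10 + C + k) * suc (n + l)
budget C k n {l} {t} t≤ = begin
  3 + t                             ≤⟨ +-mono-≤ (≤-trans (m≤m+n 3 7) (m≤m*n 10 N))
    (≤-trans t≤ (+-mono-≤ (*-monoʳ-≤ C (s≤s (m≤m+n n l))) (*-monoʳ-≤ k (≤-trans (m≤n+m l n) (n≤1+n (n + l)))))) ⟩
  10 * N + (C * N + k * N)          ≡⟨ +-assoc (10 * N) (C * N) (k * N) ⟨
  10 * N + C * N + k * N            ≡⟨ cong (_+ k * N) (*-distribʳ-+ N 10 C) ⟨
  (10 + C) * N + k * N              ≡⟨ *-distribʳ-+ N (10 + C) k ⟨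
  (10 + C + k) * N                  ∎
  where
  open ≤-Reasoning
  N : ℕ
  N = suc (n + l)

open LinearBounds using (total-linear)
open Algorithm using (algorithm; main; reportCost)

-- One program serves all polynomial alphabets: `c` and `d` influence only the constants, through
-- the bound `c + d` on the number of rounds and through the word size.
theorem4 : ∃[ p ] ∀ (c d : ℕ) → ∃[ K ] ∃[ C ]
    (∀ (σ : ℕ) (T : Str σ) (w : ℕ) → let n = length T in
    σ ≤ c * n ^ d →
    K * suc n ^ K ≤ 2 ^ w →
    ∃[ s ] ∃[ steps ] ∃[ out ]
    ( Exec w (C * suc n) p (initial w T) s steps out
    × out Enumerates SAGP₂ T
    × steps ≤ C * suc (n + length out)))
theorem4 = algorithm , λ c d → 10 + (c + d) , 10 + proj₁ (total-linear (c + d)) + reportCost , solve c d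
  where
  solve : ∀ c d (σ : ℕ) (T : Str σ) (w : ℕ) → σ ≤ c * length T ^ d →
    (10 + (c + d)) * suc (length T) ^ (10 + (c + d)) ≤ 2 ^ w →
    let C = 10 + proj₁ (total-linear (c + d)) + reportCost in
    ∃[ s ] ∃[ steps ] ∃[ out ]
    ( Exec w (C * suc (length T)) algorithm (initial w T) s steps out
    × out Enumerates SAGP₂ T
    × steps ≤ C * suc (length T + length out))
  solve c d σ T w σ≤ word =
    finish (Execution.Spec.from
    (Assembly.main-correct T w m reportCost A≤m A≤2^w 2n<2^w ≤-refl {rounds = c + d} (proj₁ (proj₂ bound))
    (proj₂ (proj₂ bound))) agree-start)
    where
    n C₁ C m k : ℕ
    n = length T
    C₁ = proj₁ (total-linear (c + d))
    -- The number of arrays, the constant of the linear time bound, and the charge for a report.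
    C = 10 + C₁ + reportCost
    m = C * suc n
    -- The 10 lets all addresses of the ten arrays fit in a word; as `k` exceeds `c` and is at least
    -- `d`, every letter fits as well.
    k = 10 + (c + d)
    bound : ∃[ S ] ((∀ {a} → In n a → cell T a ≤ S) × S < suc n ^ (c + d))
    bound = letter-bound T c d σ≤
    A≤m : 10 * suc n ≤ m
    A≤m = *-monoˡ-≤ (suc n) (≤-trans (m≤m+n 10 C₁) (m≤m+n (10 + C₁) reportCost))
    A≤2^w : 10 * suc n ≤ 2 ^ w
    A≤2^w = ≤-trans (*-mono-≤ (m≤m+n 10 (c + d))
      (m≤m*n (suc n) (suc n ^ (9 + (c + d))) {{m^n≢0 (suc n) (9 + (c + d))}})) word
    2n<2^w : suc n + suc n < 2 ^ w
    2n<2^w = lia 2 (λ n x → 10 :* (lit 1 :+ n) :≤ x ∷ [] ⊢ lit 1 :+ n :+ (lit 1 :+ n) :< x) n (2 ^ w) A≤2^w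
    σ<2^w : σ < 2 ^ w
    σ<2^w = begin-strict
      σ                ≤⟨ σ≤ ⟩
      c * n ^ d        ≤⟨ *-monoʳ-≤ c
        (≤-trans (^-monoˡ-≤ d (n≤1+n n)) (^-monoʳ-≤ (suc n) (≤-trans (m≤n+m d c) (m≤n+m (c + d) 10)))) ⟩
      c * suc n ^ k    <⟨ *-monoˡ-< (suc n ^ k) {{m^n≢0 (suc n) k}} (s≤s (≤-trans (m≤m+n c d) (m≤n+m (c + d) 9))) ⟩
      k * suc n ^ k    ≤⟨ word ⟩
      2 ^ w            ∎
      where open ≤-Reasoning
    open Algorithm.Semantics n using (module Execution)
    open Initial T w m A≤m A≤2^w 2n<2^w σ<2^w
    finish : Execution.Run w m reportCost A≤m A≤2^w 2n<2^w main _
      (Assembly.Outcome T w m reportCost A≤m A≤2^w 2n<2^w ≤-refl) _ _ → _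
    finish (Execution.ran run steps≤ _ out-correct) = _ , _ , _ , seq run-start run , out-correct ,
      budget C₁ reportCost n (≤-trans steps≤ (+-monoˡ-≤ _ (proj₂ (total-linear (c + d)) n)))
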